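{- Let $p,q$ be distinct odd primes and $\alpha,\beta$ positive integers. Then $$\sum_{\substack{i+j+k=p^{\alpha}q^{\beta}\\ i,j,k\in\mathcal{P}_{pq}\\ i\equiv j\equiv k\equiv 1 \pmod 2}}\frac{1}{ijk}\equiv\frac{7}{16}Z(p^{\alpha}q^{\beta})\equiv \frac{7}{8}(2-q)\Bigl(1-\frac{1}{q^{3}}\Bigr)p^{\alpha-1}q^{\beta-1}B_{p-3}\pmod{p^{\alpha}}.$$
   Context: For a positive integer $n$, $\mathcal{P}_n$ denotes the set of positive integers coprime to $n$, and $Z(n)=\sum_{i+j+k=n,\ i,j,k\in\mathcal{P}_n}\frac{1}{ijk}$. All sums are over ordered triples $(i,j,k)$ of positive integers. The Bernoulli numbers $B_k$ are defined by $B_0=1$ and $\sum_{i=0}^{n}\binom{n+1}{i}B_i=0$ for $n\ge1$. A congruence between rational numbers modulo $p^{\alpha}$ means that the difference, written in lowest terms, has numerator divisible by $p^{\alpha}$ and denominator coprime to $p$. -}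

module Defs where

open import Data.Bool using (Bool; true; false; if_then_else_; _∧_)
open import Data.Nat as ℕ using (ℕ; zero; suc; _∸_; _%_)
open import Data.Nat.Coprimality using (Coprime; coprime?)
open import Data.Nat.Combinatorics using (_C_)
open import Data.Nat.Divisibility using (_∣_)
open import Data.Fin using (Fin; toℕ)
open import Data.List using (List; map; upTo; foldr)
open import Data.Vec using (Vec; []; _∷_; _∷ʳ_; lookup; allFin)
import Data.Vec as Vec
open import Data.Integer as ℤ using (+_)
open import Data.Rational using (ℚ; 0ℚ; 1ℚ; _+_; _*_; _-_; -_; _/_; ↥_; ↧ₙ_)
open import Data.Product using (_×_)
open import Relation.Nullary.Decidable using (⌊_⌋)

-- 1/n as a rational (with the junk value 1/0 := 0, never used below)
recip : ℕ → ℚ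
recip zero    = 0ℚ
recip (suc n) = + 1 / suc n

ℕtoℚ : ℕ → ℚ
ℕtoℚ n = + n / 1

-- Bernoulli numbers B_0 … B_n, via B_0 = 1 and
-- Σ_{i=0}^{m} C(m+1,i) B_i = 0 for m ≥ 1, i.e.
-- B_{n+1} = -(1/(n+2)) Σ_{i=0}^{n} C(n+2,i) B_i.
bernoulliVec : (n : ℕ) → Vec ℚ (suc n)
bernoulliVec zero    = 1ℚ ∷ []
bernoulliVec (suc n) = bs ∷ʳ (- (recip (suc (suc n)) * s))
  where
  bs : Vec ℚ (suc n)
  bs = bernoulliVec n
  s : ℚ
  s = Vec.foldr _ (λ (i : Fin (suc n)) acc →
        ℕtoℚ (suc (suc n) C toℕ i) * lookup bs i + acc) 0ℚ (allFin (suc n))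

bernoulli : ℕ → ℚ
bernoulli n = Vec.last (bernoulliVec n)

-- Sum of f i j k over ordered triples (i,j,k) of positive integers
-- with i + j + k = n and P i j k = true.
-- i ranges over 1..n-2, j over 1..n-i-1, and k = n - i - j ≥ 1.
sumList : List ℚ → ℚ
sumList = foldr _+_ 0ℚ

tripleSum : (n : ℕ) → (ℕ → ℕ → ℕ → Bool) → (ℕ → ℕ → ℕ → ℚ) → ℚ
tripleSum n P f =
  sumList (map (λ i →
    sumList (map (λ j →
      let k = n ∸ i ∸ j in
      if P i j k then f i j k else 0ℚ)
      (map suc (upTo (n ∸ i ∸ 1)))))
    (map suc (upTo (n ∸ 2))))

inP : ℕ → ℕ → Bool
inP m i = ⌊ coprime? i m ⌋

isOdd : ℕ → Bool
isOdd i = ⌊ i % 2 ℕ.≟ 1 ⌋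

recip3 : ℕ → ℕ → ℕ → ℚ
recip3 i j k = recip i * recip j * recip k

Z : ℕ → ℚ
Z n = tripleSum n (λ i j k → inP n i ∧ inP n j ∧ inP n k) recip3

_≡_[modℚ_^_] : ℚ → ℚ → ℕ → ℕ → Set
x ≡ y [modℚ p ^ α ] =
  (p ℕ.^ α ∣ ℤ.∣ ↥ (x - y) ∣) × Coprime p (↧ₙ (x - y))

-- Put n = pᵅqᵝ and work modulo pᵅ in ℤ₍ₚ₎.  Split the triples i + j + k = n by parity, and independently by
-- whether an entry exceeds n/2.  Since n − 2a ≡ −2a and n − a ≡ −a, every part is a multiple of the odd sum S
-- or of D = Σ 1/(ab(a+b)) over a + b < n/2, namely Z ≡ S − (3/8)D and Z ≡ −8S − 3D.  Hence 16S ≡ 7Z and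
-- 9Z ≡ −6D; the latter holds modulo 3pᵅ, so that 3Z ≡ −2D also for p = 3.
-- With J(l) = Σ 1/(bc) over b + c = l this gives −2Z ≡ Σ_{e<n/2} (J(e) + J(n−e))/e.  Here J(e) + J(n−e) is 2/e
-- times a sum over all residues mod n, which the Chinese remainder theorem evaluates as −p^(α−1)q^(β−1)(q−2)/e.
-- Because of the factor p^(α−1), the remaining sum Σ_{e<n/2} 1/e³ matters only modulo p, where it is
-- (1 − q⁻³) Σ_{e<p/2} 1/e³.  Finally Σ_{e<p/2} 1/e³ ≡ −2B_{p−3} follows by splitting Σ_{x<p} x^(p−3) ≡ pB_{p−3}
-- (mod p²) by parity and by size.
module Submission where

open import Defs
import Data.Nat.Properties as ℕ
import Data.Integer.Properties as ℤ
import Data.Rational.Properties as ℚ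
import Data.Rational.Unnormalised.Properties as ℚᵘ
open import Relation.Binary.PropositionalEquality
import Relation.Binary.Reasoning.Setoid as SetoidReasoning
open import Data.Nat.Tactic.RingSolver using () renaming (solve-∀ to solve-∀ℕ)
open import Data.Bool using (Bool; true; false; if_then_else_; _∧_)
open import Data.Bool.Properties using (∧-identityʳ)
open import Data.Nat as ℕ using (ℕ; zero; suc; _≤_; _<_; _∸_; z≤n; s≤s; _!)
open import Data.Integer as ℤ using (ℤ)
open import Data.Rational.Unnormalised as ℚᵘ using (mkℚᵘ; *≡*; _≃_)
open import Data.Product using (_×_; _,_; ∃; proj₁; proj₂)
open import Function using (_∘_)
open import Relation.Nullary using (Dec; yes; no; ¬_; does; contradiction)
open import Relation.Nullary.Decidable using (dec⇒maybe; dec-true; dec-false; _×-dec_; ¬?; from-yes; ⌊_⌋)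
open import Tactic.RingSolver using (solve-∀)
open import Tactic.RingSolver.Core.AlmostCommutativeRing using (AlmostCommutativeRing; fromCommutativeRing)
open import Data.Sum using (inj₁; inj₂; [_,_]′; _⊎_)
open import Data.Nat.Divisibility using (_∣_; divides; ∣-trans; ∣⇒≤; _∣0; m∣m*n; n∣m*n; ∣m⇒∣m*n; ∣n⇒∣m*n; _∣?_; ∣m+n∣m⇒∣n; ∣m∣n⇒∣m+n; n∣n; n∣m⇒m%n≡0; >⇒∤)
open import Data.Nat.Primality using (Prime; euclidsLemma; prime⇒nonTrivial; prime⇒nonZero; prime⇒irreducible; prime?)
open import Data.Nat.Coprimality as Coprimality using (Coprime; coprime-divisor; coprime?; coprime-Bézout)
open import Relation.Binary.Bundles using (Setoid)
open import Data.List using (map; applyUpTo)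
open import Data.Nat.DivMod using (_%_; m≡m%n+[m/n]*n; m%n<n; [m+kn]%n≡m%n; m/n*n≡m)
open import Data.Nat.GCD using (module Bézout)
open import Data.Fin using (Fin; toℕ)
open import Data.Nat.Combinatorics using (_C_; nCk≡nC[n∸k]; nCn≡1; nC1≡n; k>n⇒nCk≡0; nCk+nC[k+1]≡[n+1]C[k+1]; nCk≡n!/k![n-k]!; k![n∸k]!∣n!)
open import Data.Nat.Properties using (_!*_!≢0)
open import Data.Vec as Vec using (Vec; []; _∷_; _∷ʳ_; lookup; tabulate)
open import Data.Vec.Properties using (last-∷ʳ)

-- A sum over entries below n/2 does not run over complete residue classes, so J(e) alone cannot be
-- evaluated. Partial fractions, 1/(bc) = (1/e)(1/b + 1/c), turn it into 2/e times a sum over b < e,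
-- and the reflected J(n - e) supplies the residues from e to n. This is why Z + 2D is formed: in it
-- e and n - e occur together with the same weight 1/e, and 3Z + 2D ≡ 0 makes it -2Z. For p = 3,
-- dividing 9Z + 6D by 3 would lose a factor p. Two of the three congruences behind it enter
-- multiplied by 3; only the one comparing odd with small triples has to gain the factor 3 by
-- itself. In the residue sum, q - 2 counts the classes modulo q that avoid 0 and e, and -p^(α-1)/e
-- is what is left when the class of e modulo p is removed from a sum of inverses that vanishes
-- modulo p^α. The Bernoulli number enters through two expressions for one power sum, both
-- containing the unknown half sum of x^(p-3). Eliminating it leaves p times the half sum of
-- x^(p-4), that is of 1/x³; as this p is divided out, the power sums are needed modulo p².

module TripleReciprocalSums where
  open import Data.Rational using (ℚ; mkℚ; 0ℚ; 1ℚ; _+_; _*_; _-_; -_; _/_; toℚᵘ; ↥_; ↧_; ↧ₙ_)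

  -- Integers and reciprocals inside ℚ.

  ℚ-ring : AlmostCommutativeRing _ _
  ℚ-ring = fromCommutativeRing ℚ.+-*-commutativeRing λ x → dec⇒maybe (0ℚ ℚ.≟ x)

  ι : ℤ → ℚ
  ι a = a / 1

  toℚᵘ-ι : ∀ a → toℚᵘ (ι a) ≃ mkℚᵘ a 0
  toℚᵘ-ι a = ℚ.toℚᵘ-fromℚᵘ (mkℚᵘ a 0)

  ι-+ : ∀ a b → ι (a ℤ.+ b) ≡ ι a + ι b
  ι-+ a b = ℚ.toℚᵘ-injective (ℚᵘ.≃-trans (toℚᵘ-ι (a ℤ.+ b)) (ℚᵘ.≃-trans
    (*≡* (cong (ℤ._* ℤ.+ 1) (cong₂ ℤ._+_ (sym (ℤ.*-identityʳ a)) (sym (ℤ.*-identityʳ b)))))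
    (ℚᵘ.≃-sym (ℚᵘ.≃-trans (ℚ.toℚᵘ-homo-+ (ι a) (ι b)) (ℚᵘ.+-cong (toℚᵘ-ι a) (toℚᵘ-ι b))))))

  ι-* : ∀ a b → ι (a ℤ.* b) ≡ ι a * ι b
  ι-* a b = ℚ.toℚᵘ-injective (ℚᵘ.≃-trans (toℚᵘ-ι (a ℤ.* b)) (ℚᵘ.≃-trans
    (*≡* refl)
    (ℚᵘ.≃-sym (ℚᵘ.≃-trans (ℚ.toℚᵘ-homo-* (ι a) (ι b)) (ℚᵘ.*-cong (toℚᵘ-ι a) (toℚᵘ-ι b))))))

  ι-neg : ∀ a → ι (ℤ.- a) ≡ - ι a
  ι-neg a = ℚ.toℚᵘ-injective (ℚᵘ.≃-trans (toℚᵘ-ι (ℤ.- a))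
    (ℚᵘ.≃-sym (ℚᵘ.≃-trans (ℚ.toℚᵘ-homo‿- (ι a)) (ℚᵘ.-‿cong (toℚᵘ-ι a)))))

  ι-injective : ∀ a b → ι a ≡ ι b → a ≡ b
  ι-injective a b eq with ℚᵘ.≃-trans (ℚᵘ.≃-sym (toℚᵘ-ι a)) (ℚᵘ.≃-trans (ℚᵘ.≃-reflexive (cong toℚᵘ eq)) (toℚᵘ-ι b))
  ... | *≡* e = trans (sym (ℤ.*-identityʳ a)) (trans e (ℤ.*-identityʳ b))

  ι-↧ : ∀ z → z * ι (↧ z) ≡ ι (↥ z)
  ι-↧ z = ℚ.toℚᵘ-injective (ℚᵘ.≃-trans (ℚ.toℚᵘ-homo-* z (ι (↧ z))) (ℚᵘ.≃-trans
    (ℚᵘ.*-congˡ {toℚᵘ z} (toℚᵘ-ι (↧ z))) (ℚᵘ.≃-trans (lem z) (ℚᵘ.≃-sym (toℚᵘ-ι (↥ z))))))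
    where
    lem : ∀ z → toℚᵘ z ℚᵘ.* mkℚᵘ (↧ z) 0 ≃ mkℚᵘ (↥ z) 0
    lem (mkℚ a d _) = *≡* (trans (ℤ.*-identityʳ _) (cong (a ℤ.*_) (cong ℤ.+_ (sym (ℕ.*-identityʳ (suc d))))))

  # : ℕ → ℚ
  # = ℕtoℚ

  #-+ : ∀ m n → # (m ℕ.+ n) ≡ # m + # n
  #-+ m n = trans (cong ι (ℤ.pos-+ m n)) (ι-+ (ℤ.+ m) (ℤ.+ n))

  #-* : ∀ m n → # (m ℕ.* n) ≡ # m * # n
  #-* m n = trans (cong ι (ℤ.pos-* m n)) (ι-* (ℤ.+ m) (ℤ.+ n))

  #-suc : ∀ n → # (suc n) ≡ 1ℚ + # n
  #-suc n = #-+ 1 n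

  #-∸ : ∀ {m n} → n ≤ m → # (m ∸ n) ≡ # m - # n
  #-∸ {m} {n} n≤m = trans (alg (# (m ∸ n)) (# n)) (cong (_- # n) (trans (sym (#-+ (m ∸ n) n)) (cong # (ℕ.m∸n+n≡m n≤m))))
    where
    alg : ∀ x y → x ≡ x + y - y
    alg = solve-∀ ℚ-ring

  recip-inverse : ∀ n .{{_ : ℕ.NonZero n}} → # n * recip n ≡ 1ℚ
  recip-inverse (suc n) = ℚ.toℚᵘ-injective (ℚᵘ.≃-trans (ℚ.toℚᵘ-homo-* (# (suc n)) (recip (suc n)))
    (ℚᵘ.≃-trans (ℚᵘ.*-cong (toℚᵘ-ι (ℤ.+ suc n)) (ℚ.toℚᵘ-fromℚᵘ (mkℚᵘ (ℤ.+ 1) n)))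
    (*≡* (trans (ℤ.*-identityʳ _) (trans (ℤ.*-identityʳ _) (cong ℤ.+_ (sym (trans (ℕ.+-identityʳ _) (ℕ.+-identityʳ _)))))))))

  recip-unique : ∀ n x → # n * x ≡ 1ℚ → x ≡ recip n
  recip-unique zero x eq = contradiction (trans (sym (ℚ.*-zeroˡ x)) eq) λ ()
  recip-unique n@(suc _) x eq = begin
    x                    ≡⟨ sym (ℚ.*-identityˡ x) ⟩
    1ℚ * x               ≡⟨ cong (_* x) (sym (recip-inverse n)) ⟩
    # n * recip n * x    ≡⟨ alg (# n) (recip n) x ⟩
    recip n * (# n * x)  ≡⟨ cong (recip n *_) eq ⟩
    recip n * 1ℚ         ≡⟨ ℚ.*-identityʳ _ ⟩
    recip n              ∎
    where
    open ≡-Reasoning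
    alg : ∀ a b c → a * b * c ≡ b * (a * c)
    alg = solve-∀ ℚ-ring

  recip-* : ∀ m n → recip (m ℕ.* n) ≡ recip m * recip n
  recip-* zero n = sym (ℚ.*-zeroˡ (recip n))
  recip-* (suc m) zero = trans (cong recip (ℕ.*-zeroʳ m)) (sym (ℚ.*-zeroʳ (recip (suc m))))
  recip-* m@(suc _) n@(suc _) = sym (recip-unique (m ℕ.* n) _ (begin
    # (m ℕ.* n) * (recip m * recip n)    ≡⟨ cong (_* (recip m * recip n)) (#-* m n) ⟩
    # m * # n * (recip m * recip n)      ≡⟨ alg (# m) (# n) (recip m) (recip n) ⟩
    (# m * recip m) * (# n * recip n)    ≡⟨ cong₂ _*_ (recip-inverse m) (recip-inverse n) ⟩
    1ℚ * 1ℚ                              ≡⟨⟩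
    1ℚ                                   ∎))
    where
    open ≡-Reasoning
    alg : ∀ a b c d → a * b * (c * d) ≡ (a * c) * (b * d)
    alg = solve-∀ ℚ-ring

  -- Finite sums over initial segments of ℕ.

  opaque
    ∑ : ℕ → (ℕ → ℚ) → ℚ
    ∑ zero    f = 0ℚ
    ∑ (suc n) f = ∑ n f + f n

  syntax ∑ n (λ i → e) = ∑[ i < n ] e
  infix 5 ∑

  opaque
    unfolding ∑

    ∑-cong : ∀ n {f g} → (∀ i → i < n → f i ≡ g i) → ∑ n f ≡ ∑ n g
    ∑-cong zero    eq = refl
    ∑-cong (suc n) eq = cong₂ _+_ (∑-cong n λ i i<n → eq i (ℕ.m<n⇒m<1+n i<n)) (eq n ℕ.≤-refl)

    ∑-0 : ∀ n {f} → (∀ i → i < n → f i ≡ 0ℚ) → ∑ n f ≡ 0ℚ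
    ∑-0 zero    eq = refl
    ∑-0 (suc n) eq = cong₂ _+_ (∑-0 n λ i i<n → eq i (ℕ.m<n⇒m<1+n i<n)) (eq n ℕ.≤-refl)

    ∑-+ : ∀ n f g → (∑[ i < n ] (f i + g i)) ≡ ∑ n f + ∑ n g
    ∑-+ zero    f g = refl
    ∑-+ (suc n) f g = trans (cong (_+ (f n + g n)) (∑-+ n f g)) (alg (∑ n f) (∑ n g) (f n) (g n))
      where
      alg : ∀ a b c d → a + b + (c + d) ≡ a + c + (b + d)
      alg = solve-∀ ℚ-ring

    ∑-*ˡ : ∀ c n f → (∑[ i < n ] (c * f i)) ≡ c * ∑ n f
    ∑-*ˡ c zero    f = sym (ℚ.*-zeroʳ c)
    ∑-*ˡ c (suc n) f = trans (cong (_+ c * f n) (∑-*ˡ c n f)) (sym (ℚ.*-distribˡ-+ c _ _))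

  ∑-*ʳ : ∀ c n f → (∑[ i < n ] (f i * c)) ≡ ∑ n f * c
  ∑-*ʳ c n f = trans (∑-cong n λ i _ → ℚ.*-comm (f i) c) (trans (∑-*ˡ c n f) (ℚ.*-comm c _))

  opaque
    unfolding ∑

    ∑-const : ∀ n c → (∑[ i < n ] c) ≡ # n * c
    ∑-const zero    c = sym (ℚ.*-zeroˡ c)
    ∑-const (suc n) c = trans (cong (_+ c) (∑-const n c)) (trans (alg (# n) c) (cong (_* c) (sym (#-suc n))))
      where
      alg : ∀ a b → a * b + b ≡ (1ℚ + a) * b
      alg = solve-∀ ℚ-ring

    ∑-swap : ∀ m n (f : ℕ → ℕ → ℚ) → (∑[ i < m ] ∑[ j < n ] f i j) ≡ (∑[ j < n ] ∑[ i < m ] f i j)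
    ∑-swap zero    n f = sym (∑-0 n λ _ _ → refl)
    ∑-swap (suc m) n f = trans (cong (_+ ∑ n (f m)) (∑-swap m n f)) (sym (∑-+ n _ (f m)))

    ∑-split : ∀ m n f → ∑ (m ℕ.+ n) f ≡ ∑ m f + (∑[ i < n ] f (m ℕ.+ i))
    ∑-split m zero    f = trans (cong (λ k → ∑ k f) (ℕ.+-identityʳ m)) (sym (ℚ.+-identityʳ (∑ m f)))
    ∑-split m (suc n) f = trans (cong (λ k → ∑ k f) (ℕ.+-suc m n))
      (trans (cong (_+ f (m ℕ.+ n)) (∑-split m n f)) (ℚ.+-assoc (∑ m f) (∑[ i < n ] f (m ℕ.+ i)) (f (m ℕ.+ n))))

  opaque
    unfolding ∑

    ∑-suc : ∀ n f → ∑ (suc n) f ≡ ∑ n f + f n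
    ∑-suc n f = refl

    ∑-1 : ∀ f → ∑ 1 f ≡ f 0
    ∑-1 f = ℚ.+-identityˡ (f 0)

    ∑-head : ∀ n f → ∑ (suc n) f ≡ f 0 + ∑ n (f ∘ suc)
    ∑-head n f = trans (∑-split 1 n f) (cong (_+ ∑ n (f ∘ suc)) (ℚ.+-identityˡ (f 0)))

    ∑-reverse : ∀ n f → (∑[ i < suc n ] f (n ∸ i)) ≡ ∑ (suc n) f
    ∑-reverse zero    f = refl
    ∑-reverse (suc n) f = trans (∑-head (suc n) (λ i → f (suc n ∸ i)))
      (trans (cong (_+_ (f (suc n))) (∑-reverse n f)) (ℚ.+-comm (f (suc n)) (∑ (suc n) f)))

    ∑-block : ∀ M a f → ∑ (M ℕ.* a) f ≡ (∑[ x < M ] ∑[ z < a ] f (x ℕ.* a ℕ.+ z))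
    ∑-block zero    a f = refl
    ∑-block (suc M) a f = trans (cong (λ k → ∑ k f) (ℕ.+-comm a (M ℕ.* a)))
      (trans (∑-split (M ℕ.* a) a f) (cong (_+ (∑[ z < a ] f (M ℕ.* a ℕ.+ z))) (∑-block M a f)))

  ∑-extend : ∀ {m n} → m ≤ n → ∀ f → (∀ i → m ≤ i → i < n → f i ≡ 0ℚ) → ∑ n f ≡ ∑ m f
  ∑-extend {m} {n} m≤n f eq = begin
    ∑ n f                                   ≡⟨ cong (λ k → ∑ k f) (sym (ℕ.m+[n∸m]≡n m≤n)) ⟩
    ∑ (m ℕ.+ (n ∸ m)) f                     ≡⟨ ∑-split m (n ∸ m) f ⟩
    ∑ m f + (∑[ i < n ∸ m ] f (m ℕ.+ i))    ≡⟨ cong (∑ m f +_) (∑-0 (n ∸ m) λ i i<n∸m → eq (m ℕ.+ i) (ℕ.m≤m+n m i) (subst (m ℕ.+ i <_) (ℕ.m+[n∸m]≡n m≤n) (ℕ.+-monoʳ-< m i<n∸m))) ⟩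
    ∑ m f + 0ℚ                              ≡⟨ ℚ.+-identityʳ _ ⟩
    ∑ m f                                   ∎
    where open ≡-Reasoning

  -- The Iverson bracket. A condition such as i + j + k = n becomes a factor of the summand, so that
  -- sums run over full boxes and can be permuted freely.
  ⟦_⟧ : ∀ {a} {A : Set a} → Dec A → ℚ
  ⟦ d ⟧ = if does d then 1ℚ else 0ℚ

  module _ {a} {A : Set a} where
    ⟦⟧-yes : (d : Dec A) → A → ⟦ d ⟧ ≡ 1ℚ
    ⟦⟧-yes d x = cong (if_then 1ℚ else 0ℚ) (dec-true d x)

    ⟦⟧-no : (d : Dec A) → ¬ A → ⟦ d ⟧ ≡ 0ℚ
    ⟦⟧-no d ¬x = cong (if_then 1ℚ else 0ℚ) (dec-false d ¬x)

    ⟦⟧-*-yes : (d : Dec A) → A → ∀ x → ⟦ d ⟧ * x ≡ x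
    ⟦⟧-*-yes d a x = trans (cong (_* x) (⟦⟧-yes d a)) (ℚ.*-identityˡ x)

    ⟦⟧-*-no : (d : Dec A) → ¬ A → ∀ x → ⟦ d ⟧ * x ≡ 0ℚ
    ⟦⟧-*-no d ¬a x = trans (cong (_* x) (⟦⟧-no d ¬a)) (ℚ.*-zeroˡ x)

    ⟦⟧-cong : ∀ {b} {B : Set b} (d : Dec A) (e : Dec B) → (A → B) → (B → A) → ⟦ d ⟧ ≡ ⟦ e ⟧
    ⟦⟧-cong (yes x) e f g = sym (cong (if_then 1ℚ else 0ℚ) (dec-true e (f x)))
    ⟦⟧-cong (no ¬x) e f g = sym (cong (if_then 1ℚ else 0ℚ) (dec-false e (¬x ∘ g)))

  ∑-indicator-none : ∀ n {P : ℕ → Set} (P? : ∀ i → Dec (P i)) →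
    (∀ {i} → i < n → ¬ P i) → ∀ (f : ℕ → ℚ) → (∑[ i < n ] (⟦ P? i ⟧ * f i)) ≡ 0ℚ
  ∑-indicator-none n P? none f = ∑-0 n λ i i<n → ⟦⟧-*-no (P? i) (none i<n) (f i)

  opaque
    unfolding ∑

    -- Uniqueness is asked only below n, because the typical predicate, divisibility by a prime, has
    -- further solutions beyond one period.
    ∑-indicator : ∀ {n k} → k < n → ∀ {P : ℕ → Set} (P? : ∀ i → Dec (P i)) →
      (∀ {i} → i < n → P i → i ≡ k) → P k → ∀ (f : ℕ → ℚ) → (∑[ i < n ] (⟦ P? i ⟧ * f i)) ≡ f k
    ∑-indicator {suc n} {k} k<1+n P? unique Pk f with k ℕ.≟ n
    ... | yes refl = trans
            (cong₂ _+_ (∑-indicator-none n P? (λ i<n Pi → ℕ.<-irrefl (unique (ℕ.m<n⇒m<1+n i<n) Pi) i<n) f)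
                       (⟦⟧-*-yes (P? k) Pk (f k)))
            (ℚ.+-identityˡ (f k))
    ... | no k≢n = trans
            (cong₂ _+_ (∑-indicator (ℕ.≤∧≢⇒< (ℕ.≤-pred k<1+n) k≢n) P? (λ i<n → unique (ℕ.m<n⇒m<1+n i<n)) Pk f)
                       (⟦⟧-*-no (P? n) (λ Pn → k≢n (sym (unique ℕ.≤-refl Pn))) (f n)))
            (ℚ.+-identityʳ (f k))

  -- Coprimality and numerators in lowest terms.

  prime∤1 : ∀ {p} → Prime p → ¬ p ∣ 1
  prime∤1 pp p∣1 = ℕ.<⇒≱ (ℕ.nonTrivial⇒n>1 _ {{prime⇒nonTrivial pp}}) (∣⇒≤ p∣1)

  ∤⇒coprime : ∀ {p n} → Prime p → ¬ p ∣ n → Coprime p n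
  ∤⇒coprime pp p∤n (d∣p , d∣n) with prime⇒irreducible pp d∣p
  ... | inj₁ d≡1 = d≡1
  ... | inj₂ refl = contradiction d∣n p∤n

  coprime-^ : ∀ {m n} k → Coprime m n → Coprime (m ℕ.^ k) n
  coprime-^ zero    c = Coprimality.1-coprimeTo _
  coprime-^ (suc k) c (d∣m^k , d∣n) = coprime-^ k c
    (coprime-divisor (λ (e∣d , e∣m) → c (e∣m , ∣-trans e∣d d∣n)) d∣m^k , d∣n)

  ∤-nonZero : ∀ {p n} → ¬ p ∣ n → ℕ.NonZero n
  ∤-nonZero {p} {zero}  p∤0 = contradiction (p ∣0) p∤0
  ∤-nonZero {p} {suc _} _   = _

  -- Multiplies out two denominators at once: the reduced one of z and the arbitrary d of q.
  -- Absolute values suffice, since only divisibility is read off.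
  clear-denominators : ∀ z q (M d : ℕ) a → z ≡ # M * q → q * # d ≡ ι a → ℤ.∣ ↥ z ∣ ℕ.* d ≡ M ℕ.* ℤ.∣ a ∣ ℕ.* ↧ₙ z
  clear-denominators z q M d a z≡Mq qd≡a = trans (sym (ℤ.abs-* (↥ z) (ℤ.+ d)))
    (trans (cong ℤ.∣_∣ (ι-injective (↥ z ℤ.* ℤ.+ d) (ℤ.+ M ℤ.* a ℤ.* ↧ z) in-ℚ))
    (trans (ℤ.abs-* (ℤ.+ M ℤ.* a) (↧ z)) (cong (ℕ._* ↧ₙ z) (ℤ.abs-* (ℤ.+ M) a))))
    where
    open ≡-Reasoning
    alg : ∀ m q d e → m * q * d * e ≡ m * (q * d) * e
    alg = solve-∀ ℚ-ring
    alg₂ : ∀ z d e → z * d * e ≡ z * e * d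
    alg₂ = solve-∀ ℚ-ring
    in-ℚ : ι (↥ z ℤ.* ℤ.+ d) ≡ ι (ℤ.+ M ℤ.* a ℤ.* ↧ z)
    in-ℚ = begin
      ι (↥ z ℤ.* ℤ.+ d)          ≡⟨ ι-* (↥ z) (ℤ.+ d) ⟩
      ι (↥ z) * # d              ≡⟨ cong (_* # d) (sym (ι-↧ z)) ⟩
      z * ι (↧ z) * # d          ≡⟨ alg₂ z (ι (↧ z)) (# d) ⟩
      z * # d * ι (↧ z)          ≡⟨ cong (λ w → w * # d * ι (↧ z)) z≡Mq ⟩
      # M * q * # d * ι (↧ z)    ≡⟨ alg (# M) q (# d) (ι (↧ z)) ⟩
      # M * (q * # d) * ι (↧ z)  ≡⟨ cong (λ w → # M * w * ι (↧ z)) qd≡a ⟩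
      # M * ι a * ι (↧ z)        ≡⟨ cong (_* ι (↧ z)) (sym (ι-* (ℤ.+ M) a)) ⟩
      ι (ℤ.+ M ℤ.* a) * ι (↧ z)  ≡⟨ sym (ι-* (ℤ.+ M ℤ.* a) (↧ z)) ⟩
      ι (ℤ.+ M ℤ.* a ℤ.* ↧ z)    ∎

  numerator-denominator-coprime : ∀ z → Coprime ℤ.∣ ↥ z ∣ (↧ₙ z)
  numerator-denominator-coprime (mkℚ _ _ c) = Coprimality.recompute c

  -- p^k is coprime to d, hence divides u. If p divided v, it would divide u · d and so u, against
  -- lowest terms.
  prime-power-∣-numerator : ∀ {p} → Prime p → ∀ k {u v d a} → ¬ p ∣ d → Coprime u v →
    u ℕ.* d ≡ p ℕ.^ k ℕ.* a ℕ.* v → p ℕ.^ k ∣ u × Coprime p v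
  prime-power-∣-numerator {p} p-prime k {u} {v} {d} {a} p∤d coprime eq =
    coprime-divisor (coprime-^ k (∤⇒coprime p-prime p∤d))
      (subst (p ℕ.^ k ∣_) (trans (sym eq) (ℕ.*-comm u d)) (∣m⇒∣m*n v (m∣m*n a)))
    , ∤⇒coprime p-prime λ p∣v → [ (λ p∣u → prime∤1 p-prime (subst (p ∣_) (coprime (p∣u , p∣v)) (divides 1 (sym (ℕ.*-identityˡ p))))) , p∤d ]′
        (euclidsLemma u d p-prime (subst (p ∣_) (sym eq) (∣n⇒∣m*n (p ℕ.^ k ℕ.* a) p∣v)))

  -- The local ring ℤ₍ₚ₎ and its congruences.

  module Localization (p : ℕ) (p-prime : Prime p) where

    -- The integral elements form the local ring ℤ₍ₚ₎, and x ≈ y [ M ] means x − y ∈ M ℤ₍ₚ₎.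
    record Integral (x : ℚ) : Set where
      constructor integral
      field
        den    : ℕ
        num    : ℤ
        p∤den  : ¬ p ∣ den
        x*den≡ : x * # den ≡ ι num

    infix 4 _≈_[_]
    record _≈_[_] (x y : ℚ) (M : ℕ) : Set where
      constructor congruent
      field
        quotient     : ℚ
        quotient-int : Integral quotient
        x≡y+Mq       : x ≡ y + # M * quotient

    ∤-* : ∀ {m n} → ¬ p ∣ m → ¬ p ∣ n → ¬ p ∣ m ℕ.* n
    ∤-* p∤m p∤n p∣mn = [ p∤m , p∤n ]′ (euclidsLemma _ _ p-prime p∣mn)

    int-ι : ∀ a → Integral (ι a)
    int-ι a = integral 1 a (prime∤1 p-prime) (ℚ.*-identityʳ (ι a))

    int-# : ∀ n → Integral (# n)
    int-# n = int-ι (ℤ.+ n)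

    int-0 : Integral 0ℚ
    int-0 = int-# 0

    int-1 : Integral 1ℚ
    int-1 = int-# 1

    int-+ : ∀ {x y} → Integral x → Integral y → Integral (x + y)
    int-+ {x} {y} (integral d a p∤d xd) (integral e b p∤e ye) = integral (d ℕ.* e) (a ℤ.* ℤ.+ e ℤ.+ b ℤ.* ℤ.+ d) (∤-* p∤d p∤e) (begin
      (x + y) * # (d ℕ.* e)                ≡⟨ cong ((x + y) *_) (#-* d e) ⟩
      (x + y) * (# d * # e)                ≡⟨ alg x y (# d) (# e) ⟩
      x * # d * # e + y * # e * # d        ≡⟨ cong₂ (λ u v → u * # e + v * # d) xd ye ⟩
      ι a * # e + ι b * # d                ≡⟨ sym (cong₂ _+_ (ι-* a (ℤ.+ e)) (ι-* b (ℤ.+ d))) ⟩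
      ι (a ℤ.* ℤ.+ e) + ι (b ℤ.* ℤ.+ d)    ≡⟨ sym (ι-+ (a ℤ.* ℤ.+ e) (b ℤ.* ℤ.+ d)) ⟩
      ι (a ℤ.* ℤ.+ e ℤ.+ b ℤ.* ℤ.+ d)      ∎)
      where
      open ≡-Reasoning
      alg : ∀ x y d e → (x + y) * (d * e) ≡ x * d * e + y * e * d
      alg = solve-∀ ℚ-ring

    int-* : ∀ {x y} → Integral x → Integral y → Integral (x * y)
    int-* {x} {y} (integral d a p∤d xd) (integral e b p∤e ye) = integral (d ℕ.* e) (a ℤ.* b) (∤-* p∤d p∤e) (begin
      x * y * # (d ℕ.* e)    ≡⟨ cong (x * y *_) (#-* d e) ⟩
      x * y * (# d * # e)    ≡⟨ alg x y (# d) (# e) ⟩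
      x * # d * (y * # e)    ≡⟨ cong₂ _*_ xd ye ⟩
      ι a * ι b              ≡⟨ sym (ι-* a b) ⟩
      ι (a ℤ.* b)            ∎)
      where
      open ≡-Reasoning
      alg : ∀ x y d e → x * y * (d * e) ≡ x * d * (y * e)
      alg = solve-∀ ℚ-ring

    int-neg : ∀ {x} → Integral x → Integral (- x)
    int-neg {x} (integral d a p∤d xd) = integral d (ℤ.- a) p∤d
      (trans (sym (ℚ.neg-distribˡ-* x (# d))) (trans (cong -_ xd) (sym (ι-neg a))))

    int-- : ∀ {x y} → Integral x → Integral y → Integral (x - y)
    int-- x y = int-+ x (int-neg y)

    int-recip : ∀ {n} → ¬ p ∣ n → Integral (recip n)
    int-recip {n} p∤n = integral n (ℤ.+ 1) p∤n
      (trans (ℚ.*-comm (recip n) (# n)) (recip-inverse n {{∤-nonZero p∤n}}))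

    int-⟦⟧ : ∀ {a} {A : Set a} (d : Dec A) → Integral ⟦ d ⟧
    int-⟦⟧ d with does d
    ... | true  = int-1
    ... | false = int-0

    opaque
      unfolding ∑

      int-∑ : ∀ n {f} → (∀ i → i < n → Integral (f i)) → Integral (∑ n f)
      int-∑ zero    int = int-0
      int-∑ (suc n) int = int-+ (int-∑ n λ i i<n → int i (ℕ.m<n⇒m<1+n i<n)) (int n ℕ.≤-refl)

    ≈-reflexive : ∀ {x y M} → x ≡ y → x ≈ y [ M ]
    ≈-reflexive {x} {M = M} refl = congruent 0ℚ int-0
      (sym (trans (cong (x +_) (ℚ.*-zeroʳ (# M))) (ℚ.+-identityʳ x)))

    ≈-refl : ∀ {x M} → x ≈ x [ M ]
    ≈-refl = ≈-reflexive refl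

    ≈-sym : ∀ {x y M} → x ≈ y [ M ] → y ≈ x [ M ]
    ≈-sym {x} {y} {M} (congruent q qi eq) = congruent (- q) (int-neg qi)
      (trans (alg y (# M) q) (cong (_+ # M * - q) (sym eq)))
      where
      alg : ∀ y m q → y ≡ y + m * q + m * - q
      alg = solve-∀ ℚ-ring

    ≈-trans : ∀ {x y z M} → x ≈ y [ M ] → y ≈ z [ M ] → x ≈ z [ M ]
    ≈-trans {x} {y} {z} {M} (congruent q qi eq) (congruent r ri eq′) = congruent (r + q) (int-+ ri qi)
      (trans eq (trans (cong (_+ # M * q) eq′) (alg z (# M) r q)))
      where
      alg : ∀ z m r q → z + m * r + m * q ≡ z + m * (r + q)
      alg = solve-∀ ℚ-ring

    ≈-setoid : ℕ → Setoid _ _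
    ≈-setoid M = record
      { Carrier = ℚ
      ; _≈_ = _≈_[ M ]
      ; isEquivalence = record { refl = ≈-refl ; sym = ≈-sym ; trans = ≈-trans }
      }

    module ≈-Reasoning (M : ℕ) = SetoidReasoning (≈-setoid M)

    ≈-+ : ∀ {x y u v M} → x ≈ y [ M ] → u ≈ v [ M ] → x + u ≈ y + v [ M ]
    ≈-+ {x} {y} {u} {v} {M} (congruent q qi eq) (congruent r ri eq′) = congruent (q + r) (int-+ qi ri)
      (trans (cong₂ _+_ eq eq′) (alg y v (# M) q r))
      where
      alg : ∀ y v m q r → y + m * q + (v + m * r) ≡ y + v + m * (q + r)
      alg = solve-∀ ℚ-ring

    ≈-*ˡ : ∀ {c x y M} → Integral c → x ≈ y [ M ] → c * x ≈ c * y [ M ]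
    ≈-*ˡ {c} {x} {y} {M} ci (congruent q qi eq) = congruent (c * q) (int-* ci qi)
      (trans (cong (c *_) eq) (alg c y (# M) q))
      where
      alg : ∀ c y m q → c * (y + m * q) ≡ c * y + m * (c * q)
      alg = solve-∀ ℚ-ring

    ≈-*ʳ : ∀ {c x y M} → Integral c → x ≈ y [ M ] → x * c ≈ y * c [ M ]
    ≈-*ʳ {c} {x} {y} ci x≈y = subst₂ _≈_[ _ ] (ℚ.*-comm c x) (ℚ.*-comm c y) (≈-*ˡ ci x≈y)

    -- From xu - yv = x(u - v) + (x - y)v, whence integrality of x and v in particular.
    ≈-* : ∀ {x y u v M} → Integral x → Integral v → x ≈ y [ M ] → u ≈ v [ M ] → x * u ≈ y * v [ M ]
    ≈-* xi vi x≈y u≈v = ≈-trans (≈-*ˡ xi u≈v) (≈-*ʳ vi x≈y)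

    ≈-neg : ∀ {x y M} → x ≈ y [ M ] → - x ≈ - y [ M ]
    ≈-neg {x} {y} {M} (congruent q qi eq) = congruent (- q) (int-neg qi) (trans (cong -_ eq) (alg y (# M) q))
      where
      alg : ∀ y m q → - (y + m * q) ≡ - y + m * - q
      alg = solve-∀ ℚ-ring

    opaque
      unfolding ∑

      ≈-∑ : ∀ n {f g M} → (∀ i → i < n → f i ≈ g i [ M ]) → ∑ n f ≈ ∑ n g [ M ]
      ≈-∑ zero    eq = ≈-refl
      ≈-∑ (suc n) eq = ≈-+ (≈-∑ n λ i i<n → eq i (ℕ.m<n⇒m<1+n i<n)) (eq n ℕ.≤-refl)

    ≈-coarsen : ∀ {x y M N} → M ∣ N → x ≈ y [ N ] → x ≈ y [ M ]
    ≈-coarsen {y = y} {M} (divides k refl) (congruent q qi eq) = congruent (# k * q) (int-* (int-# k) qi)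
      (trans eq (cong (y +_) (trans (cong (_* q) (#-* k M)) (alg (# k) (# M) q))))
      where
      alg : ∀ k m q → k * m * q ≡ m * (k * q)
      alg = solve-∀ ℚ-ring

    ≈-scale : ∀ c {x y M} → x ≈ y [ M ] → # c * x ≈ # c * y [ c ℕ.* M ]
    ≈-scale c {x} {y} {M} (congruent q qi eq) = congruent q qi
      (trans (cong (# c *_) eq) (trans (alg (# c) y (# M) q) (cong (λ z → # c * y + z * q) (sym (#-* c M)))))
      where
      alg : ∀ c y m q → c * (y + m * q) ≡ c * y + c * m * q
      alg = solve-∀ ℚ-ring

    -- Here p may divide c, at the price of the factor c in the modulus. This is how 3 is divided
    -- out when p = 3 and p in the Bernoulli congruence, where `≈-cancel` does not apply.
    ≈-unscale : ∀ c .{{_ : ℕ.NonZero c}} {x y M} → # c * x ≈ # c * y [ c ℕ.* M ] → x ≈ y [ M ]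
    ≈-unscale c {x} {y} {M} (congruent q qi eq) = congruent q qi (begin
      x                                            ≡⟨ cancel x ⟩
      recip c * (# c * x)                          ≡⟨ cong (recip c *_) eq ⟩
      recip c * (# c * y + # (c ℕ.* M) * q)        ≡⟨ cong (λ z → recip c * (# c * y + z * q)) (#-* c M) ⟩
      recip c * (# c * y + # c * # M * q)          ≡⟨ cong (recip c *_) (alg (# c) y (# M) q) ⟩
      recip c * (# c * (y + # M * q))              ≡⟨ sym (cancel (y + # M * q)) ⟩
      y + # M * q                                  ∎)
      where
      open ≡-Reasoning
      alg : ∀ c y m q → c * y + c * m * q ≡ c * (y + m * q)
      alg = solve-∀ ℚ-ring
      alg₂ : ∀ c r x → c * r * x ≡ r * (c * x)
      alg₂ = solve-∀ ℚ-ring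
      cancel : ∀ z → z ≡ recip c * (# c * z)
      cancel z = trans (sym (ℚ.*-identityˡ z)) (trans (cong (_* z) (sym (recip-inverse c))) (alg₂ (# c) (recip c) z))

    ≈-cancel : ∀ {c x y M} → ¬ p ∣ c → # c * x ≈ # c * y [ M ] → x ≈ y [ M ]
    ≈-cancel {c} {x} {y} p∤c cx≈cy = subst₂ _≈_[ _ ] (cancel x) (cancel y) (≈-*ˡ (int-recip p∤c) cx≈cy)
      where
      alg : ∀ c r x → r * (c * x) ≡ c * r * x
      alg = solve-∀ ℚ-ring
      cancel : ∀ z → recip c * (# c * z) ≡ z
      cancel z = trans (alg (# c) (recip c) z) (trans (cong (_* z) (recip-inverse c {{∤-nonZero p∤c}})) (ℚ.*-identityˡ z))

    -- Because u - v = uv(y - x).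
    ≈-inverse : ∀ {x y u v M} → Integral u → Integral v → x * u ≡ 1ℚ → y * v ≡ 1ℚ → x ≈ y [ M ] → u ≈ v [ M ]
    ≈-inverse {x} {y} {u} {v} ui vi xu yv x≈y = subst₂ _≈_[ _ ]
      (trans (alg u v y) (trans (cong (u *_) yv) (ℚ.*-identityʳ u)))
      (trans (alg₂ u v x) (trans (cong (v *_) xu) (ℚ.*-identityʳ v)))
      (≈-*ˡ (int-* ui vi) (≈-sym x≈y))
      where
      alg : ∀ u v y → u * v * y ≡ u * (y * v)
      alg = solve-∀ ℚ-ring
      alg₂ : ∀ u v x → u * v * x ≡ v * (x * u)
      alg₂ = solve-∀ ℚ-ring

    ≈-recip : ∀ {m n M} → ¬ p ∣ m → ¬ p ∣ n → # m ≈ # n [ M ] → recip m ≈ recip n [ M ]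
    ≈-recip {m} {n} p∤m p∤n = ≈-inverse (int-recip p∤m) (int-recip p∤n)
      (recip-inverse m {{∤-nonZero p∤m}}) (recip-inverse n {{∤-nonZero p∤n}})

    ≈-recip-neg : ∀ {m n M} → ¬ p ∣ m → ¬ p ∣ n → # m ≈ - # n [ M ] → recip m ≈ - recip n [ M ]
    ≈-recip-neg {m} {n} p∤m p∤n = ≈-inverse (int-recip p∤m) (int-neg (int-recip p∤n))
      (recip-inverse m {{∤-nonZero p∤m}})
      (trans (alg (# n) (recip n)) (recip-inverse n {{∤-nonZero p∤n}}))
      where
      alg : ∀ x y → - x * - y ≡ x * y
      alg = solve-∀ ℚ-ring

    multiple≈0 : ∀ {M q} → Integral q → # M * q ≈ 0ℚ [ M ]
    multiple≈0 {M} {q} qi = congruent q qi (sym (ℚ.+-identityˡ (# M * q)))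

    ∣⇒≈0 : ∀ {M n} → M ∣ n → # n ≈ 0ℚ [ M ]
    ∣⇒≈0 {M} (divides k refl) = ≈-trans (≈-reflexive (trans (#-* k M) (ℚ.*-comm (# k) (# M)))) (multiple≈0 (int-# k))

    ≈-by-difference : ∀ {x y M} → x - y ≈ 0ℚ [ M ] → x ≈ y [ M ]
    ≈-by-difference {x} {y} {M} (congruent q qi eq) = congruent q qi
      (trans (alg x y) (cong (y +_) (trans eq (ℚ.+-identityˡ (# M * q)))))
      where
      alg : ∀ x y → x ≡ y + (x - y)
      alg = solve-∀ ℚ-ring

    -- The bridge to reduced fractions: everything before it works with arbitrary representations
    -- whose denominator is prime to p.
    ≈⇒≡-mod : ∀ {x y} k → x ≈ y [ p ℕ.^ k ] → x ≡ y [modℚ p ^ k ]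
    ≈⇒≡-mod {x} {y} k (congruent q (integral d a p∤d qd) eq) =
      prime-power-∣-numerator p-prime k {d = d} {ℤ.∣ a ∣} p∤d (numerator-denominator-coprime (x - y))
        (clear-denominators (x - y) q (p ℕ.^ k) d a (trans (cong (_- y) eq) (alg y (# (p ℕ.^ k) * q))) qd)
      where
      alg : ∀ y m → y + m - y ≡ m
      alg = solve-∀ ℚ-ring

  -- Triple sums over a box and their symmetries.

  ∑³ : ℕ → (ℕ → ℕ → ℕ → ℚ) → ℚ
  ∑³ n F = ∑[ i < n ] ∑[ j < n ] ∑[ k < n ] F i j k

  ∑³-cong : ∀ n {F G} → (∀ i j k → i < n → j < n → k < n → F i j k ≡ G i j k) → ∑³ n F ≡ ∑³ n G
  ∑³-cong n eq = ∑-cong n λ i i<n → ∑-cong n λ j j<n → ∑-cong n λ k k<n → eq i j k i<n j<n k<n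

  ∑³-+ : ∀ n F G → ∑³ n (λ i j k → F i j k + G i j k) ≡ ∑³ n F + ∑³ n G
  ∑³-+ n F G = trans (∑-cong n λ i _ → trans (∑-cong n λ j _ → ∑-+ n (F i j) (G i j))
      (∑-+ n (λ j → ∑ n (F i j)) (λ j → ∑ n (G i j))))
    (∑-+ n (λ i → ∑[ j < n ] ∑ n (F i j)) (λ i → ∑[ j < n ] ∑ n (G i j)))

  ∑³-*ˡ : ∀ c n F → ∑³ n (λ i j k → c * F i j k) ≡ c * ∑³ n F
  ∑³-*ˡ c n F = trans (∑-cong n λ i _ → trans (∑-cong n λ j _ → ∑-*ˡ c n (F i j))
      (∑-*ˡ c n (λ j → ∑ n (F i j))))
    (∑-*ˡ c n (λ i → ∑[ j < n ] ∑ n (F i j)))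

  ∑³-0 : ∀ n {F} → (∀ i j k → i < n → j < n → k < n → F i j k ≡ 0ℚ) → ∑³ n F ≡ 0ℚ
  ∑³-0 n eq = ∑-0 n λ i i<n → ∑-0 n λ j j<n → ∑-0 n λ k k<n → eq i j k i<n j<n k<n

  ∑³-swap₁₂ : ∀ n F → ∑³ n F ≡ ∑³ n (λ i j k → F j i k)
  ∑³-swap₁₂ n F = ∑-swap n n λ i j → ∑ n (F i j)

  ∑³-swap₂₃ : ∀ n F → ∑³ n F ≡ ∑³ n (λ i j k → F i k j)
  ∑³-swap₂₃ n F = ∑-cong n λ i _ → ∑-swap n n (F i)

  module _ {N H : ℕ} (φ ψ : ℕ → ℕ) (split : ∀ f → ∑ N f ≡ (∑[ a < H ] f (φ a)) + (∑[ a < H ] f (ψ a)))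
           (F : ℕ → ℕ → ℕ → ℚ) (sym₁₂ : ∀ i j k → F i j k ≡ F j i k) (sym₂₃ : ∀ i j k → F i j k ≡ F i k j) where

    -- Each index comes from φ or from ψ, which gives eight sums. By symmetry of F they depend only
    -- on how often ψ occurs, hence the multiplicities 1, 3, 3, 1.
    ∑³-split : ∑³ N F ≡ ∑³ H (λ a b c → F (φ a) (φ b) (φ c)) + # 3 * ∑³ H (λ a b c → F (φ a) (φ b) (ψ c))
                      + # 3 * ∑³ H (λ a b c → F (φ a) (ψ b) (ψ c)) + ∑³ H (λ a b c → F (ψ a) (ψ b) (ψ c))
    ∑³-split = begin
      ∑³ N F
        ≡⟨ trans (merge _) (∑-cong H λ a _ → cong₂ _+_ (slice₂ (φ a)) (slice₂ (ψ a))) ⟩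
      (∑[ a < H ] (plane φ φ (φ a) + plane φ ψ (φ a) + plane ψ φ (φ a) + plane ψ ψ (φ a)
                 + (plane φ φ (ψ a) + plane φ ψ (ψ a) + plane ψ φ (ψ a) + plane ψ ψ (ψ a))))
        ≡⟨ trans (∑-+ H _ _) (cong₂ _+_ (∑-+₄ (λ b → plane φ φ (φ b)) (λ b → plane φ ψ (φ b)) (λ b → plane ψ φ (φ b)) (λ b → plane ψ ψ (φ b))) (∑-+₄ (λ b → plane φ φ (ψ b)) (λ b → plane φ ψ (ψ b)) (λ b → plane ψ φ (ψ b)) (λ b → plane ψ ψ (ψ b)))) ⟩
      A φ φ φ + A φ φ ψ + A φ ψ φ + A φ ψ ψ + (A ψ φ φ + A ψ φ ψ + A ψ ψ φ + A ψ ψ ψ)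
        ≡⟨ cong₂ (λ x y → A φ φ φ + A φ φ ψ + x + A φ ψ ψ + (y + A ψ φ ψ + A ψ ψ φ + A ψ ψ ψ)) (A-sym₂₃ φ ψ φ) (trans (A-sym₁₂ ψ φ φ) (A-sym₂₃ φ ψ φ)) ⟩
      A φ φ φ + A φ φ ψ + A φ φ ψ + A φ ψ ψ + (A φ φ ψ + A ψ φ ψ + A ψ ψ φ + A ψ ψ ψ)
        ≡⟨ cong₂ (λ x y → A φ φ φ + A φ φ ψ + A φ φ ψ + A φ ψ ψ + (A φ φ ψ + x + y + A ψ ψ ψ)) (A-sym₁₂ ψ φ ψ) (trans (A-sym₂₃ ψ ψ φ) (A-sym₁₂ ψ φ ψ)) ⟩
      A φ φ φ + A φ φ ψ + A φ φ ψ + A φ ψ ψ + (A φ φ ψ + A φ ψ ψ + A φ ψ ψ + A ψ ψ ψ)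
        ≡⟨ alg (A φ φ φ) (A φ φ ψ) (A φ ψ ψ) (A ψ ψ ψ) ⟩
      A φ φ φ + # 3 * A φ φ ψ + # 3 * A φ ψ ψ + A ψ ψ ψ ∎
      where
      open ≡-Reasoning
      plane : (ℕ → ℕ) → (ℕ → ℕ) → ℕ → ℚ
      plane χ ω i = ∑[ b < H ] ∑[ c < H ] F i (χ b) (ω c)
      A : (ℕ → ℕ) → (ℕ → ℕ) → (ℕ → ℕ) → ℚ
      A ρ χ ω = ∑³ H (λ a b c → F (ρ a) (χ b) (ω c))
      A-sym₁₂ : ∀ ρ χ ω → A ρ χ ω ≡ A χ ρ ω
      A-sym₁₂ ρ χ ω = trans (∑³-swap₁₂ H _) (∑³-cong H λ a b c _ _ _ → sym₁₂ (ρ b) (χ a) (ω c))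
      A-sym₂₃ : ∀ ρ χ ω → A ρ χ ω ≡ A ρ ω χ
      A-sym₂₃ ρ χ ω = trans (∑³-swap₂₃ H _) (∑³-cong H λ a b c _ _ _ → sym₂₃ (ρ a) (χ c) (ω b))
      merge : ∀ f → ∑ N f ≡ (∑[ a < H ] (f (φ a) + f (ψ a)))
      merge f = trans (split f) (sym (∑-+ H (f ∘ φ) (f ∘ ψ)))
      ∑-+₄ : ∀ f g h k → (∑[ b < H ] (f b + g b + h b + k b)) ≡ ∑ H f + ∑ H g + ∑ H h + ∑ H k
      ∑-+₄ f g h k = trans (∑-+ H (λ b → f b + g b + h b) k) (cong (_+ ∑ H k)
        (trans (∑-+ H (λ b → f b + g b) h) (cong (_+ ∑ H h) (∑-+ H f g))))
      regroup : ∀ x y z w → x + y + (z + w) ≡ x + y + z + w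
      regroup = solve-∀ ℚ-ring
      slice₂ : ∀ i → (∑[ j < N ] ∑[ k < N ] F i j k) ≡ plane φ φ i + plane φ ψ i + plane ψ φ i + plane ψ ψ i
      slice₂ i = trans (merge _) (trans (∑-cong H λ b _ → trans (cong₂ _+_ (split (F i (φ b))) (split (F i (ψ b))))
        (regroup (∑[ c < H ] F i (φ b) (φ c)) (∑[ c < H ] F i (φ b) (ψ c)) (∑[ c < H ] F i (ψ b) (φ c)) (∑[ c < H ] F i (ψ b) (ψ c))))
        (∑-+₄ (λ b → ∑[ c < H ] F i (φ b) (φ c)) (λ b → ∑[ c < H ] F i (φ b) (ψ c)) (λ b → ∑[ c < H ] F i (ψ b) (φ c)) (λ b → ∑[ c < H ] F i (ψ b) (ψ c))))
      alg : ∀ x y z w → x + y + y + z + (y + z + z + w) ≡ x + # 3 * y + # 3 * z + w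
      alg = solve-∀ ℚ-ring

  -- For b ≤ l the only partner is c = l - b, and l < M keeps it in range; for b > l there is none.
  ∑-convolution : ∀ {l M} → l < M → (F : ℕ → ℕ → ℚ) →
    (∑[ b < M ] ∑[ c < M ] (⟦ b ℕ.+ c ℕ.≟ l ⟧ * F b c)) ≡ (∑[ b < suc l ] F b (l ∸ b))
  ∑-convolution {l} {M} l<M F = trans
    (∑-extend l<M (λ b → ∑[ c < M ] (⟦ b ℕ.+ c ℕ.≟ l ⟧ * F b c)) λ b l<b _ →
      ∑-indicator-none M (λ c → b ℕ.+ c ℕ.≟ l) (λ {c} _ b+c≡l → ℕ.<⇒≱ l<b (ℕ.m+n≤o⇒m≤o b (ℕ.≤-reflexive b+c≡l))) (F b))
    (∑-cong (suc l) λ b b<1+l →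
      ∑-indicator (ℕ.≤-<-trans (ℕ.m∸n≤m l b) l<M) (λ c → b ℕ.+ c ℕ.≟ l)
        (λ {c} _ b+c≡l → trans (sym (ℕ.m+n∸m≡n b c)) (cong (_∸ b) b+c≡l))
        (ℕ.m+[n∸m]≡n (ℕ.≤-pred b<1+l)) (F b))

  opaque
    unfolding ∑

    sumList-map-suc : ∀ f g m → sumList (map f (map suc (applyUpTo g m))) ≡ (∑[ i < m ] f (suc (g i)))
    sumList-map-suc f g zero    = refl
    sumList-map-suc f g (suc m) = trans (cong (f (suc (g 0)) +_) (sumList-map-suc f (g ∘ suc) m))
      (sym (∑-head m (λ i → f (suc (g i)))))

  module _ (n : ℕ) (P : ℕ → ℕ → ℕ → Bool) (f : ℕ → ℕ → ℕ → ℚ) where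
    private
      G : ℕ → ℕ → ℕ → ℚ
      G i j k = if P i j k then f i j k else 0ℚ

    -- The truncated ranges of `tripleSum` hide the symmetry in i, j, k. Passing to the box of
    -- entries from 0 to n restores it, and costs nothing because the summand vanishes as soon as an
    -- entry is 0.
    tripleSum-as-∑³ : (∀ j k → G 0 j k ≡ 0ℚ) → (∀ i k → G i 0 k ≡ 0ℚ) → (∀ i j → G i j 0 ≡ 0ℚ) →
      tripleSum n P f ≡ ∑³ (suc n) (λ i j k → ⟦ i ℕ.+ j ℕ.+ k ℕ.≟ n ⟧ * G i j k)
    tripleSum-as-∑³ G0jk Gi0k Gij0 = begin
      tripleSum n P f
        ≡⟨ sumList-map-suc _ (λ i → i) (n ∸ 2) ⟩
      (∑[ i < n ∸ 2 ] sumList (map (λ j → G (suc i) j (n ∸ suc i ∸ j)) (map suc (applyUpTo (λ j → j) (n ∸ suc i ∸ 1)))))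
        ≡⟨ ∑-cong (n ∸ 2) (λ i _ → sumList-map-suc _ (λ j → j) (n ∸ suc i ∸ 1)) ⟩
      (∑[ i < n ∸ 2 ] row (suc i))
        ≡⟨ sym (∑-extend (ℕ.m∸n≤m n 2) (row ∘ suc) λ i n-2≤i _ → row-empty i n-2≤i) ⟩
      ∑ n (row ∘ suc)
        ≡⟨ sym (ℚ.+-identityˡ (∑ n (row ∘ suc))) ⟩
      0ℚ + ∑ n (row ∘ suc)
        ≡⟨ cong (_+ ∑ n (row ∘ suc)) (sym (∑-0 (n ∸ 1) λ j _ → G0jk (suc j) (n ∸ suc j))) ⟩
      row 0 + ∑ n (row ∘ suc)
        ≡⟨ sym (∑-head n row) ⟩
      ∑ (suc n) row
        ≡⟨ ∑-cong (suc n) (λ i i<1+n → sym (row≡ i (ℕ.≤-pred i<1+n))) ⟩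
      ∑³ (suc n) (λ i j k → ⟦ i ℕ.+ j ℕ.+ k ℕ.≟ n ⟧ * G i j k) ∎
      where
      open ≡-Reasoning
      row : ℕ → ℚ
      row i = ∑[ j < n ∸ i ∸ 1 ] G i (suc j) (n ∸ i ∸ suc j)
      row-empty : ∀ i → n ∸ 2 ≤ i → row (suc i) ≡ 0ℚ
      row-empty i n-2≤i = trans (cong (λ m → ∑[ j < m ] G (suc i) (suc j) (n ∸ suc i ∸ suc j))
        (trans (ℕ.∸-+-assoc n (suc i) 1) (trans (cong (n ∸_) (ℕ.+-comm (suc i) 1))
          (trans (sym (ℕ.∸-+-assoc n 2 i)) (ℕ.m≤n⇒m∸n≡0 n-2≤i))))) (∑-0 0 λ _ ())
      -- Drops the end terms j = 0 and j = m, where the second or the third entry is 0; for m = 0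
      -- the two coincide.
      trim : ∀ i m → (∑[ j < suc m ] G i j (m ∸ j)) ≡ (∑[ j < m ∸ 1 ] G i (suc j) (m ∸ suc j))
      trim i zero    = trans (∑-1 (λ j → G i j (0 ∸ j))) (trans (Gi0k i 0) (sym (∑-0 0 λ _ ())))
      trim i (suc m) = trans (∑-head (suc m) (λ j → G i j (suc m ∸ j))) (trans (cong₂ _+_ (Gi0k i (suc m))
        (trans (∑-suc m (λ j → G i (suc j) (m ∸ j))) (cong (∑ m (λ j → G i (suc j) (m ∸ j)) +_) (trans (cong (G i (suc m)) (ℕ.n∸n≡0 m)) (Gij0 i (suc m))))))
        (trans (ℚ.+-identityˡ (∑ m (λ j → G i (suc j) (m ∸ j)) + 0ℚ)) (ℚ.+-identityʳ (∑ m (λ j → G i (suc j) (m ∸ j))))))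
      row≡ : ∀ i → i ≤ n → (∑[ j < suc n ] ∑[ k < suc n ] (⟦ i ℕ.+ j ℕ.+ k ℕ.≟ n ⟧ * G i j k)) ≡ row i
      row≡ i i≤n = trans
        (∑-cong (suc n) λ j _ → ∑-cong (suc n) λ k _ → cong (_* G i j k)
          (⟦⟧-cong (i ℕ.+ j ℕ.+ k ℕ.≟ n) (j ℕ.+ k ℕ.≟ n ∸ i)
            (λ e → trans (sym (ℕ.m+n∸m≡n i (j ℕ.+ k))) (cong (_∸ i) (trans (sym (ℕ.+-assoc i j k)) e)))
            (λ e → trans (ℕ.+-assoc i j k) (trans (cong (i ℕ.+_) e) (ℕ.m+[n∸m]≡n i≤n)))))
        (trans (∑-convolution (s≤s (ℕ.m∸n≤m n i)) (G i)) (trim i (n ∸ i)))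

  opaque
    unfolding ∑

    ∑-even-odd : ∀ H f → ∑ (H ℕ.+ H) f ≡ (∑[ a < H ] f (a ℕ.+ a)) + (∑[ a < H ] f (suc (a ℕ.+ a)))
    ∑-even-odd zero    f = refl
    ∑-even-odd (suc H) f = trans (cong (λ m → ∑ m f + f (H ℕ.+ suc H)) (ℕ.+-suc H H))
      (trans (cong₂ (λ x m → x + f (H ℕ.+ H) + f m) (∑-even-odd H f) (ℕ.+-suc H H))
      (alg (∑[ a < H ] f (a ℕ.+ a)) (∑[ a < H ] f (suc (a ℕ.+ a))) (f (H ℕ.+ H)) (f (suc (H ℕ.+ H)))))
      where
      alg : ∀ x y u v → x + y + u + v ≡ x + u + (y + v)
      alg = solve-∀ ℚ-ring

  module _ (h : ℕ) (f : ℕ → ℚ) where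
    private
      H n : ℕ
      H = suc h
      n = suc (h ℕ.+ h)

      H+H≡1+n : H ℕ.+ H ≡ suc n
      H+H≡1+n = cong suc (ℕ.+-suc h h)

    -- As n = 2h + 1 is odd, reflection in n exchanges even and odd entries just as it exchanges
    -- small and large ones. Both splittings therefore have the same shape, with the same h + 1
    -- indices.
    ∑-split-parity : ∑ (suc n) f ≡ (∑[ a < H ] f (a ℕ.+ a)) + (∑[ a < H ] f (n ∸ (a ℕ.+ a)))
    ∑-split-parity = trans (cong (λ m → ∑ m f) (sym H+H≡1+n)) (trans (∑-even-odd H f)
      (cong ((∑[ a < H ] f (a ℕ.+ a)) +_) (trans (sym (∑-reverse h _)) (∑-cong H λ a a<H → cong f (reflect a (ℕ.≤-pred a<H))))))
      where
      reflect : ∀ a → a ≤ h → suc ((h ∸ a) ℕ.+ (h ∸ a)) ≡ n ∸ (a ℕ.+ a)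
      reflect a a≤h = trans (sym (ℕ.m+n∸m≡n (a ℕ.+ a) (suc ((h ∸ a) ℕ.+ (h ∸ a))))) (cong (_∸ (a ℕ.+ a))
        (trans (alg a (h ∸ a)) (cong (λ m → suc (m ℕ.+ m)) (ℕ.m+[n∸m]≡n a≤h))))
        where
        alg : ∀ a d → a ℕ.+ a ℕ.+ suc (d ℕ.+ d) ≡ suc (a ℕ.+ d ℕ.+ (a ℕ.+ d))
        alg = solve-∀ℕ

    ∑-split-half : ∑ (suc n) f ≡ (∑[ a < H ] f a) + (∑[ a < H ] f (n ∸ a))
    ∑-split-half = trans (cong (λ m → ∑ m f) (sym H+H≡1+n)) (trans (∑-split H H f)
      (cong (∑ H f +_) (trans (sym (∑-reverse h _)) (∑-cong H λ a a<H → cong f (sym (ℕ.+-∸-assoc H (ℕ.≤-pred a<H)))))))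

  prime∣prime⇒≡ : ∀ {p q} → Prime p → Prime q → p ∣ q → p ≡ q
  prime∣prime⇒≡ pp qp p∣q with prime⇒irreducible qp p∣q
  ... | inj₁ refl = contradiction (divides 1 refl) (prime∤1 pp)
  ... | inj₂ p≡q  = p≡q

  -- Residues modulo 3 and the second elementary symmetric polynomial.

  3∤⇒remainder : ∀ {a} → ¬ 3 ∣ a → ∃ λ x → a ≡ 1 ℕ.+ x ℕ.* 3 ⊎ a ≡ 2 ℕ.+ x ℕ.* 3
  3∤⇒remainder {a} 3∤a with a % 3 | m≡m%n+[m/n]*n a 3 | m%n<n a 3
  ... | 0 | a≡ | _ = contradiction (divides (a ℕ./ 3) a≡) 3∤a
  ... | 1 | a≡ | _ = a ℕ./ 3 , inj₁ a≡
  ... | 2 | a≡ | _ = a ℕ./ 3 , inj₂ a≡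
  ... | suc (suc (suc _)) | _ | s≤s (s≤s (s≤s ()))

  3∤sum : ∀ r s t x y z → (r ℕ.+ s ℕ.+ t) % 3 ≢ 0 → ¬ 3 ∣ r ℕ.+ x ℕ.* 3 ℕ.+ (s ℕ.+ y ℕ.* 3) ℕ.+ (t ℕ.+ z ℕ.* 3)
  3∤sum r s t x y z r+s+t≢0 3∣sum = r+s+t≢0 (n∣m⇒m%n≡0 _ 3
    (∣m+n∣m⇒∣n (subst (3 ∣_) (alg r s t x y z) 3∣sum) (n∣m*n (x ℕ.+ y ℕ.+ z))))
    where
    alg : ∀ r s t x y z → r ℕ.+ x ℕ.* 3 ℕ.+ (s ℕ.+ y ℕ.* 3) ℕ.+ (t ℕ.+ z ℕ.* 3) ≡ (x ℕ.+ y ℕ.+ z) ℕ.* 3 ℕ.+ (r ℕ.+ s ℕ.+ t)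
    alg = solve-∀ℕ

  -- Three units modulo 3 whose sum is divisible by 3 are all congruent, and then ab + bc + ca ≡
  -- 3a². The six mixed patterns contradict the hypothesis on the sum.
  3∣e₂ : ∀ {a b c} → ¬ 3 ∣ a → ¬ 3 ∣ b → ¬ 3 ∣ c → 3 ∣ a ℕ.+ b ℕ.+ c → 3 ∣ a ℕ.* b ℕ.+ b ℕ.* c ℕ.+ c ℕ.* a
  3∣e₂ 3∤a 3∤b 3∤c 3∣sum with 3∤⇒remainder 3∤a | 3∤⇒remainder 3∤b | 3∤⇒remainder 3∤c
  ... | x , inj₁ refl | y , inj₁ refl | z , inj₁ refl =
    divides (3 ℕ.* (x ℕ.* y ℕ.+ y ℕ.* z ℕ.+ z ℕ.* x) ℕ.+ 2 ℕ.* (x ℕ.+ y ℕ.+ z) ℕ.+ 1) (alg x y z)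
    where
    alg : ∀ x y z → (1 ℕ.+ x ℕ.* 3) ℕ.* (1 ℕ.+ y ℕ.* 3) ℕ.+ (1 ℕ.+ y ℕ.* 3) ℕ.* (1 ℕ.+ z ℕ.* 3) ℕ.+ (1 ℕ.+ z ℕ.* 3) ℕ.* (1 ℕ.+ x ℕ.* 3)
          ≡ (3 ℕ.* (x ℕ.* y ℕ.+ y ℕ.* z ℕ.+ z ℕ.* x) ℕ.+ 2 ℕ.* (x ℕ.+ y ℕ.+ z) ℕ.+ 1) ℕ.* 3
    alg = solve-∀ℕ
  ... | x , inj₂ refl | y , inj₂ refl | z , inj₂ refl =
    divides (3 ℕ.* (x ℕ.* y ℕ.+ y ℕ.* z ℕ.+ z ℕ.* x) ℕ.+ 4 ℕ.* (x ℕ.+ y ℕ.+ z) ℕ.+ 4) (alg x y z)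
    where
    alg : ∀ x y z → (2 ℕ.+ x ℕ.* 3) ℕ.* (2 ℕ.+ y ℕ.* 3) ℕ.+ (2 ℕ.+ y ℕ.* 3) ℕ.* (2 ℕ.+ z ℕ.* 3) ℕ.+ (2 ℕ.+ z ℕ.* 3) ℕ.* (2 ℕ.+ x ℕ.* 3)
          ≡ (3 ℕ.* (x ℕ.* y ℕ.+ y ℕ.* z ℕ.+ z ℕ.* x) ℕ.+ 4 ℕ.* (x ℕ.+ y ℕ.+ z) ℕ.+ 4) ℕ.* 3
    alg = solve-∀ℕ
  ... | x , inj₁ refl | y , inj₁ refl | z , inj₂ refl = contradiction 3∣sum (3∤sum 1 1 2 x y z λ ())
  ... | x , inj₁ refl | y , inj₂ refl | z , inj₁ refl = contradiction 3∣sum (3∤sum 1 2 1 x y z λ ())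
  ... | x , inj₂ refl | y , inj₁ refl | z , inj₁ refl = contradiction 3∣sum (3∤sum 2 1 1 x y z λ ())
  ... | x , inj₁ refl | y , inj₂ refl | z , inj₂ refl = contradiction 3∣sum (3∤sum 1 2 2 x y z λ ())
  ... | x , inj₂ refl | y , inj₁ refl | z , inj₂ refl = contradiction 3∣sum (3∤sum 2 1 2 x y z λ ())
  ... | x , inj₂ refl | y , inj₂ refl | z , inj₁ refl = contradiction 3∣sum (3∤sum 2 2 1 x y z λ ())

  -- Reciprocals restricted to the integers coprime to pq.

  module TwoPrimes (p q : ℕ) (p-prime : Prime p) (q-prime : Prime q) where
    open Localization p p-prime

    Unit : ℕ → Set
    Unit i = ¬ p ∣ i × ¬ q ∣ i

    unit? : ∀ i → Dec (Unit i)
    unit? i = ¬? (p ∣? i) ×-dec ¬? (q ∣? i)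

    χ : ℕ → ℚ
    χ i = ⟦ unit? i ⟧

    -- The inverse extended by 0 to non-units, in particular to 0, so that index ranges may start at
    -- 0 and need no side conditions.
    r : ℕ → ℚ
    r i = χ i * recip i

    χ-cong : ∀ {i j} → (Unit i → Unit j) → (Unit j → Unit i) → χ i ≡ χ j
    χ-cong {i} {j} = ⟦⟧-cong (unit? i) (unit? j)

    r-unit : ∀ {i} → Unit i → r i ≡ recip i
    r-unit {i} u = ⟦⟧-*-yes (unit? i) u (recip i)

    r-nonunit : ∀ {i} → ¬ Unit i → r i ≡ 0ℚ
    r-nonunit {i} ¬u = ⟦⟧-*-no (unit? i) ¬u (recip i)

    int-χ : ∀ i → Integral (χ i)
    int-χ i = int-⟦⟧ (unit? i)

    int-r : ∀ i → Integral (r i)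
    int-r i with unit? i
    ... | yes u = subst Integral (sym (r-unit u)) (int-recip (proj₁ u))
    ... | no ¬u = subst Integral (sym (r-nonunit ¬u)) int-0

    χ0≡0 : χ 0 ≡ 0ℚ
    χ0≡0 = ⟦⟧-no (unit? 0) λ (p∤0 , _) → p∤0 (p ∣0)

    r0≡0 : r 0 ≡ 0ℚ
    r0≡0 = r-nonunit λ (p∤0 , _) → p∤0 (p ∣0)

    unit-complement : ∀ {i j N} → p ∣ N → q ∣ N → i ℕ.+ j ≡ N → Unit i → Unit j
    unit-complement {i} {j} p∣N q∣N refl (p∤i , q∤i) =
      (λ p∣j → p∤i (∣m+n∣m⇒∣n (subst (p ∣_) (ℕ.+-comm i j) p∣N) p∣j)) ,
      (λ q∣j → q∤i (∣m+n∣m⇒∣n (subst (q ∣_) (ℕ.+-comm i j) q∣N) q∣j))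

    χ-complement : ∀ {i j N} → p ∣ N → q ∣ N → i ℕ.+ j ≡ N → χ i ≡ χ j
    χ-complement {i} {j} p∣N q∣N i+j≡N = χ-cong (unit-complement p∣N q∣N i+j≡N)
      (unit-complement p∣N q∣N (trans (ℕ.+-comm j i) i+j≡N))

  coprime-* : ∀ {i x y} → Coprime i x → Coprime i y → Coprime i (x ℕ.* y)
  coprime-* c c′ (d∣i , d∣xy) = c′ (d∣i , coprime-divisor (λ (e∣d , e∣x) → c (∣-trans e∣d d∣i , e∣x)) d∣xy)

  ⌊⌋-cong : ∀ {a b} {A : Set a} {B : Set b} (d : Dec A) (e : Dec B) → (A → B) → (B → A) → ⌊ d ⌋ ≡ ⌊ e ⌋
  ⌊⌋-cong (yes x) (yes y) f g = refl
  ⌊⌋-cong (yes x) (no ¬y) f g = contradiction (f x) ¬y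
  ⌊⌋-cong (no ¬x) (yes y) f g = contradiction (g y) ¬x
  ⌊⌋-cong (no ¬x) (no ¬y) f g = refl

  if-⌊⌋ : ∀ {a} {A : Set a} (d : Dec A) → (if ⌊ d ⌋ then 1ℚ else 0ℚ) ≡ ⟦ d ⟧
  if-⌊⌋ (yes _) = refl
  if-⌊⌋ (no  _) = refl

  if-∧-product : ∀ a b c x y z → (if a ∧ b ∧ c then x * y * z else 0ℚ)
    ≡ (if a then 1ℚ else 0ℚ) * x * ((if b then 1ℚ else 0ℚ) * y) * ((if c then 1ℚ else 0ℚ) * z)
  if-∧-product a b c x y z = cases a b c
    where
    alg₁ : ∀ x y z → x * y * z ≡ 1ℚ * x * (1ℚ * y) * (1ℚ * z)
    alg₁ = solve-∀ ℚ-ring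
    alg₂ : ∀ x y z → 0ℚ ≡ 1ℚ * x * (1ℚ * y) * (0ℚ * z)
    alg₂ = solve-∀ ℚ-ring
    alg₃ : ∀ x y w → 0ℚ ≡ 1ℚ * x * (0ℚ * y) * w
    alg₃ = solve-∀ ℚ-ring
    alg₄ : ∀ x v w → 0ℚ ≡ 0ℚ * x * v * w
    alg₄ = solve-∀ ℚ-ring
    cases : ∀ a b c → (if a ∧ b ∧ c then x * y * z else 0ℚ)
      ≡ (if a then 1ℚ else 0ℚ) * x * ((if b then 1ℚ else 0ℚ) * y) * ((if c then 1ℚ else 0ℚ) * z)
    cases true  true  true  = alg₁ x y z
    cases true  true  false = alg₂ x y z
    cases true  false c     = alg₃ x y ((if c then 1ℚ else 0ℚ) * z)
    cases false b     c     = alg₄ x ((if b then 1ℚ else 0ℚ) * y) ((if c then 1ℚ else 0ℚ) * z)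

  -- Collects the two conditions on each entry, so that the sixfold conjunction becomes a product of
  -- three weights.
  ∧-interleave : ∀ a b c d e f → a ∧ b ∧ c ∧ d ∧ e ∧ f ≡ (d ∧ a) ∧ (e ∧ b) ∧ (f ∧ c)
  ∧-interleave true  true  true  d e f = sym (cong₂ _∧_ (∧-identityʳ d) (cong₂ _∧_ (∧-identityʳ e) (∧-identityʳ f)))
  ∧-interleave false b c true e f = refl
  ∧-interleave false b c false e f = refl
  ∧-interleave true false c true true f = refl
  ∧-interleave true false c true false f = refl
  ∧-interleave true false c false e f = refl
  ∧-interleave true true false true true true = refl
  ∧-interleave true true false true true false = refl
  ∧-interleave true true false true false f = refl
  ∧-interleave true true false false e f = refl

  isOdd-even : ∀ a → isOdd (a ℕ.+ a) ≡ false
  isOdd-even a = cong (λ m → ⌊ m ℕ.≟ 1 ⌋) (n∣m⇒m%n≡0 (a ℕ.+ a) 2 (divides a (alg a)))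
    where
    alg : ∀ a → a ℕ.+ a ≡ a ℕ.* 2
    alg = solve-∀ℕ

  isOdd-odd : ∀ a → isOdd (suc (a ℕ.+ a)) ≡ true
  isOdd-odd a = cong (λ m → ⌊ m ℕ.≟ 1 ⌋) (trans (cong (_% 2) (alg a)) ([m+kn]%n≡m%n 1 a 2))
    where
    alg : ∀ a → suc (a ℕ.+ a) ≡ 1 ℕ.+ a ℕ.* 2
    alg = solve-∀ℕ

  sumTo : ℕ → (ℕ → ℚ) → ℕ → ℕ → ℕ → ℚ
  sumTo n s i j k = ⟦ i ℕ.+ j ℕ.+ k ℕ.≟ n ⟧ * (s i * s j * s k)

  sumTo-sym₁₂ : ∀ n s i j k → sumTo n s i j k ≡ sumTo n s j i k
  sumTo-sym₁₂ n s i j k = cong₂ (λ m x → ⟦ m ℕ.+ k ℕ.≟ n ⟧ * (x * s k)) (ℕ.+-comm i j) (ℚ.*-comm (s i) (s j))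

  sumTo-sym₂₃ : ∀ n s i j k → sumTo n s i j k ≡ sumTo n s i k j
  sumTo-sym₂₃ n s i j k = cong₂ (λ m x → ⟦ m ℕ.≟ n ⟧ * x) (algℕ i j k) (alg (s i) (s j) (s k))
    where
    algℕ : ∀ i j k → i ℕ.+ j ℕ.+ k ≡ i ℕ.+ k ℕ.+ j
    algℕ = solve-∀ℕ
    alg : ∀ x y z → x * y * z ≡ x * z * y
    alg = solve-∀ ℚ-ring

  tripleSum-product : ∀ n (P : ℕ → ℕ → ℕ → Bool) s → s 0 ≡ 0ℚ →
    (∀ i j k → (if P i j k then recip3 i j k else 0ℚ) ≡ s i * s j * s k) →
    tripleSum n P recip3 ≡ ∑³ (suc n) (sumTo n s)
  tripleSum-product n P s s0≡0 eq = trans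
    (tripleSum-as-∑³ n P recip3
      (λ j k → trans (eq 0 j k) (trans (cong (λ x → x * s j * s k) s0≡0) (alg₁ (s j) (s k))))
      (λ i k → trans (eq i 0 k) (trans (cong (λ x → s i * x * s k) s0≡0) (alg₂ (s i) (s k))))
      (λ i j → trans (eq i j 0) (trans (cong (s i * s j *_) s0≡0) (ℚ.*-zeroʳ (s i * s j)))))
    (∑³-cong (suc n) λ i j k _ _ _ → cong (⟦ i ℕ.+ j ℕ.+ k ℕ.≟ n ⟧ *_) (eq i j k))
    where
    alg₁ : ∀ x y → 0ℚ * x * y ≡ 0ℚ
    alg₁ = solve-∀ ℚ-ring
    alg₂ : ∀ x y → x * 0ℚ * y ≡ 0ℚ
    alg₂ = solve-∀ ℚ-ring

  module PrimeProducts (p q : ℕ) (p-prime : Prime p) (q-prime : Prime q) where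
    open Localization p p-prime
    open TwoPrimes p q p-prime q-prime

    -- Successor exponents ensure that both primes occur; a = b = 0 covers coprimality to pq in the
    -- odd sum.
    inP≡unit? : ∀ a b i → inP (p ℕ.^ suc a ℕ.* q ℕ.^ suc b) i ≡ ⌊ unit? i ⌋
    inP≡unit? a b i = ⌊⌋-cong (coprime? i (p ℕ.^ suc a ℕ.* q ℕ.^ suc b)) (unit? i)
      (λ c → (λ p∣i → prime∤1 p-prime (subst (p ∣_) (c (p∣i , ∣m⇒∣m*n (q ℕ.^ suc b) (m∣m*n (p ℕ.^ a)))) n∣n)) ,
             (λ q∣i → prime∤1 q-prime (subst (q ∣_) (c (q∣i , ∣n⇒∣m*n (p ℕ.^ suc a) (m∣m*n (q ℕ.^ b)))) n∣n)))
      (λ (p∤i , q∤i) → coprime-* (Coprimality.sym (coprime-^ (suc a) (∤⇒coprime p-prime p∤i)))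
                                 (Coprimality.sym (coprime-^ (suc b) (∤⇒coprime q-prime q∤i))))

    Z≡∑³ : ∀ a b → Z (p ℕ.^ suc a ℕ.* q ℕ.^ suc b) ≡ ∑³ (suc (p ℕ.^ suc a ℕ.* q ℕ.^ suc b)) (sumTo (p ℕ.^ suc a ℕ.* q ℕ.^ suc b) r)
    Z≡∑³ a b = tripleSum-product n (λ i j k → inP n i ∧ inP n j ∧ inP n k) r r0≡0 λ i j k →
      trans (if-∧-product (inP n i) (inP n j) (inP n k) (recip i) (recip j) (recip k))
        (cong₂ _*_ (cong₂ _*_ (weight i) (weight j)) (weight k))
      where
      n = p ℕ.^ suc a ℕ.* q ℕ.^ suc b
      weight : ∀ i → (if inP n i then 1ℚ else 0ℚ) * recip i ≡ r i
      weight i = cong (_* recip i) (trans (cong (if_then 1ℚ else 0ℚ) (inP≡unit? a b i)) (if-⌊⌋ (unit? i)))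

    odd-r : ℕ → ℚ
    odd-r i = (if isOdd i then 1ℚ else 0ℚ) * r i

    odd-sum : ℕ → ℚ
    odd-sum n = tripleSum n (λ i j k → inP (p ℕ.* q) i ∧ inP (p ℕ.* q) j ∧ inP (p ℕ.* q) k ∧ isOdd i ∧ isOdd j ∧ isOdd k) recip3

    odd-sum≡∑³ : ∀ n → odd-sum n ≡ ∑³ (suc n) (sumTo n odd-r)
    odd-sum≡∑³ n = tripleSum-product n (λ i j k → inP m i ∧ inP m j ∧ inP m k ∧ isOdd i ∧ isOdd j ∧ isOdd k)
      odd-r (trans (cong ((if isOdd 0 then 1ℚ else 0ℚ) *_) r0≡0) refl) λ i j k →
      trans (cong (if_then recip3 i j k else 0ℚ) (∧-interleave (inP m i) (inP m j) (inP m k) (isOdd i) (isOdd j) (isOdd k)))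
      (trans (if-∧-product (isOdd i ∧ inP m i) (isOdd j ∧ inP m j) (isOdd k ∧ inP m k) (recip i) (recip j) (recip k))
        (cong₂ _*_ (cong₂ _*_ (weight i) (weight j)) (weight k)))
      where
      m = p ℕ.* q
      if-∧ : ∀ a b x → (if a ∧ b then 1ℚ else 0ℚ) * x ≡ (if a then 1ℚ else 0ℚ) * ((if b then 1ℚ else 0ℚ) * x)
      if-∧ true  b x = sym (ℚ.*-identityˡ ((if b then 1ℚ else 0ℚ) * x))
      if-∧ false b x = trans (ℚ.*-zeroˡ x) (sym (ℚ.*-zeroˡ ((if b then 1ℚ else 0ℚ) * x)))
      inP-pq : ∀ i → inP m i ≡ ⌊ unit? i ⌋
      inP-pq i = trans (cong (λ m → inP m i) (cong₂ ℕ._*_ (sym (ℕ.*-identityʳ p)) (sym (ℕ.*-identityʳ q)))) (inP≡unit? 0 0 i)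
      weight : ∀ i → (if isOdd i ∧ inP m i then 1ℚ else 0ℚ) * recip i ≡ odd-r i
      weight i = trans (if-∧ (isOdd i) (inP m i) (recip i)) (cong (λ w → (if isOdd i then 1ℚ else 0ℚ) * (w * recip i))
        (trans (cong (if_then 1ℚ else 0ℚ) (inP-pq i)) (if-⌊⌋ (unit? i))))

  -- Reflection in n modulo P = p ^ suc α.

  module Reflection (p q : ℕ) (p-prime : Prime p) (q-prime : Prime q) (p≢2 : p ≢ 2) (q≢2 : q ≢ 2)
    (α β h : ℕ) (n≡ : suc (h ℕ.+ h) ≡ p ℕ.^ suc α ℕ.* q ℕ.^ suc β) where
    open Localization p p-prime
    open TwoPrimes p q p-prime q-prime
    open PrimeProducts p q p-prime q-prime

    private
      P n H : ℕ
      P = p ℕ.^ suc α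
      n = suc (h ℕ.+ h)
      H = suc h

    P∣n : P ∣ n
    P∣n = subst (P ∣_) (sym n≡) (m∣m*n (q ℕ.^ suc β))

    p∣n : p ∣ n
    p∣n = ∣-trans (m∣m*n (p ℕ.^ α)) P∣n

    q∣n : q ∣ n
    q∣n = subst (q ∣_) (sym n≡) (∣n⇒∣m*n P (m∣m*n (q ℕ.^ β)))

    p∤2 : ¬ p ∣ 2
    p∤2 p∣2 = p≢2 (prime∣prime⇒≡ p-prime (from-yes (prime? 2)) p∣2)

    q∤2 : ¬ q ∣ 2
    q∤2 q∣2 = q≢2 (prime∣prime⇒≡ q-prime (from-yes (prime? 2)) q∣2)

    #n≈0 : # n ≈ 0ℚ [ P ]
    #n≈0 = ∣⇒≈0 P∣n

    2a≤n : ∀ {a} → a < H → a ℕ.+ a ≤ n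
    2a≤n a<H = ℕ.≤-trans (ℕ.+-mono-≤ (ℕ.≤-pred a<H) (ℕ.≤-pred a<H)) (ℕ.n≤1+n _)

    a≤n : ∀ {a} → a < H → a ≤ n
    a≤n {a} a<H = ℕ.≤-trans (ℕ.m≤m+n a a) (2a≤n a<H)

    a+a≡2*a : ∀ a → a ℕ.+ a ≡ 2 ℕ.* a
    a+a≡2*a = solve-∀ℕ

    unit-double : ∀ {a} → Unit a → Unit (a ℕ.+ a)
    unit-double {a} (p∤a , q∤a) =
      (λ p∣2a → [ p∤2 , p∤a ]′ (euclidsLemma 2 a p-prime (subst (p ∣_) (a+a≡2*a a) p∣2a))) ,
      (λ q∣2a → [ q∤2 , q∤a ]′ (euclidsLemma 2 a q-prime (subst (q ∣_) (a+a≡2*a a) q∣2a)))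

    unit-half : ∀ {a} → Unit (a ℕ.+ a) → Unit a
    unit-half (p∤2a , q∤2a) = (λ p∣a → p∤2a (∣m∣n⇒∣m+n p∣a p∣a)) , (λ q∣a → q∤2a (∣m∣n⇒∣m+n q∣a q∣a))

    unit-reflect : ∀ {c} → c ≤ n → Unit c → Unit (n ∸ c)
    unit-reflect c≤n = unit-complement p∣n q∣n (ℕ.m+[n∸m]≡n c≤n)

    unit-unreflect : ∀ {c} → c ≤ n → Unit (n ∸ c) → Unit c
    unit-unreflect c≤n = unit-complement p∣n q∣n (ℕ.m∸n+n≡m c≤n)

    r-double : ∀ a → r (a ℕ.+ a) ≡ recip 2 * r a
    r-double a = trans (cong₂ _*_ (χ-cong unit-half unit-double) (trans (cong recip (a+a≡2*a a)) (recip-* 2 a)))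
      (alg (χ a) (recip 2) (recip a))
      where
      alg : ∀ x y z → x * (y * z) ≡ y * (x * z)
      alg = solve-∀ ℚ-ring

    r-reflect : ∀ {c} → c ≤ n → r (n ∸ c) ≈ - r c [ P ]
    r-reflect {c} c≤n with unit? c
    ... | no ¬u = ≈-reflexive (trans (r-nonunit (¬u ∘ unit-unreflect c≤n)) (cong -_ (sym (r-nonunit ¬u))))
    ... | yes u = subst₂ _≈_[ P ] (sym (r-unit (unit-reflect c≤n u))) (cong -_ (sym (r-unit u)))
      (≈-recip-neg (proj₁ (unit-reflect c≤n u)) (proj₁ u)
        (≈-trans (≈-reflexive (#-∸ c≤n)) (≈-trans (≈-+ #n≈0 ≈-refl) (≈-reflexive (ℚ.+-identityˡ (- # c))))))

    r-reflect-double : ∀ {c} → c < H → r (n ∸ (c ℕ.+ c)) ≈ - (recip 2 * r c) [ P ]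
    r-reflect-double {c} c<H = ≈-trans (r-reflect (2a≤n c<H)) (≈-reflexive (cong -_ (r-double c)))

    module _ {a b c : ℕ} (a<H : a < H) (b<H : b < H) (c<H : c < H) where

      -- For p = 3 the bracket vanishes mod 3 by 3∣e₂; for p ≠ 3 the number 3 is invertible.
      4e₂-n²≈0 : a ℕ.+ b ℕ.+ c ≡ n → Unit a → Unit b → Unit c →
        # 4 * # (a ℕ.* b ℕ.+ b ℕ.* c ℕ.+ c ℕ.* a) - # n * # n ≈ 0ℚ [ 3 ]
      4e₂-n²≈0 a+b+c≡n (p∤a , _) (p∤b , _) (p∤c , _) with p ℕ.≟ 3
      ... | yes refl = ≈-+
        (≈-trans (≈-*ˡ (int-# 4) (∣⇒≈0 (3∣e₂ p∤a p∤b p∤c (subst (3 ∣_) (sym a+b+c≡n) p∣n)))) (≈-reflexive (ℚ.*-zeroʳ (# 4))))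
        (≈-neg (≈-trans (≈-*ˡ (int-# n) (∣⇒≈0 p∣n)) (≈-reflexive (ℚ.*-zeroʳ (# n)))))
      ... | no p≢3 = ≈-trans (≈-reflexive (sym 3*⅓))
        (multiple≈0 (int-* (int-recip p∤3) (int-- (int-* (int-# 4) (int-# (a ℕ.* b ℕ.+ b ℕ.* c ℕ.+ c ℕ.* a))) (int-* (int-# n) (int-# n)))))
        where
        p∤3 : ¬ p ∣ 3
        p∤3 p∣3 = p≢3 (prime∣prime⇒≡ p-prime (from-yes (prime? 3)) p∣3)
        alg : ∀ x → # 3 * (recip 3 * x) ≡ x
        alg = solve-∀ ℚ-ring
        3*⅓ = alg (# 4 * # (a ℕ.* b ℕ.+ b ℕ.* c ℕ.+ c ℕ.* a) - # n * # n)

      -- Write x, y, z for 1/a, 1/b, 1/c and u, v, w for 1/(n−2a), 1/(n−2b), 1/(n−2c).  Then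
      -- 8uvw + xyz = uvwxyz (8abc + (n−2a)(n−2b)(n−2c)) = uvwxyz n (4(ab+bc+ca) − n²).
      large-triple : a ℕ.+ b ℕ.+ c ≡ n →
        # 8 * (r (n ∸ (a ℕ.+ a)) * r (n ∸ (b ℕ.+ b)) * r (n ∸ (c ℕ.+ c))) + r a * r b * r c ≈ 0ℚ [ P ℕ.* 3 ]
      large-triple a+b+c≡n with unit? a ×-dec unit? b ×-dec unit? c
      ... | no ¬u = ≈-reflexive (cong₂ (λ x y → # 8 * x + y) (vanish (λ i → n ∸ (i ℕ.+ i)) (λ i<H u → unit-half (unit-unreflect (2a≤n i<H) u))) (vanish (λ i → i) (λ _ u → u)))
        where
        alg : ∀ x y → x * 0ℚ * y ≡ 0ℚ
        alg = solve-∀ ℚ-ring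
        alg₂ : ∀ x y → 0ℚ * x * y ≡ 0ℚ
        alg₂ = solve-∀ ℚ-ring
        vanish : ∀ (φ : ℕ → ℕ) → (∀ {i} → i < H → Unit (φ i) → Unit i) → r (φ a) * r (φ b) * r (φ c) ≡ 0ℚ
        vanish φ back with unit? (φ a) | unit? (φ b) | unit? (φ c)
        ... | no ¬ua | _ | _ = trans (cong (λ x → x * r (φ b) * r (φ c)) (r-nonunit ¬ua)) (alg₂ (r (φ b)) (r (φ c)))
        ... | yes _ | no ¬ub | _ = trans (cong (λ x → r (φ a) * x * r (φ c)) (r-nonunit ¬ub)) (alg (r (φ a)) (r (φ c)))
        ... | yes _ | yes _ | no ¬uc = trans (cong (λ x → r (φ a) * r (φ b) * x) (r-nonunit ¬uc)) (ℚ.*-zeroʳ (r (φ a) * r (φ b)))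
        ... | yes ua | yes ub | yes uc = contradiction (back a<H ua , back b<H ub , back c<H uc) ¬u
      ... | yes (ua , ub , uc) = subst (_≈ 0ℚ [ P ℕ.* 3 ])
          (sym (trans (cong₂ (λ x y → # 8 * x + y)
                 (cong₂ _*_ (cong₂ _*_ (r-unit (reflected a<H ua)) (r-unit (reflected b<H ub))) (r-unit (reflected c<H uc)))
                 (cong₂ _*_ (cong₂ _*_ (r-unit ua) (r-unit ub)) (r-unit uc)))
               factor))
          (≈-trans (≈-*ˡ int-recips n*bracket≈0) (≈-reflexive (ℚ.*-zeroʳ recips)))
        where
        open ≡-Reasoning
        reflected : ∀ {i} → i < H → Unit i → Unit (n ∸ (i ℕ.+ i))
        reflected i<H u = unit-reflect (2a≤n i<H) (unit-double u)
        e₂ : ℕ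
        e₂ = a ℕ.* b ℕ.+ b ℕ.* c ℕ.+ c ℕ.* a
        ra = recip a
        rb = recip b
        rc = recip c
        ru = recip (n ∸ (a ℕ.+ a))
        rv = recip (n ∸ (b ℕ.+ b))
        rw = recip (n ∸ (c ℕ.+ c))
        recips bracket : ℚ
        recips = ru * rv * rw * (ra * rb * rc)
        bracket = # 4 * # e₂ - # n * # n
        int-unit : ∀ {i} → Unit i → Integral (recip i)
        int-unit (p∤i , _) = int-recip p∤i
        int-recips : Integral recips
        int-recips = int-* (int-* (int-* (int-unit (reflected a<H ua)) (int-unit (reflected b<H ub))) (int-unit (reflected c<H uc)))
                           (int-* (int-* (int-unit ua) (int-unit ub)) (int-unit uc))
        -- The factor n contributes P and the bracket contributes 3.
        n*bracket≈0 : # n * bracket ≈ 0ℚ [ P ℕ.* 3 ]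
        n*bracket≈0 with P∣n
        ... | divides k n≡kP = ≈-trans
          (≈-reflexive (trans (cong (_* bracket) (trans (cong # n≡kP) (#-* k P))) (ℚ.*-assoc (# k) (# P) bracket)))
          (≈-trans (≈-*ˡ (int-# k) (≈-scale P (4e₂-n²≈0 a+b+c≡n ua ub uc)))
          (≈-reflexive (trans (cong (# k *_) (ℚ.*-zeroʳ (# P))) (ℚ.*-zeroʳ (# k)))))
        inverse : ∀ {i} → Unit i → # i * recip i ≡ 1ℚ
        inverse {i} (p∤i , _) = recip-inverse i {{∤-nonZero p∤i}}
        #reflected : ∀ {i} → i < H → # (n ∸ (i ℕ.+ i)) ≡ # n - (# i + # i)
        #reflected {i} i<H = trans (#-∸ (2a≤n i<H)) (cong (λ x → # n - x) (#-+ i i))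
        inverse-reflected : ∀ {i} → i < H → Unit i → (# n - (# i + # i)) * recip (n ∸ (i ℕ.+ i)) ≡ 1ℚ
        inverse-reflected {i} i<H u = trans (cong (_* recip (n ∸ (i ℕ.+ i))) (sym (#reflected i<H))) (inverse (reflected i<H u))
        #e₂ : # e₂ ≡ # a * # b + # b * # c + # c * # a
        #e₂ = trans (#-+ (a ℕ.* b ℕ.+ b ℕ.* c) (c ℕ.* a)) (cong₂ _+_
          (trans (#-+ (a ℕ.* b) (b ℕ.* c)) (cong₂ _+_ (#-* a b) (#-* b c))) (#-* c a))
        #n : # n ≡ # a + # b + # c
        #n = trans (cong # (sym a+b+c≡n)) (trans (#-+ (a ℕ.+ b) c) (cong (_+ # c) (#-+ a b)))
        alg₁ : ∀ u v w x y z a b c →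
          # 8 * (u * v * w * (a * x * (b * y) * (c * z))) ≡ u * v * w * (x * y * z) * (# 8 * (a * b * c))
        alg₁ = solve-∀ ℚ-ring
        alg₂ : ∀ u v w x y z a b c → x * y * z * (a * u * (b * v) * (c * w)) ≡ u * v * w * (x * y * z) * (a * b * c)
        alg₂ = solve-∀ ℚ-ring
        alg₃ : ∀ k a b c → let n = a + b + c in
          k * (# 8 * (a * b * c)) + k * ((n - (a + a)) * (n - (b + b)) * (n - (c + c)))
          ≡ k * (n * (# 4 * (a * b + b * c + c * a) - n * n))
        alg₃ = solve-∀ ℚ-ring
        alg₄ : ∀ x → x * (1ℚ * 1ℚ * 1ℚ) ≡ x
        alg₄ = solve-∀ ℚ-ring
        ones : ∀ {x y z} → x ≡ 1ℚ → y ≡ 1ℚ → z ≡ 1ℚ → ∀ t → t ≡ t * (x * y * z)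
        ones refl refl refl t = sym (alg₄ t)
        A B C : ℚ
        A = # n - (# a + # a)
        B = # n - (# b + # b)
        C = # n - (# c + # c)
        factor : # 8 * (ru * rv * rw) + ra * rb * rc ≡ recips * (# n * bracket)
        factor = begin
          # 8 * (ru * rv * rw) + ra * rb * rc
            -- Each product is multiplied by the three factors i · (1/i) = 1 that it lacks, so that
            -- both terms carry `recips`.
            ≡⟨ cong₂ (λ x y → # 8 * x + y)
                 (ones (inverse ua) (inverse ub) (inverse uc) (ru * rv * rw))
                 (ones (inverse-reflected a<H ua) (inverse-reflected b<H ub) (inverse-reflected c<H uc) (ra * rb * rc)) ⟩
          # 8 * (ru * rv * rw * (# a * ra * (# b * rb) * (# c * rc))) + ra * rb * rc * (A * ru * (B * rv) * (C * rw))
            ≡⟨ cong₂ _+_ (alg₁ ru rv rw ra rb rc (# a) (# b) (# c)) (alg₂ ru rv rw ra rb rc A B C) ⟩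
          recips * (# 8 * (# a * # b * # c)) + recips * (A * B * C)
            ≡⟨ cong (λ N → recips * (# 8 * (# a * # b * # c)) + recips * ((N - (# a + # a)) * (N - (# b + # b)) * (N - (# c + # c)))) #n ⟩
          recips * (# 8 * (# a * # b * # c)) + recips * ((# a + # b + # c - (# a + # a)) * (# a + # b + # c - (# b + # b)) * (# a + # b + # c - (# c + # c)))
            ≡⟨ alg₃ recips (# a) (# b) (# c) ⟩
          recips * ((# a + # b + # c) * (# 4 * (# a * # b + # b * # c + # c * # a) - (# a + # b + # c) * (# a + # b + # c)))
            ≡⟨ cong₂ (λ N e → recips * (N * (# 4 * e - N * N))) (sym #n) (sym #e₂) ⟩
          recips * (# n * bracket) ∎

  double-injective : ∀ {x y} → x ℕ.+ x ≡ y ℕ.+ y → x ≡ y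
  double-injective {x} {y} eq = ℕ.*-cancelˡ-≡ x y 2 (trans (sym (alg x)) (trans eq (alg y)))
    where
    alg : ∀ a → a ℕ.+ a ≡ 2 ℕ.* a
    alg = solve-∀ℕ

  double≢odd : ∀ x y → x ℕ.+ x ≢ suc (y ℕ.+ y)
  double≢odd x y eq with trans (sym (isOdd-even x)) (trans (cong isOdd eq) (isOdd-odd y))
  ... | ()

  -- Decomposition of Z by parity and by size.

  module TripleCongruences (p q : ℕ) (p-prime : Prime p) (q-prime : Prime q) (p≢2 : p ≢ 2) (q≢2 : q ≢ 2)
    (α β h : ℕ) (n≡ : suc (h ℕ.+ h) ≡ p ℕ.^ suc α ℕ.* q ℕ.^ suc β) where
    open Localization p p-prime
    open TwoPrimes p q p-prime q-prime
    open PrimeProducts p q p-prime q-prime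
    open Reflection p q p-prime q-prime p≢2 q≢2 α β h n≡

    private
      P n H : ℕ
      P = p ℕ.^ suc α
      n = suc (h ℕ.+ h)
      H = suc h

    -- The sums over all triples with sum n, over those with all entries odd (written n − 2a),
    -- over those with only the last entry odd, over those with all entries below n/2, and over
    -- those with the last entry above n/2.
    Zₙ oddʳ mixedʳ small large convolution : ℚ
    Zₙ          = ∑³ (suc n) (sumTo n r)
    oddʳ        = ∑³ H λ a b c → sumTo n r (n ∸ (a ℕ.+ a)) (n ∸ (b ℕ.+ b)) (n ∸ (c ℕ.+ c))
    mixedʳ      = ∑³ H λ a b c → sumTo n r (a ℕ.+ a) (b ℕ.+ b) (n ∸ (c ℕ.+ c))
    small       = ∑³ H λ a b c → sumTo n r a b c
    large       = ∑³ H λ a b c → sumTo n r a b (n ∸ c)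
    convolution = ∑³ H λ a b c → ⟦ a ℕ.+ b ℕ.≟ c ⟧ * (r a * r b * r c)

    private
      collapse : ∀ y {x z w x′ z′ w′} → x ≡ x′ → z ≡ z′ → w ≡ w′ →
        x + # 3 * y + # 3 * z + w ≡ x′ + # 3 * y + # 3 * z′ + w′
      collapse y refl refl refl = refl
      two-terms : ∀ y w → 0ℚ + # 3 * y + # 3 * 0ℚ + w ≡ w + # 3 * y
      two-terms = solve-∀ ℚ-ring
      two-terms′ : ∀ x y → x + # 3 * y + # 3 * 0ℚ + 0ℚ ≡ x + # 3 * y
      two-terms′ = solve-∀ ℚ-ring
      one-term : ∀ w → 0ℚ + # 3 * 0ℚ + # 3 * 0ℚ + w ≡ w
      one-term = solve-∀ ℚ-ring

      restore : ∀ {c} → c ≤ n → n ∸ c ℕ.+ c ≡ n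
      restore = ℕ.m∸n+n≡m

      ∑³-sumTo-0 : ∀ (s : ℕ → ℚ) (φ χ ω : ℕ → ℕ) → (∀ a b c → a < H → b < H → c < H → φ a ℕ.+ χ b ℕ.+ ω c ≢ n) →
        ∑³ H (λ a b c → sumTo n s (φ a) (χ b) (ω c)) ≡ 0ℚ
      ∑³-sumTo-0 s φ χ ω none = ∑³-0 H λ a b c a<H b<H c<H →
        ⟦⟧-*-no (φ a ℕ.+ χ b ℕ.+ ω c ℕ.≟ n) (none a b c a<H b<H c<H) (s (φ a) * s (χ b) * s (ω c))

      no-even³ : ∀ a b c → a ℕ.+ a ℕ.+ (b ℕ.+ b) ℕ.+ (c ℕ.+ c) ≢ n
      no-even³ a b c eq = double≢odd (a ℕ.+ b ℕ.+ c) h (trans (alg a b c) eq)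
        where
        alg : ∀ a b c → a ℕ.+ b ℕ.+ c ℕ.+ (a ℕ.+ b ℕ.+ c) ≡ a ℕ.+ a ℕ.+ (b ℕ.+ b) ℕ.+ (c ℕ.+ c)
        alg = solve-∀ℕ

      -- Adding b + c to x + (n − b) + (n − c) = n.
      unreflect₂ : ∀ {x b c} → b ≤ n → c ≤ n → x ℕ.+ (n ∸ b) ℕ.+ (n ∸ c) ≡ n → x ℕ.+ n ≡ b ℕ.+ c
      unreflect₂ {x} {b} {c} b≤n c≤n eq = ℕ.+-cancelʳ-≡ n (x ℕ.+ n) (b ℕ.+ c) (begin
        x ℕ.+ n ℕ.+ n                                    ≡⟨ cong₂ (λ u v → x ℕ.+ u ℕ.+ v) (sym (restore b≤n)) (sym (restore c≤n)) ⟩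
        x ℕ.+ (n ∸ b ℕ.+ b) ℕ.+ (n ∸ c ℕ.+ c)            ≡⟨ alg x (n ∸ b) (n ∸ c) b c ⟩
        b ℕ.+ c ℕ.+ (x ℕ.+ (n ∸ b) ℕ.+ (n ∸ c))          ≡⟨ cong (b ℕ.+ c ℕ.+_) eq ⟩
        b ℕ.+ c ℕ.+ n                                    ∎)
        where
        open ≡-Reasoning
        alg : ∀ x u v b c → x ℕ.+ (u ℕ.+ b) ℕ.+ (v ℕ.+ c) ≡ b ℕ.+ c ℕ.+ (x ℕ.+ u ℕ.+ v)
        alg = solve-∀ℕ

      -- One even and two odd entries have an even sum, whereas n is odd.
      no-odd² : ∀ a b c → a < H → b < H → c < H → a ℕ.+ a ℕ.+ (n ∸ (b ℕ.+ b)) ℕ.+ (n ∸ (c ℕ.+ c)) ≢ n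
      no-odd² a b c a<H b<H c<H eq = double≢odd (b ℕ.+ c) (a ℕ.+ h)
        (trans (alg b c) (trans (sym (unreflect₂ (2a≤n b<H) (2a≤n c<H) eq)) (alg₂ a h)))
        where
        alg : ∀ b c → b ℕ.+ c ℕ.+ (b ℕ.+ c) ≡ b ℕ.+ b ℕ.+ (c ℕ.+ c)
        alg = solve-∀ℕ
        alg₂ : ∀ a h → a ℕ.+ a ℕ.+ suc (h ℕ.+ h) ≡ suc (a ℕ.+ h ℕ.+ (a ℕ.+ h))
        alg₂ = solve-∀ℕ

      -- The equation would give b + c = x + n ≥ 2h + 1, but b and c are at most h.
      no-large² : ∀ x b c → b < H → c < H → x ℕ.+ (n ∸ b) ℕ.+ (n ∸ c) ≢ n
      no-large² x b c b<H c<H eq = ℕ.<⇒≱ (s≤s (ℕ.+-mono-≤ (ℕ.≤-pred b<H) (ℕ.≤-pred c<H)))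
        (ℕ.≤-trans (ℕ.m≤n+m n x) (ℕ.≤-reflexive (unreflect₂ (a≤n b<H) (a≤n c<H) eq)))

      indicator-reflect : ∀ {x c} → c ≤ n → ⟦ x ℕ.+ (n ∸ c) ℕ.≟ n ⟧ ≡ ⟦ x ℕ.≟ c ⟧
      indicator-reflect {x} {c} c≤n = ⟦⟧-cong (x ℕ.+ (n ∸ c) ℕ.≟ n) (x ℕ.≟ c)
        (λ eq → ℕ.+-cancelʳ-≡ (n ∸ c) x c (trans eq (sym (ℕ.m+[n∸m]≡n c≤n))))
        (λ { refl → ℕ.m+[n∸m]≡n c≤n })

      -- With s = a + b + c the reflected entries add up to 3n - 2s, which is n exactly when s = n.
      -- So the odd triples correspond to the triples with all entries below n/2.
      indicator-odd : ∀ {a b c} → a < H → b < H → c < H →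
        ⟦ n ∸ (a ℕ.+ a) ℕ.+ (n ∸ (b ℕ.+ b)) ℕ.+ (n ∸ (c ℕ.+ c)) ℕ.≟ n ⟧ ≡ ⟦ a ℕ.+ b ℕ.+ c ℕ.≟ n ⟧
      indicator-odd {a} {b} {c} a<H b<H c<H = ⟦⟧-cong (u ℕ.+ v ℕ.+ w ℕ.≟ n) (s ℕ.≟ n)
        (λ eq → double-injective (ℕ.+-cancelˡ-≡ n (s ℕ.+ s) (n ℕ.+ n) (trans (cong (ℕ._+ (s ℕ.+ s)) (sym eq)) total)))
        (λ eq → ℕ.+-cancelʳ-≡ (s ℕ.+ s) (u ℕ.+ v ℕ.+ w) n (trans total (cong (λ m → n ℕ.+ (m ℕ.+ m)) (sym eq))))
        where
        u v w s : ℕ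
        u = n ∸ (a ℕ.+ a)
        v = n ∸ (b ℕ.+ b)
        w = n ∸ (c ℕ.+ c)
        s = a ℕ.+ b ℕ.+ c
        alg : ∀ u v w a b c → u ℕ.+ v ℕ.+ w ℕ.+ (a ℕ.+ b ℕ.+ c ℕ.+ (a ℕ.+ b ℕ.+ c))
          ≡ u ℕ.+ (a ℕ.+ a) ℕ.+ (v ℕ.+ (b ℕ.+ b) ℕ.+ (w ℕ.+ (c ℕ.+ c)))
        alg = solve-∀ℕ
        total : u ℕ.+ v ℕ.+ w ℕ.+ (s ℕ.+ s) ≡ n ℕ.+ (n ℕ.+ n)
        total = trans (alg u v w a b c) (cong₂ ℕ._+_ (restore (2a≤n a<H)) (cong₂ ℕ._+_ (restore (2a≤n b<H)) (restore (2a≤n c<H))))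

      indicator-double : ∀ a b c → ⟦ a ℕ.+ a ℕ.+ (b ℕ.+ b) ℕ.≟ c ℕ.+ c ⟧ ≡ ⟦ a ℕ.+ b ℕ.≟ c ⟧
      indicator-double a b c = ⟦⟧-cong (a ℕ.+ a ℕ.+ (b ℕ.+ b) ℕ.≟ c ℕ.+ c) (a ℕ.+ b ℕ.≟ c)
        (λ eq → double-injective (trans (alg a b) eq)) (λ { refl → sym (alg a b) })
        where
        alg : ∀ a b → a ℕ.+ b ℕ.+ (a ℕ.+ b) ≡ a ℕ.+ a ℕ.+ (b ℕ.+ b)
        alg = solve-∀ℕ

    -- Since n is odd, the number of odd entries is three or one.
    Z-by-parity : Zₙ ≡ oddʳ + # 3 * mixedʳ
    Z-by-parity = trans
      (∑³-split (λ a → a ℕ.+ a) (λ a → n ∸ (a ℕ.+ a)) (∑-split-parity h) (sumTo n r) (sumTo-sym₁₂ n r) (sumTo-sym₂₃ n r))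
      (trans (collapse mixedʳ
        (∑³-sumTo-0 r (λ a → a ℕ.+ a) (λ a → a ℕ.+ a) (λ a → a ℕ.+ a) (λ a b c _ _ _ → no-even³ a b c))
        (∑³-sumTo-0 r (λ a → a ℕ.+ a) (λ a → n ∸ (a ℕ.+ a)) (λ a → n ∸ (a ℕ.+ a)) no-odd²) (refl {x = oddʳ}))
      (two-terms mixedʳ oddʳ))

    -- At most one entry can exceed n/2.
    Z-by-size : Zₙ ≡ small + # 3 * large
    Z-by-size = trans
      (∑³-split (λ a → a) (λ a → n ∸ a) (∑-split-half h) (sumTo n r) (sumTo-sym₁₂ n r) (sumTo-sym₂₃ n r))
      (trans (collapse large (refl {x = small})
        (∑³-sumTo-0 r (λ a → a) (λ a → n ∸ a) (λ a → n ∸ a) (λ a b c _ → no-large² a b c))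
        (∑³-sumTo-0 r (λ a → n ∸ a) (λ a → n ∸ a) (λ a → n ∸ a) (λ a b c _ → no-large² (n ∸ a) b c)))
      (two-terms′ small large))

    odd-sum≡oddʳ : odd-sum n ≡ oddʳ
    odd-sum≡oddʳ = trans (odd-sum≡∑³ n) (trans
      (∑³-split (λ a → a ℕ.+ a) (λ a → n ∸ (a ℕ.+ a)) (∑-split-parity h) (sumTo n odd-r) (sumTo-sym₁₂ n odd-r) (sumTo-sym₂₃ n odd-r))
      (trans (cong₂ (λ (x , y) (z , w) → x + # 3 * y + # 3 * z + w)
        (cong₂ _,_ (first-even (λ a → a ℕ.+ a) (λ a → a ℕ.+ a)) (first-even (λ a → a ℕ.+ a) (λ a → n ∸ (a ℕ.+ a))))
        (cong₂ _,_ (first-even (λ a → n ∸ (a ℕ.+ a)) (λ a → n ∸ (a ℕ.+ a))) all-odd))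
      (one-term oddʳ)))
      where
      alg : ∀ d x y z → d * (0ℚ * x * y * z) ≡ 0ℚ
      alg = solve-∀ ℚ-ring
      -- Three of the four classes have an even first entry, where `odd-r` is 0.
      first-even : ∀ (χ ω : ℕ → ℕ) → ∑³ H (λ a b c → sumTo n odd-r (a ℕ.+ a) (χ b) (ω c)) ≡ 0ℚ
      first-even χ ω = ∑³-0 H λ a b c _ _ _ → trans
        (cong (λ t → ⟦ a ℕ.+ a ℕ.+ χ b ℕ.+ ω c ℕ.≟ n ⟧ * ((if t then 1ℚ else 0ℚ) * r (a ℕ.+ a) * odd-r (χ b) * odd-r (ω c))) (isOdd-even a))
        (alg ⟦ a ℕ.+ a ℕ.+ χ b ℕ.+ ω c ℕ.≟ n ⟧ (r (a ℕ.+ a)) (odd-r (χ b)) (odd-r (ω c)))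
      odd-complement : ∀ {a} → a < H → n ∸ (a ℕ.+ a) ≡ suc ((h ∸ a) ℕ.+ (h ∸ a))
      odd-complement {a} a<H = trans (cong (_∸ (a ℕ.+ a)) (trans (cong (λ m → suc (m ℕ.+ m)) (sym (ℕ.m+[n∸m]≡n (ℕ.≤-pred a<H)))) (sym (algℕ a (h ∸ a)))))
        (ℕ.m+n∸m≡n (a ℕ.+ a) (suc ((h ∸ a) ℕ.+ (h ∸ a))))
        where
        algℕ : ∀ a d → a ℕ.+ a ℕ.+ suc (d ℕ.+ d) ≡ suc (a ℕ.+ d ℕ.+ (a ℕ.+ d))
        algℕ = solve-∀ℕ
      odd-r-odd : ∀ {a} → a < H → odd-r (n ∸ (a ℕ.+ a)) ≡ r (n ∸ (a ℕ.+ a))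
      odd-r-odd {a} a<H = trans (cong (λ t → (if t then 1ℚ else 0ℚ) * r (n ∸ (a ℕ.+ a)))
        (trans (cong isOdd (odd-complement a<H)) (isOdd-odd (h ∸ a)))) (ℚ.*-identityˡ (r (n ∸ (a ℕ.+ a))))
      all-odd : ∑³ H (λ a b c → sumTo n odd-r (n ∸ (a ℕ.+ a)) (n ∸ (b ℕ.+ b)) (n ∸ (c ℕ.+ c))) ≡ oddʳ
      all-odd = ∑³-cong H λ a b c a<H b<H c<H →
        cong (⟦ n ∸ (a ℕ.+ a) ℕ.+ (n ∸ (b ℕ.+ b)) ℕ.+ (n ∸ (c ℕ.+ c)) ℕ.≟ n ⟧ *_)
          (cong₂ _*_ (cong₂ _*_ (odd-r-odd a<H) (odd-r-odd b<H)) (odd-r-odd c<H))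

    private
      -- The common shape of the three congruences that follow: two triple sums with equivalent
      -- indicators are compared term by term. The alternative `e i j k ≡ 0ℚ` is there because the
      -- comparison of odd with small triples holds only for triples with sum n.
      combination≈0 : ∀ c {M} (d e : ℕ → ℕ → ℕ → ℚ) (X Y : ℕ → ℕ → ℕ → ℚ) →
        (∀ i j k → i < H → j < H → k < H → d i j k ≡ e i j k) → (∀ i j k → Integral (e i j k)) →
        (∀ i j k → i < H → j < H → k < H → e i j k ≡ 0ℚ ⊎ # c * X i j k + Y i j k ≈ 0ℚ [ M ]) →
        # c * ∑³ H (λ i j k → d i j k * X i j k) + ∑³ H (λ i j k → e i j k * Y i j k) ≈ 0ℚ [ M ]
      combination≈0 c {M} d e X Y d≡e int-e termwise = ≈-trans (≈-reflexive (trans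
          (cong (_+ ∑³ H (λ i j k → e i j k * Y i j k)) (sym (∑³-*ˡ (# c) H (λ i j k → d i j k * X i j k))))
          (sym (∑³-+ H (λ i j k → # c * (d i j k * X i j k)) (λ i j k → e i j k * Y i j k)))))
        (≈-trans (≈-∑ H λ i i<H → ≈-∑ H λ j j<H → ≈-∑ H λ k k<H → term i j k i<H j<H k<H)
          (≈-reflexive (∑³-0 H {λ _ _ _ → 0ℚ} λ _ _ _ _ _ _ → refl)))
        where
        alg : ∀ c d x y → c * (d * x) + d * y ≡ d * (c * x + y)
        alg = solve-∀ ℚ-ring
        term : ∀ i j k → i < H → j < H → k < H → # c * (d i j k * X i j k) + e i j k * Y i j k ≈ 0ℚ [ M ]
        term i j k i<H j<H k<H = ≈-trans
          (≈-reflexive (trans (cong (λ t → # c * (t * X i j k) + e i j k * Y i j k) (d≡e i j k i<H j<H k<H)) (alg (# c) (e i j k) (X i j k) (Y i j k))))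
          (vanishing (termwise i j k i<H j<H k<H))
          where
          vanishing : e i j k ≡ 0ℚ ⊎ # c * X i j k + Y i j k ≈ 0ℚ [ M ] → e i j k * (# c * X i j k + Y i j k) ≈ 0ℚ [ M ]
          vanishing (inj₁ e≡0) = ≈-reflexive (trans (cong (_* (# c * X i j k + Y i j k)) e≡0) (ℚ.*-zeroˡ (# c * X i j k + Y i j k)))
          vanishing (inj₂ ≈0)  = ≈-trans (≈-*ˡ (int-e i j k) ≈0) (≈-reflexive (ℚ.*-zeroʳ (e i j k)))

    8odd+small≈0 : # 8 * oddʳ + small ≈ 0ℚ [ P ℕ.* 3 ]
    8odd+small≈0 = combination≈0 8
      (λ a b c → ⟦ n ∸ (a ℕ.+ a) ℕ.+ (n ∸ (b ℕ.+ b)) ℕ.+ (n ∸ (c ℕ.+ c)) ℕ.≟ n ⟧) (λ a b c → ⟦ a ℕ.+ b ℕ.+ c ℕ.≟ n ⟧)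
      (λ a b c → r (n ∸ (a ℕ.+ a)) * r (n ∸ (b ℕ.+ b)) * r (n ∸ (c ℕ.+ c))) (λ a b c → r a * r b * r c)
      (λ a b c → indicator-odd) (λ a b c → int-⟦⟧ (a ℕ.+ b ℕ.+ c ℕ.≟ n)) term
      where
      term : ∀ a b c → a < H → b < H → c < H → ⟦ a ℕ.+ b ℕ.+ c ℕ.≟ n ⟧ ≡ 0ℚ ⊎
        # 8 * (r (n ∸ (a ℕ.+ a)) * r (n ∸ (b ℕ.+ b)) * r (n ∸ (c ℕ.+ c))) + r a * r b * r c ≈ 0ℚ [ P ℕ.* 3 ]
      term a b c a<H b<H c<H with a ℕ.+ b ℕ.+ c ℕ.≟ n
      ... | no a+b+c≢n = inj₁ (⟦⟧-no (a ℕ.+ b ℕ.+ c ℕ.≟ n) a+b+c≢n)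
      ... | yes a+b+c≡n = inj₂ (large-triple a<H b<H c<H a+b+c≡n)

    -- (2a)(2b)(n - 2c) ≡ -8abc, and 2a + 2b + (n - 2c) = n says a + b = c.
    8mixed+convolution≈0 : # 8 * mixedʳ + convolution ≈ 0ℚ [ P ]
    8mixed+convolution≈0 = combination≈0 8
      (λ a b c → ⟦ a ℕ.+ a ℕ.+ (b ℕ.+ b) ℕ.+ (n ∸ (c ℕ.+ c)) ℕ.≟ n ⟧) (λ a b c → ⟦ a ℕ.+ b ℕ.≟ c ⟧)
      (λ a b c → r (a ℕ.+ a) * r (b ℕ.+ b) * r (n ∸ (c ℕ.+ c))) (λ a b c → r a * r b * r c)
      (λ a b c _ _ c<H → trans (indicator-reflect {a ℕ.+ a ℕ.+ (b ℕ.+ b)} (2a≤n c<H)) (indicator-double a b c))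
      (λ a b c → int-⟦⟧ (a ℕ.+ b ℕ.≟ c))
      λ a b c _ _ c<H → inj₂ (≈-trans
        (≈-+ (≈-*ˡ (int-# 8) (≈-*ˡ (int-* (int-r (a ℕ.+ a)) (int-r (b ℕ.+ b))) (r-reflect-double c<H))) ≈-refl)
        (≈-reflexive (trans (cong₂ (λ x y → # 8 * (x * y * - (recip 2 * r c)) + r a * r b * r c) (r-double a) (r-double b))
          (alg (r a) (r b) (r c)))))
      where
      alg : ∀ x y z → # 8 * (recip 2 * x * (recip 2 * y) * - (recip 2 * z)) + x * y * z ≡ 0ℚ
      alg = solve-∀ ℚ-ring

    large+convolution≈0 : large + convolution ≈ 0ℚ [ P ]
    large+convolution≈0 = ≈-trans (≈-reflexive (cong (_+ convolution) (sym (ℚ.*-identityˡ large)))) (combination≈0 1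
      (λ a b c → ⟦ a ℕ.+ b ℕ.+ (n ∸ c) ℕ.≟ n ⟧) (λ a b c → ⟦ a ℕ.+ b ℕ.≟ c ⟧)
      (λ a b c → r a * r b * r (n ∸ c)) (λ a b c → r a * r b * r c)
      (λ a b c _ _ c<H → indicator-reflect {a ℕ.+ b} (a≤n c<H))
      (λ a b c → int-⟦⟧ (a ℕ.+ b ℕ.≟ c))
      λ a b c _ _ c<H → inj₂ (≈-trans
        (≈-+ (≈-*ˡ (int-# 1) (≈-*ˡ (int-* (int-r a) (int-r b)) (r-reflect (a≤n c<H)))) ≈-refl)
        (≈-reflexive (alg (r a) (r b) (r c)))))
      where
      alg : ∀ x y z → # 1 * (x * y * - z) + x * y * z ≡ 0ℚ
      alg = solve-∀ ℚ-ring

    16odd≈7Z : # 16 * oddʳ ≈ # 7 * Zₙ [ P ]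
    16odd≈7Z = ≈-by-difference (≈-trans
      -- 7Z is written as 8Z - Z, with the parity splitting for 8Z and the size splitting for Z.
      -- Then 24 · `mixedʳ` and 3 · `large` enter with opposite signs and their multiples of
      -- `convolution` cancel.
      (≈-reflexive (trans (trans (alg₁ oddʳ Zₙ) (cong₂ (λ x y → # 16 * oddʳ - (# 8 * x - y)) Z-by-parity Z-by-size)) (alg₂ oddʳ mixedʳ small large convolution)))
      (≈-+ (≈-+ (≈-coarsen (m∣m*n 3) 8odd+small≈0)
        (≈-*ˡ (int-ι (ℤ.- (ℤ.+ 3))) 8mixed+convolution≈0)) (≈-*ˡ (int-# 3) large+convolution≈0)))
      where
      alg₂ : ∀ o m s l d → # 16 * o - (# 8 * (o + # 3 * m) - (s + # 3 * l)) ≡ # 8 * o + s + ι (ℤ.- (ℤ.+ 3)) * (# 8 * m + d) + # 3 * (l + d)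
      alg₂ = solve-∀ ℚ-ring
      alg₁ : ∀ o z → # 16 * o - # 7 * z ≡ # 16 * o - (# 8 * z - z)
      alg₁ = solve-∀ ℚ-ring

    private
      3*≈0 : ∀ {x M} → x ≈ 0ℚ [ M ] → # 3 * x ≈ 0ℚ [ M ℕ.* 3 ]
      3*≈0 {x} {M} x≈0 = subst₂ (λ y N → # 3 * x ≈ y [ N ]) (ℚ.*-zeroʳ (# 3)) (ℕ.*-comm 3 M) (≈-scale 3 x≈0)

      ⅓*≈0 : ∀ {x M} → # 3 * x ≈ 0ℚ [ M ℕ.* 3 ] → x ≈ 0ℚ [ M ]
      ⅓*≈0 {x} {M} 3x≈0 = ≈-unscale 3 {x} {0ℚ} {M}
        (subst₂ (λ y N → # 3 * x ≈ y [ N ]) (sym (ℚ.*-zeroʳ (# 3))) (ℕ.*-comm M 3) 3x≈0)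

    -- Now 8Z + Z is formed instead. The brackets with `mixedʳ` and `large` carry an explicit 3,
    -- which lifts their modulus to 3P; the remaining one holds modulo 3P already.
    9Z+6convolution≈0 : # 3 * (# 3 * Zₙ + # 2 * convolution) ≈ 0ℚ [ P ℕ.* 3 ]
    9Z+6convolution≈0 = ≈-trans
      (≈-reflexive (trans (split9 Zₙ convolution)
        (trans (cong₂ (λ x y → # 8 * x + y + # 6 * convolution) Z-by-parity Z-by-size) (alg oddʳ mixedʳ small large convolution))))
      (≈-+ (≈-+ 8odd+small≈0 (3*≈0 8mixed+convolution≈0)) (3*≈0 large+convolution≈0))
      where
      split9 : ∀ z d → # 3 * (# 3 * z + # 2 * d) ≡ # 8 * z + z + # 6 * d
      split9 = solve-∀ ℚ-ring
      alg : ∀ o m s l d → # 8 * (o + # 3 * m) + (s + # 3 * l) + # 6 * d ≡ # 8 * o + s + # 3 * (# 8 * m + d) + # 3 * (l + d)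
      alg = solve-∀ ℚ-ring

    3Z+2convolution≈0 : # 3 * Zₙ + # 2 * convolution ≈ 0ℚ [ P ]
    3Z+2convolution≈0 = ⅓*≈0 9Z+6convolution≈0

  -- Pair sums and complete residue sums.

  module Convolution (p q : ℕ) (p-prime : Prime p) (q-prime : Prime q) (p≢2 : p ≢ 2) (q≢2 : q ≢ 2)
    (α β h : ℕ) (n≡ : suc (h ℕ.+ h) ≡ p ℕ.^ suc α ℕ.* q ℕ.^ suc β) where
    open Localization p p-prime
    open TwoPrimes p q p-prime q-prime
    open Reflection p q p-prime q-prime p≢2 q≢2 α β h n≡
    open TripleCongruences p q p-prime q-prime p≢2 q≢2 α β h n≡

    private
      P n H : ℕ
      P = p ℕ.^ suc α
      n = suc (h ℕ.+ h)
      H = suc h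

    pairSum : ℕ → ℚ
    pairSum l = ∑[ b < suc l ] (r b * r (l ∸ b))

    int-pairSum : ∀ l → Integral (pairSum l)
    int-pairSum l = int-∑ (suc l) λ b _ → int-* (int-r b) (int-r (l ∸ b))

    private
      rotate : ∀ N F → ∑³ N F ≡ ∑³ N (λ i j k → F j k i)
      rotate N F = trans (∑³-swap₂₃ N F) (∑³-swap₁₂ N (λ i j k → F i k j))

      slice : ∀ {l M} c → l < M → (∑[ a < M ] ∑[ b < M ] (⟦ a ℕ.+ b ℕ.≟ l ⟧ * (r a * r b * c))) ≡ pairSum l * c
      slice {l} c l<M = trans (∑-convolution l<M (λ a b → r a * r b * c)) (∑-*ʳ c (suc l) (λ b → r b * r (l ∸ b)))

    convolution≡∑ : convolution ≡ (∑[ c < H ] (pairSum c * r c))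
    convolution≡∑ = trans (rotate H (λ a b c → ⟦ a ℕ.+ b ℕ.≟ c ⟧ * (r a * r b * r c))) (∑-cong H λ c c<H → slice (r c) c<H)

    Zₙ≡∑ : Zₙ ≡ (∑[ c < suc n ] (pairSum (n ∸ c) * r c))
    Zₙ≡∑ = trans (rotate (suc n) (sumTo n r)) (∑-cong (suc n) λ c c<1+n → trans
      (∑-cong (suc n) λ a _ → ∑-cong (suc n) λ b _ → cong (_* (r a * r b * r c)) (⟦⟧-cong (a ℕ.+ b ℕ.+ c ℕ.≟ n) (a ℕ.+ b ℕ.≟ n ∸ c)
        (λ eq → trans (sym (ℕ.m+n∸n≡m (a ℕ.+ b) c)) (cong (_∸ c) eq))
        (λ eq → trans (cong (ℕ._+ c) eq) (ℕ.m∸n+n≡m (ℕ.≤-pred c<1+n)))))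
      (slice (r c) (s≤s (ℕ.m∸n≤m n c))))

    -- The upper half of the range, reflected, has terms `pairSum c * r (n ∸ c)` ≡
    -- -`pairSum c * r c`, which add up to -`convolution`.
    Zₙ≈ : Zₙ ≈ (∑[ c < H ] (pairSum (n ∸ c) * r c)) - convolution [ P ]
    Zₙ≈ = ≈-trans (≈-reflexive (trans Zₙ≡∑ (∑-split-half h (λ c → pairSum (n ∸ c) * r c))))
      (≈-+ (≈-refl {∑[ c < H ] (pairSum (n ∸ c) * r c)}) (≈-trans
        (≈-∑ H λ c c<H → ≈-trans (≈-reflexive (cong (λ m → pairSum m * r (n ∸ c)) (ℕ.m∸[m∸n]≡n (a≤n c<H))))
          (≈-trans (≈-*ˡ (int-pairSum c) (r-reflect (a≤n c<H))) (≈-reflexive (alg (pairSum c) (r c)))))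
        (≈-reflexive (trans (∑-*ˡ (- 1ℚ) H (λ c → pairSum c * r c)) (trans (cong (- 1ℚ *_) (sym convolution≡∑)) (alg₂ convolution))))))
      where
      alg : ∀ x y → x * - y ≡ - 1ℚ * (x * y)
      alg = solve-∀ ℚ-ring
      alg₂ : ∀ x → - 1ℚ * x ≡ - x
      alg₂ = solve-∀ ℚ-ring

    -- With D for `convolution`, the left side is D + (Z + D) = (3Z + 2D) - 2Z.
    half-sum≈-2Z : (∑[ e < H ] (r e * (pairSum e + pairSum (n ∸ e)))) ≈ - (# 2 * Zₙ) [ P ]
    half-sum≈-2Z = begin
      (∑[ e < H ] (r e * (pairSum e + pairSum (n ∸ e))))
        ≡⟨ trans (∑-cong H λ e _ → alg (r e) (pairSum e) (pairSum (n ∸ e))) (∑-+ H (λ e → pairSum e * r e) (λ e → pairSum (n ∸ e) * r e)) ⟩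
      (∑[ e < H ] (pairSum e * r e)) + Y
        ≡⟨ trans (cong (_+ Y) (sym convolution≡∑)) (alg₂ convolution Y) ⟩
      Y - convolution + # 2 * convolution
        ≈⟨ ≈-+ (≈-sym Zₙ≈) ≈-refl ⟩
      Zₙ + # 2 * convolution
        ≡⟨ alg₃ Zₙ convolution ⟩
      # 3 * Zₙ + # 2 * convolution - # 2 * Zₙ
        ≈⟨ ≈-+ 3Z+2convolution≈0 ≈-refl ⟩
      0ℚ - # 2 * Zₙ
        ≡⟨ ℚ.+-identityˡ (- (# 2 * Zₙ)) ⟩
      - (# 2 * Zₙ) ∎
      where
      open ≈-Reasoning P
      Y : ℚ
      Y = ∑[ e < H ] (pairSum (n ∸ e) * r e)
      alg : ∀ x y z → x * (y + z) ≡ y * x + z * x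
      alg = solve-∀ ℚ-ring
      alg₂ : ∀ c y → c + y ≡ y - c + # 2 * c
      alg₂ = solve-∀ ℚ-ring
      alg₃ : ∀ z c → z + # 2 * c ≡ # 3 * z + # 2 * c - # 2 * z
      alg₃ = solve-∀ ℚ-ring

    -- The sum of 1/b over b ≤ m with b and m - b both units. For a unit m it is m/2 times
    -- `pairSum m`.
    A : ℕ → ℚ
    A m = ∑[ b < suc m ] (r b * χ (m ∸ b))

    A-reverse : ∀ m → A m ≡ (∑[ b < suc m ] (χ b * r (m ∸ b)))
    A-reverse m = trans (sym (∑-reverse m (λ b → r b * χ (m ∸ b)))) (∑-cong (suc m) λ b b<1+m →
      trans (cong (λ k → r (m ∸ b) * χ k) (ℕ.m∸[m∸n]≡n (ℕ.≤-pred b<1+m))) (ℚ.*-comm (r (m ∸ b)) (χ b)))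

    -- Partial fractions 1/(bc) = (1/e)(1/b + 1/c) for b + c = e. The factors χ keep the identity
    -- valid when b or c is not a unit.
    r*r : ∀ {e b c} → Unit e → b ℕ.+ c ≡ e → r b * r c ≡ recip e * (r b * χ c + χ b * r c)
    r*r {e} {b} {c} ue b+c≡e with unit? b | unit? c
    ... | no ¬ub | _ = trans (cong (_* r c) (r-nonunit ¬ub)) (trans (alg (r c) (recip e) (χ c))
      (cong₂ (λ x y → recip e * (x * χ c + y * r c)) (sym (r-nonunit ¬ub)) (sym (⟦⟧-no (unit? b) ¬ub))))
      where
      alg : ∀ x y z → 0ℚ * x ≡ y * (0ℚ * z + 0ℚ * x)
      alg = solve-∀ ℚ-ring
    ... | yes _ | no ¬uc = trans (cong (r b *_) (r-nonunit ¬uc)) (trans (alg (r b) (recip e) (χ b))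
      (cong₂ (λ x y → recip e * (r b * x + χ b * y)) (sym (⟦⟧-no (unit? c) ¬uc)) (sym (r-nonunit ¬uc))))
      where
      alg : ∀ x y z → x * 0ℚ ≡ y * (x * 0ℚ + z * 0ℚ)
      alg = solve-∀ ℚ-ring
    ... | yes ub | yes uc = begin
      r b * r c
        ≡⟨ cong₂ _*_ (r-unit ub) (r-unit uc) ⟩
      recip b * recip c
        ≡⟨ sym (ℚ.*-identityˡ (recip b * recip c)) ⟩
      1ℚ * (recip b * recip c)
        ≡⟨ cong (_* (recip b * recip c)) (sym (inverse ue)) ⟩
      # e * recip e * (recip b * recip c)
        ≡⟨ cong (λ x → x * recip e * (recip b * recip c)) (trans (cong # (sym b+c≡e)) (#-+ b c)) ⟩
      (# b + # c) * recip e * (recip b * recip c)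
        ≡⟨ alg (# b) (# c) (recip e) (recip b) (recip c) ⟩
      recip e * (recip b * (# c * recip c) + # b * recip b * recip c)
        ≡⟨ cong₂ (λ x y → recip e * (recip b * x + y * recip c)) (trans (inverse uc) (sym (⟦⟧-yes (unit? c) uc))) (trans (inverse ub) (sym (⟦⟧-yes (unit? b) ub))) ⟩
      recip e * (recip b * χ c + χ b * recip c)
        ≡⟨ cong₂ (λ x y → recip e * (x * χ c + χ b * y)) (sym (r-unit ub)) (sym (r-unit uc)) ⟩
      recip e * (r b * χ c + χ b * r c) ∎
      where
      open ≡-Reasoning
      inverse : ∀ {i} → Unit i → # i * recip i ≡ 1ℚ
      inverse {i} (p∤i , _) = recip-inverse i {{∤-nonZero p∤i}}
      alg : ∀ b c e x y → (b + c) * e * (x * y) ≡ e * (x * (c * y) + b * x * y)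
      alg = solve-∀ ℚ-ring

    pairSum≡ : ∀ {e} → Unit e → pairSum e ≡ # 2 * (recip e * A e)
    pairSum≡ {e} ue = begin
      pairSum e
        ≡⟨ ∑-cong (suc e) (λ b b<1+e → r*r ue (ℕ.m+[n∸m]≡n (ℕ.≤-pred b<1+e))) ⟩
      (∑[ b < suc e ] (recip e * (r b * χ (e ∸ b) + χ b * r (e ∸ b))))
        ≡⟨ trans (∑-*ˡ (recip e) (suc e) (λ b → r b * χ (e ∸ b) + χ b * r (e ∸ b))) (cong (recip e *_) (∑-+ (suc e) (λ b → r b * χ (e ∸ b)) (λ b → χ b * r (e ∸ b)))) ⟩
      recip e * (A e + (∑[ b < suc e ] (χ b * r (e ∸ b))))
        ≡⟨ cong (λ x → recip e * (A e + x)) (sym (A-reverse e)) ⟩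
      recip e * (A e + A e)
        ≡⟨ alg (recip e) (A e) ⟩
      # 2 * (recip e * A e) ∎
      where
      open ≡-Reasoning
      alg : ∀ x a → x * (a + a) ≡ # 2 * (x * a)
      alg = solve-∀ ℚ-ring

    χ-shift : ∀ b → χ b ≡ χ (b ℕ.+ n)
    χ-shift b = χ-cong
      (λ (p∤b , q∤b) → (λ p∣b+n → p∤b (∣m+n∣m⇒∣n (subst (p ∣_) (ℕ.+-comm b n) p∣b+n) p∣n)) ,
                       (λ q∣b+n → q∤b (∣m+n∣m⇒∣n (subst (q ∣_) (ℕ.+-comm b n) q∣b+n) q∣n)))
      (λ (p∤b+n , q∤b+n) → (λ p∣b → p∤b+n (∣m∣n⇒∣m+n p∣b p∣n)) , (λ q∣b → q∤b+n (∣m∣n⇒∣m+n q∣b q∣n)))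

    -- Since b − e ≡ b + (n − e), this is the sum of 1/b over the residues b mod n with b and b − e coprime to pq.
    R : ℕ → ℚ
    R e = ∑[ b < n ] (r b * χ (b ℕ.+ (n ∸ e)))

    module _ {e : ℕ} (e≤n : e ≤ n) where
      private
        f : ℕ → ℚ
        f b = r b * χ (b ℕ.+ (n ∸ e))

      -- e - b and b + (n - e) add up to n, so they are units together. The last term b = e drops
      -- out because χ 0 = 0.
      A≡ : A e ≡ ∑ e f
      A≡ = trans (∑-suc e (λ b → r b * χ (e ∸ b))) (trans (cong₂ _+_
        (∑-cong e λ b b<e → cong (r b *_) (χ-complement p∣n q∣n (complement b b<e)))
        (trans (cong (λ m → r e * χ m) (ℕ.n∸n≡0 e)) (trans (cong (r e *_) χ0≡0) (ℚ.*-zeroʳ (r e)))))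
        (ℚ.+-identityʳ (∑ e f)))
        where
        complement : ∀ b → b < e → e ∸ b ℕ.+ (b ℕ.+ (n ∸ e)) ≡ n
        complement b b<e = trans (sym (ℕ.+-assoc (e ∸ b) b (n ∸ e)))
          (trans (cong (ℕ._+ (n ∸ e)) (ℕ.m∸n+n≡m (ℕ.<⇒≤ b<e))) (ℕ.m+[n∸m]≡n e≤n))

      -- 1/(n - e - b) ≡ -1/(e + b), and b ≡ (e + b) + (n - e) modulo n. In terms of e + b the sum
      -- thus runs over the residues from e to n that `A e` leaves out.
      A-reflect≈ : A (n ∸ e) ≈ - (∑[ b < suc (n ∸ e) ] f (e ℕ.+ b)) [ P ]
      A-reflect≈ = ≈-trans (≈-reflexive (A-reverse (n ∸ e))) (≈-trans
        (≈-∑ (suc (n ∸ e)) λ b b<1+m → ≈-trans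
          (≈-reflexive (cong₂ (λ x m → x * r m) (trans (χ-shift b) (cong χ (shift b))) (ℕ.∸-+-assoc n e b)))
          (≈-trans (≈-*ˡ (int-χ (e ℕ.+ b ℕ.+ (n ∸ e))) (r-reflect (bound b b<1+m)))
            (≈-reflexive (alg (χ (e ℕ.+ b ℕ.+ (n ∸ e))) (r (e ℕ.+ b))))))
        (≈-reflexive (trans (∑-*ˡ (- 1ℚ) (suc (n ∸ e)) (λ b → f (e ℕ.+ b))) (alg₂ (∑[ b < suc (n ∸ e) ] f (e ℕ.+ b))))))
        where
        bound : ∀ b → b < suc (n ∸ e) → e ℕ.+ b ≤ n
        bound b b<1+m = subst (e ℕ.+ b ≤_) (ℕ.m+[n∸m]≡n e≤n) (ℕ.+-monoʳ-≤ e (ℕ.≤-pred b<1+m))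
        shift : ∀ b → b ℕ.+ n ≡ e ℕ.+ b ℕ.+ (n ∸ e)
        shift b = trans (cong (b ℕ.+_) (sym (ℕ.m+[n∸m]≡n e≤n))) (algℕ b e (n ∸ e))
          where
          algℕ : ∀ b e m → b ℕ.+ (e ℕ.+ m) ≡ e ℕ.+ b ℕ.+ m
          algℕ = solve-∀ℕ
        alg : ∀ x y → x * - y ≡ - 1ℚ * (y * x)
        alg = solve-∀ ℚ-ring
        alg₂ : ∀ x → - 1ℚ * x ≡ - x
        alg₂ = solve-∀ ℚ-ring

      -- The term b = n is added for free, r n being 0; it lets the second range end at n.
      R≡ : R e ≡ ∑ e f + (∑[ b < suc (n ∸ e) ] f (e ℕ.+ b))
      R≡ = trans (sym (trans (∑-suc n f) (trans (cong (λ x → ∑ n f + x * χ (n ℕ.+ (n ∸ e))) (r-nonunit λ (p∤n , _) → p∤n p∣n))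
          (alg (∑ n f) (χ (n ℕ.+ (n ∸ e)))))))
        (trans (cong (λ m → ∑ m f) (sym (trans (ℕ.+-suc e (n ∸ e)) (cong suc (ℕ.m+[n∸m]≡n e≤n))))) (∑-split e (suc (n ∸ e)) f))
        where
        alg : ∀ x y → x + 0ℚ * y ≡ x
        alg = solve-∀ ℚ-ring

      -- The sign in 1/(n - e) ≡ -1/e cancels the sign of the reflected half, so the two halves of
      -- `R e` join with the same factor 2/e.
      pairSum-reflect≈ : Unit e → pairSum e + pairSum (n ∸ e) ≈ # 2 * (recip e * R e) [ P ]
      pairSum-reflect≈ ue = begin
        pairSum e + pairSum (n ∸ e)
          ≡⟨ cong₂ _+_ (pairSum≡ ue) (pairSum≡ un-e) ⟩
        # 2 * (recip e * A e) + # 2 * (recip (n ∸ e) * A (n ∸ e))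
          ≈⟨ ≈-+ (≈-reflexive (cong (λ x → # 2 * (recip e * x)) A≡)) (≈-*ˡ (int-# 2)
               (≈-* (int-recip (proj₁ un-e)) (int-neg int-X) recip≈ A-reflect≈)) ⟩
        # 2 * (recip e * ∑ e f) + # 2 * (- recip e * - X)
          ≡⟨ alg (recip e) (∑ e f) X ⟩
        # 2 * (recip e * (∑ e f + X))
          ≡⟨ cong (λ x → # 2 * (recip e * x)) (sym R≡) ⟩
        # 2 * (recip e * R e) ∎
        where
        open ≈-Reasoning P
        X : ℚ
        X = ∑[ b < suc (n ∸ e) ] f (e ℕ.+ b)
        int-X : Integral X
        int-X = int-∑ (suc (n ∸ e)) λ b _ → int-* (int-r (e ℕ.+ b)) (int-χ (e ℕ.+ b ℕ.+ (n ∸ e)))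
        un-e : Unit (n ∸ e)
        un-e = unit-reflect e≤n ue
        recip≈ : recip (n ∸ e) ≈ - recip e [ P ]
        recip≈ = subst₂ (λ x y → x ≈ - y [ P ]) (r-unit un-e) (r-unit ue) (r-reflect e≤n)
        alg : ∀ x s t → # 2 * (x * s) + # 2 * (- x * - t) ≡ # 2 * (x * (s + t))
        alg = solve-∀ ℚ-ring

  -- Linear congruences modulo a prime.

  module Progressions (q : ℕ) (q-prime : Prime q) (m : ℕ) (q∤m : ¬ q ∣ m) where
    private
      instance
        q-nonZero : ℕ.NonZero q
        q-nonZero = prime⇒nonZero q-prime

    ∣-small⇒≡0 : ∀ {k} → k < q → q ∣ k → k ≡ 0
    ∣-small⇒≡0 {zero}  k<q q∣k = refl
    ∣-small⇒≡0 {suc k} k<q q∣k = contradiction (∣⇒≤ q∣k) (ℕ.<⇒≱ k<q)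

    root-unique-≤ : ∀ {i k d} → i ≤ k → k < q → q ∣ i ℕ.* m ℕ.+ d → q ∣ k ℕ.* m ℕ.+ d → i ≡ k
    root-unique-≤ {i} {k} {d} i≤k k<q q∣i q∣k = trans (sym (ℕ.+-identityʳ i))
      (trans (cong (i ℕ.+_) (sym (∣-small⇒≡0 (ℕ.≤-<-trans (ℕ.m∸n≤m k i) k<q) q∣k∸i))) (ℕ.m+[n∸m]≡n i≤k))
      where
      alg : ∀ i x m d → (i ℕ.+ x) ℕ.* m ℕ.+ d ≡ i ℕ.* m ℕ.+ d ℕ.+ x ℕ.* m
      alg = solve-∀ℕ
      q∣k∸i : q ∣ k ∸ i
      q∣k∸i = [ (λ q∣x → q∣x) , (λ q∣m → contradiction q∣m q∤m) ]′ (euclidsLemma (k ∸ i) m q-prime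
        (∣m+n∣m⇒∣n (subst (q ∣_) (trans (cong (λ x → x ℕ.* m ℕ.+ d) (sym (ℕ.m+[n∸m]≡n i≤k))) (alg i (k ∸ i) m d)) q∣k) q∣i))

    root-unique : ∀ {i k d} → i < q → k < q → q ∣ i ℕ.* m ℕ.+ d → q ∣ k ℕ.* m ℕ.+ d → i ≡ k
    root-unique {i} {k} i<q k<q q∣i q∣k with ℕ.≤-total i k
    ... | inj₁ i≤k = root-unique-≤ i≤k k<q q∣i q∣k
    ... | inj₂ k≤i = sym (root-unique-≤ k≤i i<q q∣k q∣i)

    abstract
      root-any : ∀ d → ∃ λ w → q ∣ w ℕ.* m ℕ.+ d
      root-any d with coprime-Bézout (∤⇒coprime q-prime q∤m)
      ... | Bézout.+- x y 1+ym≡xq = y ℕ.* d , divides (d ℕ.* x) (trans (alg y d m) (trans (cong (d ℕ.*_) 1+ym≡xq) (sym (ℕ.*-assoc d x q))))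
        where
        alg : ∀ y d m → y ℕ.* d ℕ.* m ℕ.+ d ≡ d ℕ.* (1 ℕ.+ y ℕ.* m)
        alg = solve-∀ℕ
      -- Here y inverts m itself, while in the first case it inverted -m. The root is therefore y
      -- times -d, with -d replaced by d(q - 1).
      ... | Bézout.-+ x y 1+xq≡ym = y ℕ.* (d ℕ.* (q ∸ 1)) , divides (d ℕ.* (q ∸ 1) ℕ.* x ℕ.+ d)
          (trans (alg y d m (q ∸ 1)) (trans (cong (λ z → d ℕ.* (q ∸ 1) ℕ.* z ℕ.+ d) (sym 1+xq≡ym))
            (trans (alg₂ d (q ∸ 1) x q) (trans (cong (λ z → d ℕ.* (q ∸ 1) ℕ.* x ℕ.* q ℕ.+ d ℕ.* z) (ℕ.m∸n+n≡m (ℕ.>-nonZero⁻¹ q))) (alg₃ d (q ∸ 1) x q)))))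
        where
        alg : ∀ y d m r → y ℕ.* (d ℕ.* r) ℕ.* m ℕ.+ d ≡ d ℕ.* r ℕ.* (y ℕ.* m) ℕ.+ d
        alg = solve-∀ℕ
        alg₂ : ∀ d r x q → d ℕ.* r ℕ.* (1 ℕ.+ x ℕ.* q) ℕ.+ d ≡ d ℕ.* r ℕ.* x ℕ.* q ℕ.+ d ℕ.* (r ℕ.+ 1)
        alg₂ = solve-∀ℕ
        alg₃ : ∀ d r x q → d ℕ.* r ℕ.* x ℕ.* q ℕ.+ d ℕ.* q ≡ (d ℕ.* r ℕ.* x ℕ.+ d) ℕ.* q
        alg₃ = solve-∀ℕ

      root : ∀ d → ∃ λ w → w < q × q ∣ w ℕ.* m ℕ.+ d
      root d with root-any d
      ... | w , q∣ = w % q , m%n<n w q , ∣m+n∣m⇒∣n (subst (q ∣_) eq q∣) (n∣m*n (w ℕ./ q ℕ.* m))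
        where
        alg : ∀ r k q m d → (r ℕ.+ k ℕ.* q) ℕ.* m ℕ.+ d ≡ k ℕ.* m ℕ.* q ℕ.+ (r ℕ.* m ℕ.+ d)
        alg = solve-∀ℕ
        eq : w ℕ.* m ℕ.+ d ≡ w ℕ./ q ℕ.* m ℕ.* q ℕ.+ (w % q ℕ.* m ℕ.+ d)
        eq = trans (cong (λ x → x ℕ.* m ℕ.+ d) (m≡m%n+[m/n]*n w q)) (alg (w % q) (w ℕ./ q) q m d)

    ∑-root : ∀ d f → (∑[ w < q ] (⟦ q ∣? (w ℕ.* m ℕ.+ d) ⟧ * f w)) ≡ f (proj₁ (root d))
    ∑-root d f = ∑-indicator root<q (λ w → q ∣? (w ℕ.* m ℕ.+ d)) (λ w<q q∣w → root-unique w<q root<q q∣w q∣root) q∣root f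
      where
      root<q = proj₁ (proj₂ (root d))
      q∣root = proj₂ (proj₂ (root d))

    count-roots : ∀ d → (∑[ w < q ] ⟦ q ∣? (w ℕ.* m ℕ.+ d) ⟧) ≡ 1ℚ
    count-roots d = trans (∑-cong q λ w _ → sym (ℚ.*-identityʳ ⟦ q ∣? (w ℕ.* m ℕ.+ d) ⟧)) (∑-root d (λ _ → 1ℚ))

    ∣-periodic : ∀ x w d → ⟦ q ∣? ((x ℕ.* q ℕ.+ w) ℕ.* m ℕ.+ d) ⟧ ≡ ⟦ q ∣? (w ℕ.* m ℕ.+ d) ⟧
    ∣-periodic x w d = ⟦⟧-cong (q ∣? ((x ℕ.* q ℕ.+ w) ℕ.* m ℕ.+ d)) (q ∣? (w ℕ.* m ℕ.+ d))
      (λ q∣ → ∣m+n∣m⇒∣n (subst (q ∣_) (alg x q w m d) q∣) (n∣m*n (x ℕ.* m)))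
      (λ q∣ → subst (q ∣_) (sym (alg x q w m d)) (∣m∣n⇒∣m+n (n∣m*n (x ℕ.* m)) q∣))
      where
      alg : ∀ x q w m d → (x ℕ.* q ℕ.+ w) ℕ.* m ℕ.+ d ≡ x ℕ.* m ℕ.* q ℕ.+ (w ℕ.* m ℕ.+ d)
      alg = solve-∀ℕ

    count-roots-periods : ∀ k d → (∑[ w < k ℕ.* q ] ⟦ q ∣? (w ℕ.* m ℕ.+ d) ⟧) ≡ # k
    count-roots-periods k d = trans (∑-block k q (λ w → ⟦ q ∣? (w ℕ.* m ℕ.+ d) ⟧))
      (trans (∑-cong k λ x _ → trans (∑-cong q λ w _ → ∣-periodic x w d) (count-roots d)) (trans (∑-const k 1ℚ) (ℚ.*-identityʳ (# k))))

  -- Sums of reciprocals along an arithmetic progression of difference p.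

  module UnitProgressions (p : ℕ) (p-prime : Prime p) (p≢2 : p ≢ 2) where
    open Localization p p-prime
    p∤1 : ¬ p ∣ 1
    p∤1 = prime∤1 p-prime

    -- Reversing the sum shows that its double vanishes, and 2 is a unit.
    antisymmetric-∑≈0 : ∀ N {M f} → (∀ i → i ≤ N → f (N ∸ i) ≈ - f i [ M ]) → ∑ (suc N) f ≈ 0ℚ [ M ]
    antisymmetric-∑≈0 N {M} {f} antisym = ≈-cancel {2} (λ p∣2 → p≢2 (prime∣prime⇒≡ p-prime (from-yes (prime? 2)) p∣2)) (begin
      # 2 * ∑ (suc N) f
        ≡⟨ trans (alg (∑ (suc N) f)) (cong (∑ (suc N) f +_) (sym (∑-reverse N f))) ⟩
      ∑ (suc N) f + (∑[ i < suc N ] f (N ∸ i))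
        ≈⟨ ≈-+ (≈-refl {∑ (suc N) f}) (≈-∑ (suc N) λ i i<1+N → antisym i (ℕ.≤-pred i<1+N)) ⟩
      ∑ (suc N) f + (∑[ i < suc N ] (- f i))
        ≡⟨ sym (∑-+ (suc N) f (λ i → - f i)) ⟩
      (∑[ i < suc N ] (f i - f i))
        ≡⟨ ∑-0 (suc N) (λ i _ → ℚ.+-inverseʳ (f i)) ⟩
      # 2 * 0ℚ ∎)
      where
      open ≈-Reasoning M
      alg : ∀ x → # 2 * x ≡ x + x
      alg = solve-∀ ℚ-ring

    -- The term t = p, congruent to 0, makes the range symmetric under t ↦ p - t.
    ∑-residues≈0 : (∑[ t < p ] # t) ≈ 0ℚ [ p ]
    ∑-residues≈0 = ≈-trans (≈-reflexive (sym (ℚ.+-identityʳ (∑ p #)))) (≈-trans (≈-+ (≈-refl {∑ p #}) (≈-sym (∣⇒≈0 {p} n∣n)))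
      (≈-trans (≈-reflexive (sym (∑-suc p #))) (antisymmetric-∑≈0 p λ t t≤p →
        ≈-trans (≈-reflexive (#-∸ t≤p)) (≈-trans (≈-+ (∣⇒≈0 n∣n) ≈-refl) (≈-reflexive (ℚ.+-identityˡ (- # t)))))))

    ∤-+multiple : ∀ {z} x → ¬ p ∣ z → ¬ p ∣ x ℕ.* p ℕ.+ z
    ∤-+multiple x p∤z p∣ = p∤z (∣m+n∣m⇒∣n p∣ (n∣m*n x))

    recip-+multiple : ∀ {z} x {M} → M ∣ x ℕ.* p → ¬ p ∣ z → recip (x ℕ.* p ℕ.+ z) ≈ recip z [ M ]
    recip-+multiple {z} x M∣xp p∤z = ≈-recip (∤-+multiple x p∤z) p∤z
      (≈-trans (≈-reflexive (#-+ (x ℕ.* p) z)) (≈-trans (≈-+ (∣⇒≈0 M∣xp) ≈-refl) (≈-reflexive (ℚ.+-identityˡ (# z)))))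

    -- From the exact identity 1/(mM + a) = 1/a - mM · (1/a) · 1/(mM + a). Its last term already
    -- carries M, so the two inverses in it matter only modulo p, where both are 1/z.
    recip-expand : ∀ {a m z M} → ¬ p ∣ a → ¬ p ∣ z → p ∣ m ℕ.* M → ¬ p ∣ m ℕ.* M ℕ.+ a → recip a ≈ recip z [ p ] →
      recip (m ℕ.* M ℕ.+ a) ≈ recip a - # m * (# M * (recip z * recip z)) [ M ℕ.* p ]
    recip-expand {a} {m} {z} {M} p∤a p∤z p∣mM p∤mM+a a≈z = ≈-trans (≈-reflexive exact)
      (≈-+ (≈-refl {recip a}) (≈-neg (≈-*ˡ (int-# m) (≈-scale M
        (≈-* (int-recip p∤a) (int-recip p∤z) a≈z
          (≈-trans (≈-recip p∤mM+a p∤a (≈-trans (≈-reflexive (#-+ (m ℕ.* M) a)) (≈-trans (≈-+ (∣⇒≈0 p∣mM) ≈-refl) (≈-reflexive (ℚ.+-identityˡ (# a)))))) a≈z))))))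
      where
      open ≡-Reasoning
      u v : ℚ
      u = recip a
      v = recip (m ℕ.* M ℕ.+ a)
      alg : ∀ u v a m M → v * (a * u) ≡ u * ((m * M + a) * v) - m * (M * (u * v))
      alg = solve-∀ ℚ-ring
      exact : v ≡ u - # m * (# M * (u * v))
      exact = begin
        v                                                       ≡⟨ sym (ℚ.*-identityʳ v) ⟩
        v * 1ℚ                                                  ≡⟨ cong (v *_) (sym (recip-inverse a {{∤-nonZero p∤a}})) ⟩
        v * (# a * u)                                           ≡⟨ alg u v (# a) (# m) (# M) ⟩
        u * ((# m * # M + # a) * v) - # m * (# M * (u * v))     ≡⟨ cong (λ x → u * (x * v) - # m * (# M * (u * v))) (sym (trans (#-+ (m ℕ.* M) a) (cong (_+ # a) (#-* m M)))) ⟩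
        u * (# (m ℕ.* M ℕ.+ a) * v) - # m * (# M * (u * v))     ≡⟨ cong (λ x → u * x - # m * (# M * (u * v))) (recip-inverse (m ℕ.* M ℕ.+ a) {{∤-nonZero p∤mM+a}}) ⟩
        u * 1ℚ - # m * (# M * (u * v))                          ≡⟨ cong (_- # m * (# M * (u * v))) (ℚ.*-identityʳ u) ⟩
        u - # m * (# M * (u * v))                               ∎

    -- Termwise comparison would give this only modulo p. Writing x = t p^(j-1) + y and expanding in
    -- t, the first-order corrections are multiples of t, and their sum over t < p gains another
    -- factor p. Each step of the induction thus raises the modulus by p.
    recip-progression : ∀ j {z} → ¬ p ∣ z → (∑[ x < p ℕ.^ j ] recip (x ℕ.* p ℕ.+ z)) ≈ # (p ℕ.^ j) * recip z [ p ℕ.^ suc j ]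
    recip-progression zero    {z} p∤z = ≈-reflexive (trans (∑-1 (λ x → recip (x ℕ.* p ℕ.+ z))) (sym (ℚ.*-identityˡ (recip z))))
    recip-progression (suc j) {z} p∤z = begin
      (∑[ x < p ℕ.* Q ] recip (x ℕ.* p ℕ.+ z))
        ≡⟨ trans (∑-block p Q (λ x → recip (x ℕ.* p ℕ.+ z))) (∑-swap p Q (λ t y → recip ((t ℕ.* Q ℕ.+ y) ℕ.* p ℕ.+ z))) ⟩
      (∑[ y < Q ] ∑[ t < p ] recip ((t ℕ.* Q ℕ.+ y) ℕ.* p ℕ.+ z))
        ≈⟨ (≈-∑ Q λ y _ → ≈-trans (≈-∑ p λ t _ → expand y t) (average y)) ⟩
      (∑[ y < Q ] (# p * recip (y ℕ.* p ℕ.+ z)))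
        ≡⟨ ∑-*ˡ (# p) Q (λ y → recip (y ℕ.* p ℕ.+ z)) ⟩
      # p * (∑[ y < Q ] recip (y ℕ.* p ℕ.+ z))
        ≈⟨ ≈-scale p (recip-progression j p∤z) ⟩
      # p * (# Q * recip z)
        ≡⟨ trans (sym (ℚ.*-assoc (# p) (# Q) (recip z))) (cong (_* recip z) (sym (#-* p Q))) ⟩
      # (p ℕ.* Q) * recip z ∎
      where
      Q M : ℕ
      Q = p ℕ.^ j
      M = p ℕ.* Q
      open ≈-Reasoning (p ℕ.* M)
      w : ℚ
      w = # M * (recip z * recip z)
      p∣M : p ∣ M
      p∣M = m∣m*n Q
      algℕ : ∀ t Q y p z → (t ℕ.* Q ℕ.+ y) ℕ.* p ℕ.+ z ≡ t ℕ.* (p ℕ.* Q) ℕ.+ (y ℕ.* p ℕ.+ z)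
      algℕ = solve-∀ℕ
      expand : ∀ y t → recip ((t ℕ.* Q ℕ.+ y) ℕ.* p ℕ.+ z) ≈ recip (y ℕ.* p ℕ.+ z) - # t * w [ p ℕ.* M ]
      expand y t = subst₂ (λ k N → recip k ≈ recip (y ℕ.* p ℕ.+ z) - # t * w [ N ]) (sym (algℕ t Q y p z)) (ℕ.*-comm M p)
        (recip-expand {m = t} {M = M} (∤-+multiple y p∤z) p∤z (∣n⇒∣m*n t p∣M)
          (subst (λ k → ¬ p ∣ k) (algℕ t Q y p z) (∤-+multiple (t ℕ.* Q ℕ.+ y) p∤z))
          (recip-+multiple y (n∣m*n y) p∤z))
      average : ∀ y → (∑[ t < p ] (recip (y ℕ.* p ℕ.+ z) - # t * w)) ≈ # p * recip (y ℕ.* p ℕ.+ z) [ p ℕ.* M ]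
      average y = ≈-trans (≈-reflexive (trans (∑-+ p (λ _ → u) (λ t → - (# t * w))) (cong₂ _+_ (∑-const p u)
          (trans (∑-cong p λ t _ → alg (# t) w) (∑-*ʳ (- w) p #)))))
        (≈-trans (≈-+ (≈-refl {# p * u}) vanish) (≈-reflexive (ℚ.+-identityʳ (# p * u))))
        where
        u = recip (y ℕ.* p ℕ.+ z)
        alg : ∀ t w → - (t * w) ≡ t * - w
        alg = solve-∀ ℚ-ring
        alg₂ : ∀ s m v → s * - (m * v) ≡ - v * (m * s)
        alg₂ = solve-∀ ℚ-ring
        vanish : (∑[ t < p ] # t) * - w ≈ 0ℚ [ p ℕ.* M ]
        vanish = ≈-trans (≈-reflexive (alg₂ (∑ p #) (# M) (recip z * recip z)))
          (≈-trans (≈-*ˡ (int-neg (int-* (int-recip p∤z) (int-recip p∤z)))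
            (subst (# M * ∑ p # ≈ # M * 0ℚ [_]) (ℕ.*-comm M p) (≈-scale M ∑-residues≈0)))
          (≈-reflexive (trans (cong (- (recip z * recip z) *_) (ℚ.*-zeroʳ (# M))) (ℚ.*-zeroʳ (- (recip z * recip z))))))

  -- The part of the residue sum at the prime p.

  ν : ℕ → ℕ → ℚ
  ν m i = ⟦ ¬? (m ∣? i) ⟧

  ν-∣ : ∀ {m i} → m ∣ i → ν m i ≡ 0ℚ
  ν-∣ {m} {i} m∣i = ⟦⟧-no (¬? (m ∣? i)) (λ m∤i → m∤i m∣i)

  ν-∤ : ∀ {m i} → ¬ m ∣ i → ν m i ≡ 1ℚ
  ν-∤ {m} {i} m∤i = ⟦⟧-yes (¬? (m ∣? i)) m∤i

  ν≡1- : ∀ m i → ν m i ≡ 1ℚ - ⟦ m ∣? i ⟧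
  ν≡1- m i with m ∣? i
  ... | yes _ = refl
  ... | no _  = refl

  ν-+multiple : ∀ {m c} i → m ∣ c → ν m (c ℕ.+ i) ≡ ν m i
  ν-+multiple {m} {c} i m∣c = ⟦⟧-cong (¬? (m ∣? c ℕ.+ i)) (¬? (m ∣? i))
    (λ m∤c+i m∣i → m∤c+i (∣m∣n⇒∣m+n m∣c m∣i)) (λ m∤i m∣c+i → m∤i (∣m+n∣m⇒∣n m∣c+i m∣c))

  -- Inclusion and exclusion without a third term: m cannot divide both c and c + e.
  ν*ν : ∀ {m e} c → ¬ m ∣ e → ν m c * ν m (c ℕ.+ e) ≡ 1ℚ - ⟦ m ∣? c ⟧ - ⟦ m ∣? c ℕ.+ e ⟧
  ν*ν {m} {e} c m∤e = trans (cong₂ _*_ (ν≡1- m c) (ν≡1- m (c ℕ.+ e))) (cases (m ∣? c))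
    where
    alg : ∀ x → (1ℚ - 0ℚ) * (1ℚ - x) ≡ 1ℚ - 0ℚ - x
    alg = solve-∀ ℚ-ring
    cases : Dec (m ∣ c) → (1ℚ - ⟦ m ∣? c ⟧) * (1ℚ - ⟦ m ∣? c ℕ.+ e ⟧) ≡ 1ℚ - ⟦ m ∣? c ⟧ - ⟦ m ∣? c ℕ.+ e ⟧
    cases (yes m∣c) rewrite ⟦⟧-yes (m ∣? c) m∣c | ⟦⟧-no (m ∣? c ℕ.+ e) (λ m∣c+e → m∤e (∣m+n∣m⇒∣n m∣c+e m∣c)) = refl
    cases (no m∤c)  rewrite ⟦⟧-no (m ∣? c) m∤c = alg ⟦ m ∣? c ℕ.+ e ⟧

  module PrimeReciprocals (p : ℕ) (p-prime : Prime p) where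
    open Localization p p-prime

    rₚ : ℕ → ℚ
    rₚ i = ν p i * recip i

    rₚ-∤ : ∀ {i} → ¬ p ∣ i → rₚ i ≡ recip i
    rₚ-∤ {i} p∤i = ⟦⟧-*-yes (¬? (p ∣? i)) p∤i (recip i)

    rₚ-∣ : ∀ {i} → p ∣ i → rₚ i ≡ 0ℚ
    rₚ-∣ {i} p∣i = ⟦⟧-*-no (¬? (p ∣? i)) (λ p∤i → p∤i p∣i) (recip i)

    int-rₚ : ∀ i → Integral (rₚ i)
    int-rₚ i = by (p ∣? i)
      where
      by : Dec (p ∣ i) → Integral (rₚ i)
      by (yes p∣i) = subst Integral (sym (rₚ-∣ p∣i)) int-0
      by (no p∤i)  = subst Integral (sym (rₚ-∤ p∤i)) (int-recip p∤i)

    rₚ-periodic : ∀ {M} → p ∣ M → ∀ x y → rₚ (x ℕ.* M ℕ.+ y) ≈ rₚ y [ M ]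
    rₚ-periodic {M} p∣M x y = by (p ∣? y)
      where
      p∣xM : p ∣ x ℕ.* M
      p∣xM = ∣n⇒∣m*n x p∣M
      by : Dec (p ∣ y) → rₚ (x ℕ.* M ℕ.+ y) ≈ rₚ y [ M ]
      by (yes p∣y) = ≈-reflexive (trans (rₚ-∣ (∣m∣n⇒∣m+n p∣xM p∣y)) (sym (rₚ-∣ p∣y)))
      by (no p∤y)  = subst₂ _≈_[ M ] (sym (rₚ-∤ p∤xM+y)) (sym (rₚ-∤ p∤y))
        (≈-recip p∤xM+y p∤y (≈-trans (≈-reflexive (#-+ (x ℕ.* M) y))
          (≈-trans (≈-+ (∣⇒≈0 (n∣m*n x)) (≈-refl {# y})) (≈-reflexive (ℚ.+-identityˡ (# y))))))
        where
        p∤xM+y : ¬ p ∣ x ℕ.* M ℕ.+ y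
        p∤xM+y p∣ = p∤y (∣m+n∣m⇒∣n p∣ p∣xM)

    rₚ-antisymmetric : ∀ {M} → p ∣ M → ∀ i → i ≤ M → rₚ (M ∸ i) ≈ - rₚ i [ M ]
    rₚ-antisymmetric {M} p∣M i i≤M = by (p ∣? i)
      where
      by : Dec (p ∣ i) → rₚ (M ∸ i) ≈ - rₚ i [ M ]
      by (yes p∣i) = ≈-reflexive (trans (rₚ-∣ (∣m+n∣m⇒∣n (subst (p ∣_) (sym (ℕ.m+[n∸m]≡n i≤M)) p∣M) p∣i)) (cong -_ (sym (rₚ-∣ p∣i))))
      by (no p∤i)  = subst₂ (λ x y → x ≈ - y [ M ]) (sym (rₚ-∤ p∤M∸i)) (sym (rₚ-∤ p∤i))
        (≈-recip-neg p∤M∸i p∤i (≈-trans (≈-reflexive (#-∸ i≤M))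
          (≈-trans (≈-+ (∣⇒≈0 n∣n) (≈-refl { - # i})) (≈-reflexive (ℚ.+-identityˡ (- # i))))))
        where
        p∤M∸i : ¬ p ∣ M ∸ i
        p∤M∸i p∣M∸i = p∤i (∣m+n∣m⇒∣n (subst (p ∣_) (sym (ℕ.m∸n+n≡m i≤M)) p∣M) p∣M∸i)

  module PrimeResidues (p : ℕ) (p-prime : Prime p) (p≢2 : p ≢ 2) (α : ℕ) where
    open Localization p p-prime
    open UnitProgressions p p-prime p≢2
    open Progressions p p-prime 1 p∤1
    open PrimeReciprocals p p-prime

    private
      P : ℕ
      P = p ℕ.^ suc α

      p∣P : p ∣ P
      p∣P = m∣m*n (p ℕ.^ α)

    ∑-rₚ≈0 : ∑ P rₚ ≈ 0ℚ [ P ]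
    ∑-rₚ≈0 = ≈-trans (≈-reflexive (sym (trans (∑-suc P rₚ) (trans (cong (∑ P rₚ +_) (rₚ-∣ p∣P)) (ℚ.+-identityʳ (∑ P rₚ))))))
      (antisymmetric-∑≈0 P (rₚ-antisymmetric p∣P))

    module _ {e e′ : ℕ} (p∤e′ : ¬ p ∣ e′) (p∤e : ¬ p ∣ e) (p∣e+e′ : p ∣ e ℕ.+ e′) where
      private
        z : ℕ
        z = proj₁ (root e′)

        p∣z+e′ : p ∣ z ℕ.+ e′
        p∣z+e′ = subst (λ w → p ∣ w ℕ.+ e′) (ℕ.*-identityʳ z) (proj₂ (proj₂ (root e′)))

        p∤z : ¬ p ∣ z
        p∤z p∣z = p∤e′ (∣m+n∣m⇒∣n p∣z+e′ p∣z)

        z≈e : # z ≈ # e [ p ]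
        z≈e = ≈-by-difference (≈-trans (≈-reflexive (trans (alg (# z) (# e) (# e′)) (cong₂ _-_ (sym (#-+ z e′)) (sym (#-+ e e′)))))
          (≈-+ (∣⇒≈0 p∣z+e′) (≈-neg (∣⇒≈0 p∣e+e′))))
          where
          alg : ∀ x y w → x - y ≡ x + w - (y + w)
          alg = solve-∀ ℚ-ring

      -- e′ plays the role of -e, so the selected y are xp + z with z the residue of e modulo p and
      -- x < p^α. Replacing 1/z by 1/e is correct only modulo p, which suffices next to the factor
      -- p^α.
      ∑-rₚ-residue≈ : (∑[ y < P ] (⟦ p ∣? y ℕ.+ e′ ⟧ * rₚ y)) ≈ # (p ℕ.^ α) * recip e [ P ]
      ∑-rₚ-residue≈ = begin
        (∑[ y < P ] (⟦ p ∣? y ℕ.+ e′ ⟧ * rₚ y))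
          ≡⟨ trans (cong (λ N → ∑[ y < N ] (⟦ p ∣? y ℕ.+ e′ ⟧ * rₚ y)) (ℕ.*-comm p (p ℕ.^ α)))
               (∑-block (p ℕ.^ α) p (λ y → ⟦ p ∣? y ℕ.+ e′ ⟧ * rₚ y)) ⟩
        (∑[ x < p ℕ.^ α ] ∑[ w < p ] (⟦ p ∣? x ℕ.* p ℕ.+ w ℕ.+ e′ ⟧ * rₚ (x ℕ.* p ℕ.+ w)))
          ≡⟨ ∑-cong (p ℕ.^ α) (λ x _ → trans (∑-cong p λ w _ → cong (_* rₚ (x ℕ.* p ℕ.+ w))
               (trans (cong (λ k → ⟦ p ∣? k ℕ.+ e′ ⟧) (sym (ℕ.*-identityʳ (x ℕ.* p ℕ.+ w)))) (∣-periodic x w e′)))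
               (trans (∑-root e′ (λ w → rₚ (x ℕ.* p ℕ.+ w))) (rₚ-∤ (∤-+multiple x p∤z)))) ⟩
        (∑[ x < p ℕ.^ α ] recip (x ℕ.* p ℕ.+ z))
          ≈⟨ recip-progression α p∤z ⟩
        # (p ℕ.^ α) * recip z
          ≈⟨ subst (# (p ℕ.^ α) * recip z ≈ # (p ℕ.^ α) * recip e [_]) (ℕ.*-comm (p ℕ.^ α) p) (≈-scale (p ℕ.^ α) (≈-recip p∤z p∤e z≈e)) ⟩
        # (p ℕ.^ α) * recip e ∎
        where open ≈-Reasoning P

      -- The sum over all residues vanishes, so minus the excluded class y ≡ e remains.
      ∑-rₚ-shifted≈ : (∑[ y < P ] (rₚ y * ν p (y ℕ.+ e′))) ≈ - (# (p ℕ.^ α) * recip e) [ P ]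
      ∑-rₚ-shifted≈ = begin
        (∑[ y < P ] (rₚ y * ν p (y ℕ.+ e′)))
          ≡⟨ trans (∑-cong P λ y _ → trans (cong (rₚ y *_) (ν≡1- p (y ℕ.+ e′))) (alg (rₚ y) ⟦ p ∣? y ℕ.+ e′ ⟧))
               (∑-+ P rₚ (λ y → - 1ℚ * (⟦ p ∣? y ℕ.+ e′ ⟧ * rₚ y))) ⟩
        ∑ P rₚ + (∑[ y < P ] (- 1ℚ * (⟦ p ∣? y ℕ.+ e′ ⟧ * rₚ y)))
          ≡⟨ cong (∑ P rₚ +_) (∑-*ˡ (- 1ℚ) P (λ y → ⟦ p ∣? y ℕ.+ e′ ⟧ * rₚ y)) ⟩
        ∑ P rₚ + - 1ℚ * (∑[ y < P ] (⟦ p ∣? y ℕ.+ e′ ⟧ * rₚ y))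
          ≈⟨ ≈-+ ∑-rₚ≈0 (≈-*ˡ (int-neg int-1) ∑-rₚ-residue≈) ⟩
        0ℚ + - 1ℚ * (# (p ℕ.^ α) * recip e)
          ≡⟨ alg₂ (# (p ℕ.^ α) * recip e) ⟩
        - (# (p ℕ.^ α) * recip e) ∎
        where
        open ≈-Reasoning P
        alg : ∀ x y → x * (1ℚ - y) ≡ x + - 1ℚ * (y * x)
        alg = solve-∀ ℚ-ring
        alg₂ : ∀ x → 0ℚ + - 1ℚ * x ≡ - x
        alg₂ = solve-∀ ℚ-ring

  module _ (p q : ℕ) (p-prime : Prime p) (q-prime : Prime q) where
    open TwoPrimes p q p-prime q-prime

    χ≡ν*ν : ∀ i → χ i ≡ ν p i * ν q i
    χ≡ν*ν i = by (p ∣? i) (q ∣? i)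
      where
      by : Dec (p ∣ i) → Dec (q ∣ i) → χ i ≡ ν p i * ν q i
      by (yes p∣i) _         = trans (⟦⟧-no (unit? i) λ (p∤i , _) → p∤i p∣i) (sym (trans (cong (_* ν q i) (ν-∣ p∣i)) (ℚ.*-zeroˡ (ν q i))))
      by (no _)    (yes q∣i) = trans (⟦⟧-no (unit? i) λ (_ , q∤i) → q∤i q∣i) (sym (trans (cong (ν p i *_) (ν-∣ q∣i)) (ℚ.*-zeroʳ (ν p i))))
      by (no p∤i)  (no q∤i)  = trans (⟦⟧-yes (unit? i) (p∤i , q∤i)) (sym (cong₂ _*_ (ν-∤ p∤i) (ν-∤ q∤i)))

  -- Evaluation of the residue sum modulo n.

  module ResidueSum (p q : ℕ) (p-prime : Prime p) (q-prime : Prime q) (p≢q : p ≢ q) (p≢2 : p ≢ 2) (q≢2 : q ≢ 2)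
    (α β h : ℕ) (n≡ : suc (h ℕ.+ h) ≡ p ℕ.^ suc α ℕ.* q ℕ.^ suc β) where
    open Localization p p-prime
    open TwoPrimes p q p-prime q-prime
    open Reflection p q p-prime q-prime p≢2 q≢2 α β h n≡
    open TripleCongruences p q p-prime q-prime p≢2 q≢2 α β h n≡
    open Convolution p q p-prime q-prime p≢2 q≢2 α β h n≡
    open PrimeReciprocals p p-prime
    open PrimeResidues p p-prime p≢2 α

    private
      P Q n H : ℕ
      P = p ℕ.^ suc α
      Q = q ℕ.^ suc β
      n = suc (h ℕ.+ h)
      H = suc h

      q∤P : ¬ q ∣ P
      q∤P q∣P = prime∤1 q-prime (subst (q ∣_) (coprime-^ (suc α)
        (∤⇒coprime p-prime λ p∣q → p≢q (prime∣prime⇒≡ p-prime q-prime p∣q)) (q∣P , n∣n)) n∣n)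

      p∣P : p ∣ P
      p∣P = m∣m*n (p ℕ.^ α)

    open Progressions q q-prime P q∤P

    κ : ℚ
    κ = # (q ℕ.^ β) * (# q - # 2)

    int-κ : Integral κ
    int-κ = int-* (int-# (q ℕ.^ β)) (int-- (int-# q) (int-# 2))

    -- As P is invertible modulo q, each of the two excluded classes of x contains q^β of the q ·
    -- q^β values; the classes differ because q does not divide e.
    count-q-units : ∀ {e} → ¬ q ∣ e → ∀ y → (∑[ x < Q ] (ν q (x ℕ.* P ℕ.+ y) * ν q (x ℕ.* P ℕ.+ y ℕ.+ e))) ≡ κ
    count-q-units {e} q∤e y = begin
      (∑[ x < Q ] (ν q (x ℕ.* P ℕ.+ y) * ν q (x ℕ.* P ℕ.+ y ℕ.+ e)))
        ≡⟨ ∑-cong Q (λ x _ → trans (ν*ν (x ℕ.* P ℕ.+ y) q∤e)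
             (trans (alg ⟦ q ∣? x ℕ.* P ℕ.+ y ⟧ ⟦ q ∣? x ℕ.* P ℕ.+ y ℕ.+ e ⟧)
               (cong (λ k → 1ℚ + - 1ℚ * (⟦ q ∣? x ℕ.* P ℕ.+ y ⟧ + ⟦ q ∣? k ⟧)) (ℕ.+-assoc (x ℕ.* P) y e)))) ⟩
      (∑[ x < Q ] (1ℚ + - 1ℚ * (D y x + D (y ℕ.+ e) x)))
        ≡⟨ trans (∑-+ Q (λ _ → 1ℚ) (λ x → - 1ℚ * (D y x + D (y ℕ.+ e) x))) (cong₂ _+_ (∑-const Q 1ℚ)
             (trans (∑-*ˡ (- 1ℚ) Q (λ x → D y x + D (y ℕ.+ e) x)) (cong (- 1ℚ *_) (∑-+ Q (D y) (D (y ℕ.+ e)))))) ⟩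
      # Q * 1ℚ + - 1ℚ * (∑ Q (D y) + ∑ Q (D (y ℕ.+ e)))
        ≡⟨ cong₂ (λ x z → # Q * 1ℚ + - 1ℚ * (x + z)) (count y) (count (y ℕ.+ e)) ⟩
      # Q * 1ℚ + - 1ℚ * (# (q ℕ.^ β) + # (q ℕ.^ β))
        ≡⟨ trans (cong (λ x → x * 1ℚ + - 1ℚ * (# (q ℕ.^ β) + # (q ℕ.^ β))) (#-* q (q ℕ.^ β))) (alg₂ (# q) (# (q ℕ.^ β))) ⟩
      κ ∎
      where
      open ≡-Reasoning
      D : ℕ → ℕ → ℚ
      D d x = ⟦ q ∣? x ℕ.* P ℕ.+ d ⟧
      count : ∀ d → ∑ Q (D d) ≡ # (q ℕ.^ β)
      count d = trans (cong (λ N → ∑ N (D d)) (ℕ.*-comm q (q ℕ.^ β))) (count-roots-periods (q ℕ.^ β) d)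
      alg : ∀ x y → 1ℚ - x - y ≡ 1ℚ + - 1ℚ * (x + y)
      alg = solve-∀ ℚ-ring
      alg₂ : ∀ q b → q * b * 1ℚ + - 1ℚ * (b + b) ≡ b * (q - # 2)
      alg₂ = solve-∀ ℚ-ring

    -- By b = xP + y the sum factors into a sum over y mod P and a count over x mod Q.
    R≈ : ∀ {e} → e ≤ n → Unit e → R e ≈ - (# (p ℕ.^ α) * κ * recip e) [ P ]
    R≈ {e} e≤n ue = begin
      R e
        ≡⟨ trans (cong (λ N → ∑ N f) (trans n≡ (ℕ.*-comm P Q))) (trans (∑-block Q P f) (∑-swap Q P (λ x y → f (x ℕ.* P ℕ.+ y)))) ⟩
      (∑[ y < P ] ∑[ x < Q ] f (x ℕ.* P ℕ.+ y))
        ≈⟨ (≈-∑ P λ y _ → ≈-∑ Q λ x _ → factor x y) ⟩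
      (∑[ y < P ] ∑[ x < Q ] (rₚ y * ν p (y ℕ.+ e′) * (ν q (x ℕ.* P ℕ.+ y) * ν q (x ℕ.* P ℕ.+ y ℕ.+ e′))))
        ≡⟨ trans (∑-cong P λ y _ → trans (∑-*ˡ (rₚ y * ν p (y ℕ.+ e′)) Q (λ x → ν q (x ℕ.* P ℕ.+ y) * ν q (x ℕ.* P ℕ.+ y ℕ.+ e′)))
             (cong (rₚ y * ν p (y ℕ.+ e′) *_) (count-q-units q∤e′ y))) (∑-*ʳ κ P (λ y → rₚ y * ν p (y ℕ.+ e′))) ⟩
      (∑[ y < P ] (rₚ y * ν p (y ℕ.+ e′))) * κ
        ≈⟨ ≈-*ʳ int-κ (∑-rₚ-shifted≈ p∤e′ (proj₁ ue) (subst (p ∣_) (sym (ℕ.m+[n∸m]≡n e≤n)) p∣n)) ⟩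
      - (# (p ℕ.^ α) * recip e) * κ
        ≡⟨ alg₂ (# (p ℕ.^ α)) (recip e) κ ⟩
      - (# (p ℕ.^ α) * κ * recip e) ∎
      where
      open ≈-Reasoning P
      e′ : ℕ
      e′ = n ∸ e
      f : ℕ → ℚ
      f b = r b * χ (b ℕ.+ e′)
      p∤e′ : ¬ p ∣ e′
      p∤e′ = proj₁ (unit-reflect e≤n ue)
      q∤e′ : ¬ q ∣ e′
      q∤e′ = proj₂ (unit-reflect e≤n ue)
      alg : ∀ a b c d e → a * b * c * (d * e) ≡ a * c * d * (b * e)
      alg = solve-∀ ℚ-ring
      alg₂ : ∀ a b c → - (a * b) * c ≡ - (a * c * b)
      alg₂ = solve-∀ ℚ-ring
      factor : ∀ x y → f (x ℕ.* P ℕ.+ y) ≈ rₚ y * ν p (y ℕ.+ e′) * (ν q (x ℕ.* P ℕ.+ y) * ν q (x ℕ.* P ℕ.+ y ℕ.+ e′)) [ P ]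
      factor x y = ≈-trans
        (≈-reflexive (trans (cong₂ (λ u v → u * recip b * v) (χ≡ν*ν p q p-prime q-prime b) (χ≡ν*ν p q p-prime q-prime (b ℕ.+ e′)))
          (trans (alg (ν p b) (ν q b) (recip b) (ν p (b ℕ.+ e′)) (ν q (b ℕ.+ e′)))
          (cong (λ u → rₚ b * u * (ν q b * ν q (b ℕ.+ e′)))
            (trans (cong (ν p) (ℕ.+-assoc (x ℕ.* P) y e′)) (ν-+multiple (y ℕ.+ e′) (∣n⇒∣m*n x p∣P)))))))
        (≈-*ʳ (int-* (int-⟦⟧ (¬? (q ∣? b))) (int-⟦⟧ (¬? (q ∣? b ℕ.+ e′))))
          (≈-*ʳ (int-⟦⟧ (¬? (p ∣? y ℕ.+ e′))) (rₚ-periodic p∣P x y)))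
        where
        b : ℕ
        b = x ℕ.* P ℕ.+ y

    K : ℚ
    K = ∑[ e < H ] (r e * r e * r e)

    -- Every term of the half sum becomes -2 p^α κ/e³. Comparing with -2Z cancels the unit -2.
    Zₙ≈K : Zₙ ≈ # (p ℕ.^ α) * κ * K [ P ]
    Zₙ≈K = ≈-cancel {2} p∤2 (subst₂ _≈_[ P ] (alg (# 2 * Zₙ)) (alg (# 2 * (# (p ℕ.^ α) * κ * K)))
      (≈-neg (≈-trans (≈-sym half-sum≈-2Z) half-sum≈)))
      where
      alg : ∀ x → - - x ≡ x
      alg = solve-∀ ℚ-ring
      alg₂ : ∀ c x → x * (# 2 * (x * - (c * x))) ≡ - (# 2 * c) * (x * x * x)
      alg₂ = solve-∀ ℚ-ring
      alg₃ : ∀ c x → - (# 2 * c) * x ≡ - (# 2 * (c * x))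
      alg₃ = solve-∀ ℚ-ring
      alg₄ : ∀ c x → 0ℚ * x ≡ c * (0ℚ * 0ℚ * 0ℚ)
      alg₄ = solve-∀ ℚ-ring
      coeff : ℚ
      coeff = # (p ℕ.^ α) * κ
      term : ∀ e → e < H → r e * (pairSum e + pairSum (n ∸ e)) ≈ - (# 2 * coeff) * (r e * r e * r e) [ P ]
      term e e<H = by (unit? e)
        where
        by : Dec (Unit e) → r e * (pairSum e + pairSum (n ∸ e)) ≈ - (# 2 * coeff) * (r e * r e * r e) [ P ]
        by (no ¬ue) = ≈-reflexive (trans (cong (_* (pairSum e + pairSum (n ∸ e))) (r-nonunit ¬ue))
          (trans (alg₄ (- (# 2 * coeff)) (pairSum e + pairSum (n ∸ e))) (cong (λ x → - (# 2 * coeff) * (x * x * x)) (sym (r-nonunit ¬ue)))))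
        by (yes ue) = ≈-trans (≈-*ˡ (int-r e) (≈-trans (pairSum-reflect≈ (a≤n e<H) ue)
            (≈-*ˡ (int-# 2) (≈-*ˡ (int-recip (proj₁ ue)) (R≈ (a≤n e<H) ue)))))
          (≈-reflexive (trans (cong (λ x → r e * (# 2 * (x * - (coeff * x)))) (sym (r-unit ue))) (alg₂ coeff (r e))))
      half-sum≈ : (∑[ e < H ] (r e * (pairSum e + pairSum (n ∸ e)))) ≈ - (# 2 * (coeff * K)) [ P ]
      half-sum≈ = ≈-trans (≈-∑ H term) (≈-reflexive (trans (∑-*ˡ (- (# 2 * coeff)) H (λ e → r e * r e * r e)) (alg₃ coeff K)))

  -- Half sums of reciprocal cubes modulo p.

  ∑-block-extra : ∀ M a c f → ∑ (M ℕ.* a ℕ.+ c) f ≡ (∑[ x < M ] ∑[ z < a ] f (x ℕ.* a ℕ.+ z)) + (∑[ z < c ] f (M ℕ.* a ℕ.+ z))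
  ∑-block-extra M a c f = trans (∑-split (M ℕ.* a) c f) (cong (_+ (∑[ z < c ] f (M ℕ.* a ℕ.+ z))) (∑-block M a f))

  -- The lower half of n = (2s + 1)(2k + 1) consists of s full periods of length 2k + 1 and one half
  -- period.
  half-of-product : ∀ {h s k} → suc (h ℕ.+ h) ≡ suc (s ℕ.+ s) ℕ.* suc (k ℕ.+ k) → suc h ≡ s ℕ.* suc (k ℕ.+ k) ℕ.+ suc k
  half-of-product {h} {s} {k} eq = trans (cong suc (double-injective (ℕ.suc-injective (trans eq (alg s k))))) (sym (ℕ.+-suc (s ℕ.* suc (k ℕ.+ k)) k))
    where
    alg : ∀ s k → suc (s ℕ.+ s) ℕ.* suc (k ℕ.+ k) ≡ suc (s ℕ.* suc (k ℕ.+ k) ℕ.+ k ℕ.+ (s ℕ.* suc (k ℕ.+ k) ℕ.+ k))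
    alg = solve-∀ℕ

  module _ (q : ℕ) .{{_ : ℕ.NonZero q}} (f : ℕ → ℚ) where
    private
      g : ℕ → ℚ
      g e = ⟦ q ∣? e ⟧ * f e

      ∑-multiple : ∀ x {c} → 0 < c → c ≤ q → (∑[ w < c ] g (x ℕ.* q ℕ.+ w)) ≡ f (x ℕ.* q)
      ∑-multiple x {c} 0<c c≤q = trans
        (∑-indicator 0<c (λ w → q ∣? x ℕ.* q ℕ.+ w)
          (λ {w} w<c q∣xq+w → small w (ℕ.<-≤-trans w<c c≤q) (∣m+n∣m⇒∣n q∣xq+w (n∣m*n x)))
          (∣m∣n⇒∣m+n (n∣m*n x) (q ∣0)) (λ w → f (x ℕ.* q ℕ.+ w)))
        (cong f (ℕ.+-identityʳ (x ℕ.* q)))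
        where
        small : ∀ w → w < q → q ∣ w → w ≡ 0
        small zero    _   _   = refl
        small (suc w) w<q q∣w = contradiction (∣⇒≤ q∣w) (ℕ.<⇒≱ w<q)

    -- The only multiple of q in a block is its first element. The incomplete last block contains
    -- one too because 0 < c, which accounts for `suc M`.
    ∑-multiples : ∀ M c → 0 < c → c ≤ q → (∑[ e < M ℕ.* q ℕ.+ c ] (⟦ q ∣? e ⟧ * f e)) ≡ (∑[ x < suc M ] f (x ℕ.* q))
    ∑-multiples M c 0<c c≤q = trans (∑-block-extra M q c g) (trans
      (cong₂ _+_ (∑-cong M λ x _ → ∑-multiple x (ℕ.>-nonZero⁻¹ q) ℕ.≤-refl) (∑-multiple M 0<c c≤q))
      (sym (∑-suc M (λ x → f (x ℕ.* q)))))

  module Cubes (p : ℕ) (p-prime : Prime p) (p≢2 : p ≢ 2) (k : ℕ) (p≡ : p ≡ suc (k ℕ.+ k)) where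
    open Localization p p-prime
    open UnitProgressions p p-prime p≢2
    open PrimeReciprocals p p-prime

    cube : ℕ → ℚ
    cube e = rₚ e * rₚ e * rₚ e

    ≈-cube : ∀ {x y} → Integral x → Integral y → x ≈ y [ p ] → x * x * x ≈ y * y * y [ p ]
    ≈-cube xi yi x≈y = ≈-* (int-* xi xi) yi (≈-* xi yi x≈y x≈y) x≈y

    Kₚ : ℚ
    Kₚ = ∑[ e < suc k ] cube e

    ∑-cube≈0 : ∑ p cube ≈ 0ℚ [ p ]
    ∑-cube≈0 = ≈-trans (≈-reflexive (sym (trans (∑-suc p cube) (trans (cong (λ x → ∑ p cube + x * x * x) (rₚ-∣ n∣n)) (ℚ.+-identityʳ (∑ p cube))))))
      (antisymmetric-∑≈0 p λ i i≤p → ≈-trans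
        (≈-cube (int-rₚ (p ∸ i)) (int-neg (int-rₚ i)) (rₚ-antisymmetric n∣n i i≤p)) (≈-reflexive (alg (rₚ i))))
      where
      alg : ∀ x → - x * - x * - x ≡ - (x * x * x)
      alg = solve-∀ ℚ-ring

    cube-periodic : ∀ x y → cube (x ℕ.* p ℕ.+ y) ≈ cube y [ p ]
    cube-periodic x y = ≈-cube (int-rₚ (x ℕ.* p ℕ.+ y)) (int-rₚ y) (rₚ-periodic n∣n x y)

    -- Full periods vanish since e ↦ p - e changes the sign of 1/e³; only the half period is left.
    half-cubes≈ : ∀ s → ∑ (s ℕ.* p ℕ.+ suc k) cube ≈ Kₚ [ p ]
    half-cubes≈ s = ≈-trans (≈-reflexive (∑-block-extra s p (suc k) cube)) (≈-trans
      (≈-+ (≈-trans (≈-∑ s λ x _ → ≈-trans (≈-∑ p λ z _ → cube-periodic x z) ∑-cube≈0) (≈-reflexive (∑-0 s {λ _ → 0ℚ} λ _ _ → refl)))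
           (≈-∑ (suc k) λ z _ → cube-periodic s z))
      (≈-reflexive (ℚ.+-identityˡ Kₚ)))

  module UnitCubes (p q : ℕ) (p-prime : Prime p) (q-prime : Prime q) (p≢q : p ≢ q) (p≢2 : p ≢ 2) (q≢2 : q ≢ 2)
    (k l : ℕ) (p≡ : p ≡ suc (k ℕ.+ k)) (q≡ : q ≡ suc (l ℕ.+ l)) where
    open Localization p p-prime
    open TwoPrimes p q p-prime q-prime
    open PrimeReciprocals p p-prime
    open Cubes p p-prime p≢2 k p≡

    private
      instance
        q-nonZero : ℕ.NonZero q
        q-nonZero = prime⇒nonZero q-prime

      p∤q : ¬ p ∣ q
      p∤q p∣q = p≢q (prime∣prime⇒≡ p-prime q-prime p∣q)

    r³≡ : ∀ e → r e * r e * r e ≡ cube e + - 1ℚ * (⟦ q ∣? e ⟧ * cube e)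
    r³≡ e = trans (cong (λ x → x * recip e * (x * recip e) * (x * recip e)) (χ≡ν*ν p q p-prime q-prime e)) (trans
      (cases (q ∣? e)) (alg₃ (cube e) ⟦ q ∣? e ⟧))
      where
      alg : ∀ x y → x * 0ℚ * y * (x * 0ℚ * y) * (x * 0ℚ * y) ≡ (1ℚ - 1ℚ) * (x * y * (x * y) * (x * y))
      alg = solve-∀ ℚ-ring
      alg₂ : ∀ x y → x * 1ℚ * y * (x * 1ℚ * y) * (x * 1ℚ * y) ≡ (1ℚ - 0ℚ) * (x * y * (x * y) * (x * y))
      alg₂ = solve-∀ ℚ-ring
      alg₃ : ∀ c d → (1ℚ - d) * c ≡ c + - 1ℚ * (d * c)
      alg₃ = solve-∀ ℚ-ring
      cases : Dec (q ∣ e) → ν p e * ν q e * recip e * (ν p e * ν q e * recip e) * (ν p e * ν q e * recip e) ≡ (1ℚ - ⟦ q ∣? e ⟧) * cube e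
      cases (yes q∣e) = trans (cong (λ x → ν p e * x * recip e * (ν p e * x * recip e) * (ν p e * x * recip e)) (ν-∣ q∣e))
        (trans (alg (ν p e) (recip e)) (cong (λ d → (1ℚ - d) * cube e) (sym (⟦⟧-yes (q ∣? e) q∣e))))
      cases (no q∤e) = trans (cong (λ x → ν p e * x * recip e * (ν p e * x * recip e) * (ν p e * x * recip e)) (ν-∤ q∤e))
        (trans (alg₂ (ν p e) (recip e)) (cong (λ d → (1ℚ - d) * cube e) (sym (⟦⟧-no (q ∣? e) q∤e))))

    cube-multiple : ∀ x → cube (x ℕ.* q) ≡ recip (q ℕ.^ 3) * cube x
    cube-multiple x = trans (cong (λ y → y * y * y) rₚ-multiple) (trans (alg (rₚ x) (recip q)) (cong (_* cube x) (sym recip-q³)))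
      where
      recip-q³ : recip (q ℕ.^ 3) ≡ recip q * (recip q * (recip q * 1ℚ))
      recip-q³ = trans (recip-* q (q ℕ.^ 2)) (cong (recip q *_) (trans (recip-* q (q ℕ.^ 1)) (cong (recip q *_) (recip-* q 1))))
      alg : ∀ x y → x * y * (x * y) * (x * y) ≡ y * (y * (y * 1ℚ)) * (x * x * x)
      alg = solve-∀ ℚ-ring
      rₚ-multiple : rₚ (x ℕ.* q) ≡ rₚ x * recip q
      rₚ-multiple = trans (cong₂ _*_
        (⟦⟧-cong (¬? (p ∣? x ℕ.* q)) (¬? (p ∣? x)) (λ p∤xq p∣x → p∤xq (∣m⇒∣m*n q p∣x))
          (λ p∤x p∣xq → [ p∤x , p∤q ]′ (euclidsLemma x q p-prime p∣xq)))
        (recip-* x q)) (sym (ℚ.*-assoc (ν p x) (recip x) (recip q)))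

    -- With n = (2s+1)p = (2t+1)q and 2t+1 = (2u+1)p, the e < n/2 divisible by q are the qx with x < n/(2q).
    ∑-r³≈ : ∀ {h s t u} → suc h ≡ s ℕ.* p ℕ.+ suc k → suc h ≡ t ℕ.* q ℕ.+ suc l → suc t ≡ u ℕ.* p ℕ.+ suc k →
      (∑[ e < suc h ] (r e * r e * r e)) ≈ (1ℚ - recip (q ℕ.^ 3)) * Kₚ [ p ]
    ∑-r³≈ {h} {s} {t} {u} h≡s h≡t t≡u = begin
      (∑[ e < suc h ] (r e * r e * r e))
        ≡⟨ trans (∑-cong (suc h) λ e _ → r³≡ e) (trans (∑-+ (suc h) cube (λ e → - 1ℚ * (⟦ q ∣? e ⟧ * cube e)))
             (cong (∑ (suc h) cube +_) (∑-*ˡ (- 1ℚ) (suc h) (λ e → ⟦ q ∣? e ⟧ * cube e)))) ⟩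
      ∑ (suc h) cube + - 1ℚ * (∑[ e < suc h ] (⟦ q ∣? e ⟧ * cube e))
        ≡⟨ cong₂ (λ N x → ∑ N cube + - 1ℚ * x) h≡s (trans (cong (λ N → ∑[ e < N ] (⟦ q ∣? e ⟧ * cube e)) h≡t)
             (trans (∑-multiples q cube t (suc l) (s≤s z≤n) (subst (suc l ≤_) (sym q≡) (s≤s (ℕ.m≤m+n l l))))
             (trans (∑-cong (suc t) λ x _ → cube-multiple x) (trans (∑-*ˡ (recip (q ℕ.^ 3)) (suc t) cube)
               (cong (λ N → recip (q ℕ.^ 3) * ∑ N cube) t≡u))))) ⟩
      ∑ (s ℕ.* p ℕ.+ suc k) cube + - 1ℚ * (recip (q ℕ.^ 3) * ∑ (u ℕ.* p ℕ.+ suc k) cube)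
        ≈⟨ ≈-+ (half-cubes≈ s) (≈-*ˡ (int-neg int-1) (≈-*ˡ (int-recip (∤-* p∤q (∤-* p∤q (∤-* p∤q p∤1)))) (half-cubes≈ u))) ⟩
      Kₚ + - 1ℚ * (recip (q ℕ.^ 3) * Kₚ)
        ≡⟨ alg Kₚ (recip (q ℕ.^ 3)) ⟩
      (1ℚ - recip (q ℕ.^ 3)) * Kₚ ∎
      where
      open ≈-Reasoning p
      open UnitProgressions p p-prime p≢2 using (p∤1)
      alg : ∀ x y → x + - 1ℚ * (y * x) ≡ (1ℚ - y) * x
      alg = solve-∀ ℚ-ring

  -- Power sums and the Bernoulli recursion.

  nC0≡1 : ∀ n → n C 0 ≡ 1
  nC0≡1 n = trans (nCk≡nC[n∸k] {0} {n} z≤n) (nCn≡1 n)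

  [1+n]Cn≡1+n : ∀ n → suc n C n ≡ suc n
  [1+n]Cn≡1+n n = trans (nCk≡nC[n∸k] {n} {suc n} (ℕ.n≤1+n n)) (trans (cong (suc n C_) (ℕ.m+n∸n≡m 1 n)) (nC1≡n (suc n)))

  ∤! : ∀ {p} → Prime p → ∀ {k} → k < p → ¬ p ∣ k !
  ∤! pp {zero}  k<p p∣1  = prime∤1 pp p∣1
  ∤! pp {suc k} k<p p∣k! = [ (λ p∣k+1 → ℕ.<⇒≱ k<p (∣⇒≤ p∣k+1)) , ∤! pp (ℕ.<-trans (ℕ.n<1+n k) k<p) ]′ (euclidsLemma (suc k) (k !) pp p∣k!)

  prime∣binomial : ∀ {p} → Prime p → ∀ {i} → 0 < i → i < p → p ∣ p C i
  prime∣binomial {p} pp {i} 0<i i<p = [ (λ p∣C → p∣C) , (λ p∣d → contradiction p∣d p∤d) ]′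
    (euclidsLemma (p C i) d pp (subst (p ∣_) (sym C*d≡p!) p∣p!))
    where
    instance
      d≢0 : ℕ.NonZero (i ! ℕ.* (p ∸ i) !)
      d≢0 = i !* (p ∸ i) !≢0
    d : ℕ
    d = i ! ℕ.* (p ∸ i) !
    C*d≡p! : (p C i) ℕ.* d ≡ p !
    C*d≡p! = trans (cong (ℕ._* d) (nCk≡n!/k![n-k]! (ℕ.<⇒≤ i<p))) (m/n*n≡m (k![n∸k]!∣n! (ℕ.<⇒≤ i<p)))
    n∣n! : ∀ n .{{_ : ℕ.NonZero n}} → n ∣ n !
    n∣n! (suc n) = m∣m*n (n !)
    p∣p! : p ∣ p !
    p∣p! = n∣n! p {{prime⇒nonZero pp}}
    p∤d : ¬ p ∣ d
    p∤d p∣d = [ ∤! pp i<p , ∤! pp (ℕ.∸-monoʳ-< {p} {i} {0} 0<i (ℕ.<⇒≤ i<p)) ]′ (euclidsLemma (i !) ((p ∸ i) !) pp p∣d)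

  binomial-theorem : ∀ x m → # (suc x ℕ.^ m) ≡ (∑[ i < suc m ] (# (m C i) * # (x ℕ.^ i)))
  binomial-theorem x zero    = sym (∑-1 (λ i → # (0 C i) * # (x ℕ.^ i)))
  binomial-theorem x (suc m) = begin
    # (suc x ℕ.* suc x ℕ.^ m)
      ≡⟨ trans (#-* (suc x) (suc x ℕ.^ m)) (cong₂ _*_ (#-suc x) (binomial-theorem x m)) ⟩
    (1ℚ + # x) * ∑ (suc m) T
      ≡⟨ trans (ℚ.*-distribʳ-+ (∑ (suc m) T) 1ℚ (# x)) (cong₂ _+_ (ℚ.*-identityˡ (∑ (suc m) T)) (sym (∑-*ˡ (# x) (suc m) T))) ⟩
    ∑ (suc m) T + (∑[ i < suc m ] (# x * T i))
      ≡⟨ cong₂ _+_ low (∑-cong (suc m) λ i _ → trans (alg (# x) (# (m C i)) (# (x ℕ.^ i))) (cong (# (m C i) *_) (sym (#-* x (x ℕ.^ i))))) ⟩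
    # (suc m C 0) * # 1 + (∑[ i < suc m ] (# (m C suc i) * # (x ℕ.^ suc i))) + (∑[ i < suc m ] (# (m C i) * # (x ℕ.^ suc i)))
      ≡⟨ trans (ℚ.+-assoc (# (suc m C 0) * # 1) (∑[ i < suc m ] (# (m C suc i) * # (x ℕ.^ suc i))) (∑[ i < suc m ] (# (m C i) * # (x ℕ.^ suc i))))
           (cong (# (suc m C 0) * # 1 +_) (trans (sym (∑-+ (suc m) (λ i → # (m C suc i) * # (x ℕ.^ suc i)) (λ i → # (m C i) * # (x ℕ.^ suc i))))
           (∑-cong (suc m) λ i _ → pascal i))) ⟩
    # (suc m C 0) * # (x ℕ.^ 0) + (∑[ i < suc m ] (# (suc m C suc i) * # (x ℕ.^ suc i)))
      ≡⟨ sym (∑-head (suc m) (λ i → # (suc m C i) * # (x ℕ.^ i))) ⟩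
    (∑[ i < suc (suc m) ] (# (suc m C i) * # (x ℕ.^ i))) ∎
    where
    open ≡-Reasoning
    T : ℕ → ℚ
    T i = # (m C i) * # (x ℕ.^ i)
    alg : ∀ x c y → x * (c * y) ≡ c * (x * y)
    alg = solve-∀ ℚ-ring
    alg₂ : ∀ a b y → b * y + a * y ≡ (a + b) * y
    alg₂ = solve-∀ ℚ-ring
    pascal : ∀ i → # (m C suc i) * # (x ℕ.^ suc i) + # (m C i) * # (x ℕ.^ suc i) ≡ # (suc m C suc i) * # (x ℕ.^ suc i)
    pascal i = trans (alg₂ (# (m C i)) (# (m C suc i)) (# (x ℕ.^ suc i))) (cong (_* # (x ℕ.^ suc i))
      (trans (sym (#-+ (m C i) (m C suc i))) (cong # (nCk+nC[k+1]≡[n+1]C[k+1] m i))))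
    low : ∑ (suc m) T ≡ # (suc m C 0) * # 1 + (∑[ i < suc m ] T (suc i))
    low = begin
      ∑ (suc m) T
        ≡⟨ sym (trans (∑-suc (suc m) T) (trans (cong (λ c → ∑ (suc m) T + # c * # (x ℕ.^ suc m)) (k>n⇒nCk≡0 (ℕ.n<1+n m)))
             (trans (cong (∑ (suc m) T +_) (ℚ.*-zeroˡ (# (x ℕ.^ suc m)))) (ℚ.+-identityʳ (∑ (suc m) T))))) ⟩
      ∑ (suc (suc m)) T
        ≡⟨ ∑-head (suc m) T ⟩
      # (m C 0) * # 1 + (∑[ i < suc m ] T (suc i))
        ≡⟨ cong (λ c → # c * # 1 + (∑[ i < suc m ] T (suc i))) (trans (nC0≡1 m) (sym (nC0≡1 (suc m)))) ⟩
      # (suc m C 0) * # 1 + (∑[ i < suc m ] T (suc i)) ∎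

  ∑-telescope : ∀ n (f : ℕ → ℚ) → (∑[ x < n ] (f (suc x) - f x)) ≡ f n - f 0
  ∑-telescope zero    f = trans (∑-0 0 λ _ ()) (sym (ℚ.+-inverseʳ (f 0)))
  ∑-telescope (suc n) f = trans (∑-suc n (λ x → f (suc x) - f x)) (trans (cong (_+ (f (suc n) - f n)) (∑-telescope n f)) (alg (f n) (f 0) (f (suc n))))
    where
    alg : ∀ x y z → x - y + (z - x) ≡ z - y
    alg = solve-∀ ℚ-ring

  powerSum : ℕ → ℕ → ℚ
  powerSum N m = ∑[ x < N ] # (x ℕ.^ m)

  -- Sum (x + 1)^(m+1) - x^(m+1) over x < N. The coefficients are those of the Bernoulli recursion,
  -- with N^(m+1) in place of 0.
  powerSum-recurrence : ∀ N m → # (N ℕ.^ suc m) ≡ (∑[ i < suc m ] (# (suc m C i) * powerSum N i))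
  powerSum-recurrence N m = begin
    # (N ℕ.^ suc m)
      ≡⟨ sym (ℚ.+-identityʳ (# (N ℕ.^ suc m))) ⟩
    # (N ℕ.^ suc m) - # (0 ℕ.^ suc m)
      ≡⟨ sym (∑-telescope N (λ x → # (x ℕ.^ suc m))) ⟩
    (∑[ x < N ] (# (suc x ℕ.^ suc m) - # (x ℕ.^ suc m)))
      ≡⟨ ∑-cong N (λ x _ → difference x) ⟩
    (∑[ x < N ] ∑[ i < suc m ] (# (suc m C i) * # (x ℕ.^ i)))
      ≡⟨ trans (∑-swap N (suc m) (λ x i → # (suc m C i) * # (x ℕ.^ i))) (∑-cong (suc m) λ i _ → ∑-*ˡ (# (suc m C i)) N (λ x → # (x ℕ.^ i))) ⟩
    (∑[ i < suc m ] (# (suc m C i) * powerSum N i)) ∎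
    where
    open ≡-Reasoning
    alg : ∀ s y → s + 1ℚ * y - y ≡ s
    alg = solve-∀ ℚ-ring
    difference : ∀ x → # (suc x ℕ.^ suc m) - # (x ℕ.^ suc m) ≡ (∑[ i < suc m ] (# (suc m C i) * # (x ℕ.^ i)))
    difference x = trans (cong (_- # (x ℕ.^ suc m)) (trans (binomial-theorem x (suc m)) (trans (∑-suc (suc m) (λ i → # (suc m C i) * # (x ℕ.^ i)))
        (cong (λ c → (∑[ i < suc m ] (# (suc m C i) * # (x ℕ.^ i))) + # c * # (x ℕ.^ suc m)) (nCn≡1 (suc m))))))
      (alg (∑[ i < suc m ] (# (suc m C i) * # (x ℕ.^ i))) (# (x ℕ.^ suc m)))

  lookup-∷ʳ : ∀ {n} (xs : Vec ℚ n) (x : ℚ) (f : ℕ → ℚ) → (∀ i → lookup xs i ≡ f (toℕ i)) → x ≡ f n → ∀ i → lookup (xs ∷ʳ x) i ≡ f (toℕ i)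
  lookup-∷ʳ []       x f eq x≡ Fin.zero    = x≡
  lookup-∷ʳ (y ∷ xs) x f eq x≡ Fin.zero    = eq Fin.zero
  lookup-∷ʳ (y ∷ xs) x f eq x≡ (Fin.suc i) = lookup-∷ʳ xs x (f ∘ suc) (eq ∘ Fin.suc) x≡ i

  foldr-tabulate : ∀ n {A : Set} (h : Fin n → A) (g : A → ℚ) (G : ℕ → ℚ) → (∀ i → g (h i) ≡ G (toℕ i)) →
    Vec.foldr (λ _ → ℚ) (λ i acc → g i + acc) 0ℚ (tabulate h) ≡ ∑ n G
  foldr-tabulate zero    h g G eq = sym (∑-0 0 λ _ ())
  foldr-tabulate (suc n) h g G eq = trans (cong₂ _+_ (eq Fin.zero) (foldr-tabulate n (h ∘ Fin.suc) g (G ∘ suc) (eq ∘ Fin.suc))) (sym (∑-head n G))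

  nextBernoulli : ℕ → ℚ
  nextBernoulli n = - (recip (suc (suc n)) *
    Vec.foldr (λ _ → ℚ) (λ (i : Fin (suc n)) acc → # (suc (suc n) C toℕ i) * lookup (bernoulliVec n) i + acc) 0ℚ (Vec.allFin (suc n)))

  bernoulli≡next : ∀ n → bernoulli (suc n) ≡ nextBernoulli n
  bernoulli≡next n = last-∷ʳ (nextBernoulli n) (bernoulliVec n)

  -- Extending the vector leaves its earlier entries unchanged; this frees the recursion from the
  -- vector that stores it.
  lookup-bernoulliVec : ∀ n i → lookup (bernoulliVec n) i ≡ bernoulli (toℕ i)
  lookup-bernoulliVec zero    Fin.zero = refl
  lookup-bernoulliVec (suc n) i = lookup-∷ʳ (bernoulliVec n) (nextBernoulli n) bernoulli (lookup-bernoulliVec n) (sym (bernoulli≡next n)) i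

  bernoulli-suc : ∀ n → bernoulli (suc n) ≡ - (recip (suc (suc n)) * (∑[ i < suc n ] (# (suc (suc n) C i) * bernoulli i)))
  bernoulli-suc n = trans (bernoulli≡next n) (cong (λ s → - (recip (suc (suc n)) * s))
    (foldr-tabulate (suc n) (λ i → i) (λ i → # (suc (suc n) C toℕ i) * lookup (bernoulliVec n) i) (λ i → # (suc (suc n) C i) * bernoulli i)
      λ i → cong (# (suc (suc n) C toℕ i) *_) (lookup-bernoulliVec n i)))

  ^-distribʳ-* : ∀ j x y → (x ℕ.* y) ℕ.^ j ≡ x ℕ.^ j ℕ.* y ℕ.^ j
  ^-distribʳ-* zero    x y = refl
  ^-distribʳ-* (suc j) x y = trans (cong (x ℕ.* y ℕ.*_) (^-distribʳ-* j x y)) (alg x y (x ℕ.^ j) (y ℕ.^ j))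
    where
    alg : ∀ x y u v → x ℕ.* y ℕ.* (u ℕ.* v) ≡ x ℕ.* u ℕ.* (y ℕ.* v)
    alg = solve-∀ℕ

  -- Bernoulli numbers and half power sums modulo p².

  module PowerSums (p : ℕ) (p-prime : Prime p) (p≢2 : p ≢ 2) (k : ℕ) (p≡ : p ≡ suc (k ℕ.+ k)) where
    open Localization p p-prime
    open UnitProgressions p p-prime p≢2
    open PrimeReciprocals p p-prime
    open Cubes p p-prime p≢2 k p≡

    ∤-small : ∀ {i} → 0 < i → i < p → ¬ p ∣ i
    ∤-small 0<i i<p = >⇒∤ {{ℕ.>-nonZero 0<i}} i<p

    -- Induction on a, the inner binomial coefficients being divisible by p. The exponent is p
    -- written as 2k + 1, so that the exponent p - 1 is 2k in `fermat`.
    fermat′ : ∀ a → # (a ℕ.^ suc (k ℕ.+ k)) ≈ # a [ p ]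
    fermat′ zero    = ≈-refl
    fermat′ (suc x) = begin
      # (suc x ℕ.^ m)
        ≡⟨ trans (binomial-theorem x m) (trans (∑-suc m T) (cong (_+ T m) (∑-head (k ℕ.+ k) T))) ⟩
      T 0 + (∑[ i < k ℕ.+ k ] T (suc i)) + T m
        ≡⟨ cong₂ (λ u v → # u * # 1 + (∑[ i < k ℕ.+ k ] T (suc i)) + # v * # (x ℕ.^ m)) (nC0≡1 m) (nCn≡1 m) ⟩
      1ℚ + (∑[ i < k ℕ.+ k ] T (suc i)) + 1ℚ * # (x ℕ.^ m)
        ≈⟨ ≈-+ (≈-+ (≈-refl {1ℚ}) (≈-trans (≈-∑ (k ℕ.+ k) middle) (≈-reflexive (∑-0 (k ℕ.+ k) {λ _ → 0ℚ} λ _ _ → refl))))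
               (≈-*ˡ int-1 (fermat′ x)) ⟩
      1ℚ + 0ℚ + 1ℚ * # x
        ≡⟨ trans (alg (# x)) (sym (#-suc x)) ⟩
      # (suc x) ∎
      where
      open ≈-Reasoning p
      m : ℕ
      m = suc (k ℕ.+ k)
      T : ℕ → ℚ
      T i = # (m C i) * # (x ℕ.^ i)
      alg : ∀ y → 1ℚ + 0ℚ + 1ℚ * y ≡ 1ℚ + y
      alg = solve-∀ ℚ-ring
      middle : ∀ i → i < k ℕ.+ k → T (suc i) ≈ 0ℚ [ p ]
      middle i i<2k = ≈-trans (≈-*ʳ (int-# (x ℕ.^ suc i)) (∣⇒≈0 (subst (λ n → p ∣ n C suc i) p≡
        (prime∣binomial p-prime (s≤s z≤n) (subst (suc i <_) (sym p≡) (s≤s i<2k)))))) (≈-reflexive (ℚ.*-zeroˡ (# (x ℕ.^ suc i))))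

    fermat : ∀ {a} → ¬ p ∣ a → # (a ℕ.^ (k ℕ.+ k)) ≈ 1ℚ [ p ]
    fermat {a} p∤a = ≈-cancel {a} p∤a (subst₂ _≈_[ p ] (#-* a (a ℕ.^ (k ℕ.+ k))) (sym (ℚ.*-identityʳ (# a))) (fermat′ a))

    PowerSum≈Bernoulli : ℕ → Set
    PowerSum≈Bernoulli m = Integral (bernoulli m) × powerSum p m ≈ # p * bernoulli m [ p ℕ.* p ]

    p²∣p^ : ∀ m → p ℕ.* p ∣ p ℕ.^ suc (suc m)
    p²∣p^ m = subst (p ℕ.* p ∣_) (ℕ.*-assoc p p (p ℕ.^ m)) (m∣m*n (p ℕ.^ m))

    -- For m ≥ 1 the term p^(m+1) vanishes modulo p², so the power sums and p times the Bernoulli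
    -- numbers obey the same recursion. Its leading coefficient m + 1 is a unit because m + 1 < p,
    -- which also gives the integrality of the Bernoulli number.
    powerSum-step : ∀ m → suc m < p → (∀ i → i < m → PowerSum≈Bernoulli i) → PowerSum≈Bernoulli m
    powerSum-step zero    _   _  = int-1 , ≈-reflexive (∑-const p 1ℚ)
    powerSum-step (suc m) M<p IH = subst Integral (sym B≡) (int-neg (int-* (int-recip p∤M) int-S)) , ≈-cancel {M} p∤M (begin
      # M * s
        ≡⟨ trans (alg L (# M * s)) (cong (_- L) (sym recurrence)) ⟩
      # (p ℕ.^ M) - L
        ≈⟨ ≈-+ (∣⇒≈0 (p²∣p^ m)) (≈-neg L≈) ⟩
      0ℚ - # p * S
        ≡⟨ alg₂ (# p) S ⟩
      # p * - (1ℚ * S)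
        ≡⟨ cong (λ x → # p * - (x * S)) (sym (recip-inverse M)) ⟩
      # p * - (# M * recip M * S)
        ≡⟨ alg₃ (# p) (# M) (recip M) S ⟩
      # M * (# p * - (recip M * S))
        ≡⟨ cong (λ x → # M * (# p * x)) (sym B≡) ⟩
      # M * (# p * bernoulli (suc m)) ∎)
      where
      open ≈-Reasoning (p ℕ.* p)
      M : ℕ
      M = suc (suc m)
      S L s : ℚ
      S = ∑[ i < suc m ] (# (M C i) * bernoulli i)
      L = ∑[ i < suc m ] (# (M C i) * powerSum p i)
      s = powerSum p (suc m)
      p∤M : ¬ p ∣ M
      p∤M = ∤-small (s≤s z≤n) M<p
      B≡ : bernoulli (suc m) ≡ - (recip M * S)
      B≡ = bernoulli-suc m
      int-S : Integral S
      int-S = int-∑ (suc m) λ i i<1+m → int-* (int-# (M C i)) (proj₁ (IH i i<1+m))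
      recurrence : # (p ℕ.^ M) ≡ L + # M * s
      recurrence = trans (powerSum-recurrence p (suc m)) (trans (∑-suc (suc m) (λ i → # (M C i) * powerSum p i))
        (cong (λ c → L + # c * s) ([1+n]Cn≡1+n (suc m))))
      L≈ : L ≈ # p * S [ p ℕ.* p ]
      L≈ = ≈-trans (≈-∑ (suc m) λ i i<1+m → ≈-trans (≈-*ˡ (int-# (M C i)) (proj₂ (IH i i<1+m)))
          (≈-reflexive (alg₄ (# (M C i)) (# p) (bernoulli i))))
        (≈-reflexive (∑-*ˡ (# p) (suc m) (λ i → # (M C i) * bernoulli i)))
        where
        alg₄ : ∀ c p b → c * (p * b) ≡ p * (c * b)
        alg₄ = solve-∀ ℚ-ring
      alg : ∀ l x → x ≡ l + x - l
      alg = solve-∀ ℚ-ring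
      alg₂ : ∀ p s → 0ℚ - p * s ≡ p * - (1ℚ * s)
      alg₂ = solve-∀ ℚ-ring
      alg₃ : ∀ p m r s → p * - (m * r * s) ≡ m * (p * - (r * s))
      alg₃ = solve-∀ ℚ-ring

    powerSum≈-below : ∀ m → m < p → ∀ i → i < m → PowerSum≈Bernoulli i
    powerSum≈-below (suc m) 1+m<p i i<1+m with ℕ.m≤n⇒m<n∨m≡n (ℕ.≤-pred i<1+m)
    ... | inj₁ i<m  = powerSum≈-below m (ℕ.<-trans (ℕ.n<1+n m) 1+m<p) i i<m
    ... | inj₂ refl = powerSum-step m 1+m<p (powerSum≈-below m (ℕ.<-trans (ℕ.n<1+n m) 1+m<p))

    powerSum≈ : ∀ m → suc m < p → PowerSum≈Bernoulli m
    powerSum≈ m 1+m<p = powerSum≈-below (suc m) 1+m<p m (ℕ.n<1+n m)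

    -- The even exponent m is 2t + 2, and x^m appears as x · x^(m−1).
    power-reflect : ∀ t {x y} → y ≡ p ∸ x → x ≤ p →
      # (y ℕ.^ suc (suc (t ℕ.+ t))) ≈ # x * # (x ℕ.^ suc (t ℕ.+ t)) - # (suc (suc (t ℕ.+ t))) * (# p * # (x ℕ.^ suc (t ℕ.+ t))) [ p ℕ.* p ]
    power-reflect t {x} refl x≤p = go t
      where
      y : ℕ
      y = p ∸ x
      u v P : ℚ
      u = # x
      v = # y
      P = # p
      v≡ : v ≡ P - u
      v≡ = #-∸ x≤p
      int-y : Integral v
      int-y = int-# y
      square : ∀ {z} → Integral z → ∀ w → w + P * P * z ≈ w [ p ℕ.* p ]
      square {z} zi w = congruent z zi (cong (λ m → w + m * z) (sym (#-* p p)))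
      #^2 : ∀ a j → # (a ℕ.^ suc (suc j)) ≡ # a * (# a * # (a ℕ.^ j))
      #^2 a j = trans (#-* a (a ℕ.^ suc j)) (cong (# a *_) (#-* a (a ℕ.^ j)))
      base : ∀ P u → (P - u) * ((P - u) * 1ℚ) ≡ u * (u * 1ℚ) - # 2 * (P * (u * 1ℚ)) + P * P * 1ℚ
      base = solve-∀ ℚ-ring
      -- Multiplication by (p - x)² raises the exponent by 2. The p² terms are collected at the end,
      -- where `square` discards them.
      step : ∀ P u w m → (P - u) * ((P - u) * (u * w - m * (P * w)))
        ≡ u * (u * (u * w)) - (# 2 + m) * (P * (u * (u * w))) + P * P * (# 2 * m * (u * w) + u * w - m * (P * w))
      step = solve-∀ ℚ-ring
      go : ∀ t → # (y ℕ.^ suc (suc (t ℕ.+ t))) ≈ u * # (x ℕ.^ suc (t ℕ.+ t)) - # (suc (suc (t ℕ.+ t))) * (P * # (x ℕ.^ suc (t ℕ.+ t))) [ p ℕ.* p ]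
      go zero = begin
        # (y ℕ.^ 2)
          ≡⟨ trans (#^2 y 0) (trans (cong (λ z → z * (z * 1ℚ)) v≡) (base P u)) ⟩
        u * (u * 1ℚ) - # 2 * (P * (u * 1ℚ)) + P * P * 1ℚ
          ≈⟨ square int-1 (u * (u * 1ℚ) - # 2 * (P * (u * 1ℚ))) ⟩
        u * (u * 1ℚ) - # 2 * (P * (u * 1ℚ))
          ≡⟨ cong (λ w → u * w - # 2 * (P * w)) (sym (#-* x 1)) ⟩
        u * # (x ℕ.^ 1) - # 2 * (P * # (x ℕ.^ 1)) ∎
        where open ≈-Reasoning (p ℕ.* p)
      go (suc t) = subst (λ j → # (y ℕ.^ suc (suc (suc j))) ≈ u * # (x ℕ.^ suc (suc j)) - # (suc (suc (suc j))) * (P * # (x ℕ.^ suc (suc j))) [ p ℕ.* p ])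
        (sym (ℕ.+-suc t t)) (begin
        # (y ℕ.^ suc (suc m))
          ≡⟨ #^2 y m ⟩
        v * (v * # (y ℕ.^ m))
          ≈⟨ ≈-*ˡ int-y (≈-*ˡ int-y (go t)) ⟩
        v * (v * (u * w - # m * (P * w)))
          ≡⟨ trans (cong (λ z → z * (z * (u * w - # m * (P * w)))) v≡) (step P u w (# m)) ⟩
        u * (u * (u * w)) - (# 2 + # m) * (P * (u * (u * w))) + P * P * (# 2 * # m * (u * w) + u * w - # m * (P * w))
          ≈⟨ square (int-- (int-+ (int-* (int-* (int-# 2) (int-# m)) (int-* (int-# x) int-w)) (int-* (int-# x) int-w)) (int-* (int-# m) (int-* (int-# p) int-w)))
               (u * (u * (u * w)) - (# 2 + # m) * (P * (u * (u * w)))) ⟩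
        u * (u * (u * w)) - (# 2 + # m) * (P * (u * (u * w)))
          ≡⟨ cong₂ (λ a b → u * a - b * (P * a)) (sym (#^2 x (suc (t ℕ.+ t)))) (sym (#-+ 2 m)) ⟩
        u * # (x ℕ.^ suc (suc (suc (t ℕ.+ t)))) - # (suc (suc m)) * (P * # (x ℕ.^ suc (suc (suc (t ℕ.+ t))))) ∎)
        where
        open ≈-Reasoning (p ℕ.* p)
        m : ℕ
        m = suc (suc (t ℕ.+ t))
        w : ℚ
        w = # (x ℕ.^ suc (t ℕ.+ t))
        int-w : Integral w
        int-w = int-# (x ℕ.^ suc (t ℕ.+ t))

    module _ (t : ℕ) (k≡ : k ≡ suc (suc t)) where
      private
        -- m = p - 3 and o = p - 4, so that x^o ≡ 1/x³ modulo p for units x.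
        o m H : ℕ
        o = suc (t ℕ.+ t)
        m = suc o
        H = suc k

        f : ℕ → ℚ
        f x = # (x ℕ.^ m)

        2k≡ : k ℕ.+ k ≡ suc (suc (suc o))
        2k≡ = trans (cong (λ k → k ℕ.+ k) k≡) (alg t)
          where
          alg : ∀ t → suc (suc t) ℕ.+ suc (suc t) ≡ suc (suc (suc (suc (t ℕ.+ t))))
          alg = solve-∀ℕ

        p≡m+3 : p ≡ suc (suc (suc m))
        p≡m+3 = trans p≡ (cong suc 2k≡)

      module _ (φ : ℕ → ℕ) (φ≤p : ∀ a → a < H → φ a ≤ p) (split : ∀ f → ∑ (suc p) f ≡ (∑[ a < H ] f (φ a)) + (∑[ a < H ] f (p ∸ φ a))) where
        -- x is paired with p - x. The term of (p - x)^m linear in p brings in the sum of powers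
        -- with exponent m - 1.
        ∑-power≈ : ∑ (suc p) f ≈ # 2 * (∑[ a < H ] # (φ a ℕ.^ m)) - # m * (# p * (∑[ a < H ] # (φ a ℕ.^ o))) [ p ℕ.* p ]
        ∑-power≈ = begin
          ∑ (suc p) f
            ≡⟨ split f ⟩
          S + (∑[ a < H ] f (p ∸ φ a))
            ≈⟨ ≈-+ (≈-refl {S}) (≈-∑ H λ a a<H → power-reflect t refl (φ≤p a a<H)) ⟩
          S + (∑[ a < H ] (# (φ a) * # (φ a ℕ.^ o) - # m * (# p * # (φ a ℕ.^ o))))
            ≡⟨ cong (S +_) (trans (∑-cong H λ a _ → cong₂ _+_ (sym (#-* (φ a) (φ a ℕ.^ o))) (alg (# m) (# p) (# (φ a ℕ.^ o))))
                 (trans (∑-+ H (λ a → # (φ a ℕ.^ m)) (λ a → - (# m * # p) * # (φ a ℕ.^ o))) (cong (S +_) (∑-*ˡ (- (# m * # p)) H (λ a → # (φ a ℕ.^ o)))))) ⟩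
          S + (S + - (# m * # p) * Y)
            ≡⟨ alg₂ S (# m) (# p) Y ⟩
          # 2 * S - # m * (# p * Y) ∎
          where
          open ≈-Reasoning (p ℕ.* p)
          S Y : ℚ
          S = ∑[ a < H ] # (φ a ℕ.^ m)
          Y = ∑[ a < H ] # (φ a ℕ.^ o)
          alg : ∀ m p w → - (m * (p * w)) ≡ - (m * p) * w
          alg = solve-∀ ℚ-ring
          alg₂ : ∀ s m p y → s + (s + - (m * p) * y) ≡ # 2 * s - m * (p * y)
          alg₂ = solve-∀ ℚ-ring

      private
        S Y T F B : ℚ
        S = ∑[ a < H ] # (a ℕ.^ m)
        Y = ∑[ a < H ] # (a ℕ.^ o)
        T = # (2 ℕ.^ o)
        F = ∑ (suc p) f
        B = bernoulli m

        2a≤p : ∀ a → a < H → a ℕ.+ a ≤ p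
        2a≤p a a<H = subst (a ℕ.+ a ≤_) (sym p≡) (ℕ.≤-trans (ℕ.+-mono-≤ (ℕ.≤-pred a<H) (ℕ.≤-pred a<H)) (ℕ.n≤1+n (k ℕ.+ k)))

        int-Y : Integral Y
        int-Y = int-∑ H λ a _ → int-# (a ℕ.^ o)

      half-power : F ≈ # 2 * S - # m * (# p * Y) [ p ℕ.* p ]
      half-power = ∑-power≈ (λ a → a) (λ a a<H → ℕ.≤-trans (ℕ.m≤m+n a a) (2a≤p a a<H))
        (λ f → subst (λ p → ∑ (suc p) f ≡ (∑[ a < H ] f a) + (∑[ a < H ] f (p ∸ a))) (sym p≡) (∑-split-half k f))

      double-power : F ≈ # 2 * (# 2 * T * S) - # m * (# p * (T * Y)) [ p ℕ.* p ]
      double-power = ≈-trans (∑-power≈ (λ a → a ℕ.+ a) 2a≤p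
          (λ f → subst (λ p → ∑ (suc p) f ≡ (∑[ a < H ] f (a ℕ.+ a)) + (∑[ a < H ] f (p ∸ (a ℕ.+ a)))) (sym p≡) (∑-split-parity k f)))
        (≈-reflexive (cong₂ (λ x y → # 2 * x - # m * (# p * y))
          (trans (scaled m) (cong (_* S) (#-* 2 (2 ℕ.^ o)))) (scaled o)))
        where
        scaled : ∀ j → (∑[ a < H ] # ((a ℕ.+ a) ℕ.^ j)) ≡ # (2 ℕ.^ j) * (∑[ a < H ] # (a ℕ.^ j))
        scaled j = trans (∑-cong H λ a _ → trans (cong # (trans (cong (ℕ._^ j) (alg a)) (^-distribʳ-* j 2 a))) (#-* (2 ℕ.^ j) (a ℕ.^ j)))
          (∑-*ˡ (# (2 ℕ.^ j)) H (λ a → # (a ℕ.^ j)))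
          where
          alg : ∀ a → a ℕ.+ a ≡ 2 ℕ.* a
          alg = solve-∀ℕ

      F≈pB : F ≈ # p * B [ p ℕ.* p ]
      F≈pB = ≈-trans (≈-reflexive (∑-suc p f)) (≈-trans
        (≈-+ (proj₂ (powerSum≈ m (subst (suc m <_) (sym p≡m+3) (ℕ.m<n⇒m<1+n (ℕ.n<1+n (suc m)))))) (∣⇒≈0 (p²∣p^ (t ℕ.+ t))))
        (≈-reflexive (ℚ.+-identityʳ (# p * B))))

      int-B : Integral B
      int-B = proj₁ (powerSum≈ m (subst (suc m <_) (sym p≡m+3) (ℕ.m<n⇒m<1+n (ℕ.n<1+n (suc m)))))

      -- The case of multiplier 2 in Voronoi's congruence, 2T being 2^m. Subtracting 2T times
      -- `half-power` from `double-power` eliminates S; everything left is divisible by p, and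
      -- dividing by p reduces the modulus from p² to p.
      voronoi : (1ℚ - # 2 * T) * B ≈ # m * (T * Y) [ p ]
      voronoi = ≈-unscale p {{prime⇒nonZero p-prime}} (begin
        # p * ((1ℚ - # 2 * T) * B)
          ≡⟨ alg (# p) T B ⟩
        # p * B + - (# 2 * T) * (# p * B)
          ≈⟨ ≈-+ (≈-trans (≈-sym F≈pB) double-power) (≈-*ˡ (int-neg (int-* (int-# 2) (int-# (2 ℕ.^ o)))) (≈-trans (≈-sym F≈pB) half-power)) ⟩
        # 2 * (# 2 * T * S) - # m * (# p * (T * Y)) + - (# 2 * T) * (# 2 * S - # m * (# p * Y))
          ≡⟨ alg₂ T S Y (# m) (# p) ⟩
        # p * (# m * (T * Y)) ∎)
        where
        open ≈-Reasoning (p ℕ.* p)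
        alg : ∀ p t b → p * ((1ℚ - # 2 * t) * b) ≡ p * b + - (# 2 * t) * (p * b)
        alg = solve-∀ ℚ-ring
        alg₂ : ∀ t s y m p → # 2 * (# 2 * t * s) - m * (p * (t * y)) + - (# 2 * t) * (# 2 * s - m * (p * y)) ≡ p * (m * (t * y))
        alg₂ = solve-∀ ℚ-ring

      #^2k : ∀ a → # (a ℕ.^ (k ℕ.+ k)) ≡ # a * (# a * (# a * # (a ℕ.^ o)))
      #^2k a = trans (cong (λ j → # (a ℕ.^ j)) 2k≡) (trans (#-* a (a ℕ.^ suc (suc o))) (cong (# a *_)
        (trans (#-* a (a ℕ.^ suc o)) (cong (# a *_) (#-* a (a ℕ.^ o))))))

      8T≈1 : # 8 * T ≈ 1ℚ [ p ]
      8T≈1 = ≈-trans (≈-reflexive (trans (alg T) (sym (#^2k 2)))) (fermat λ p∣2 → p≢2 (prime∣prime⇒≡ p-prime (from-yes (prime? 2)) p∣2))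
        where
        alg : ∀ x → # 8 * x ≡ # 2 * (# 2 * (# 2 * x))
        alg = solve-∀ ℚ-ring

      m≈-3 : # m ≈ - # 3 [ p ]
      m≈-3 = ≈-trans (≈-reflexive (trans (alg (# m)) (cong (_- # 3) (trans (sym (#-+ 3 m)) (cong # (sym p≡m+3))))))
        (≈-trans (≈-+ (∣⇒≈0 n∣n) (≈-refl { - # 3})) (≈-reflexive (ℚ.+-identityˡ (- # 3))))
        where
        alg : ∀ x → x ≡ # 3 + x - # 3
        alg = solve-∀ ℚ-ring

      -- Since 8T = 2^(p-1) ≡ 1 and m = p - 3 ≡ -3, eight times `voronoi` reads 6B ≡ -3Y. Here p ≥
      -- 5, so 3 is a unit.
      Y≈-2B : Y ≈ - (# 2 * B) [ p ]
      Y≈-2B = ≈-trans (≈-reflexive (alg₅ Y)) (≈-neg (≈-sym (≈-cancel {3} p∤3 (begin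
        # 3 * (# 2 * B)
          ≡⟨ alg B ⟩
        # 8 * B + - # 2 * (1ℚ * B)
          ≈⟨ ≈-+ (≈-refl {# 8 * B}) (≈-*ˡ (int-neg (int-# 2)) (≈-*ʳ int-B (≈-sym 8T≈1))) ⟩
        # 8 * B + - # 2 * (# 8 * T * B)
          ≡⟨ alg₂ T B ⟩
        # 8 * ((1ℚ - # 2 * T) * B)
          ≈⟨ ≈-*ˡ (int-# 8) voronoi ⟩
        # 8 * (# m * (T * Y))
          ≡⟨ alg₃ T Y (# m) ⟩
        # m * (# 8 * T * Y)
          ≈⟨ ≈-* (int-# m) (int-* int-1 int-Y) m≈-3 (≈-*ʳ int-Y 8T≈1) ⟩
        - # 3 * (1ℚ * Y)
          ≡⟨ alg₄ Y ⟩
        # 3 * - Y ∎))))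
        where
        open ≈-Reasoning p
        p∤3 : ¬ p ∣ 3
        p∤3 = ∤-small (s≤s z≤n) (subst (3 <_) (sym p≡m+3) (s≤s (s≤s (s≤s (s≤s z≤n)))))
        alg : ∀ b → # 3 * (# 2 * b) ≡ # 8 * b + - # 2 * (1ℚ * b)
        alg = solve-∀ ℚ-ring
        alg₂ : ∀ t b → # 8 * b + - # 2 * (# 8 * t * b) ≡ # 8 * ((1ℚ - # 2 * t) * b)
        alg₂ = solve-∀ ℚ-ring
        alg₃ : ∀ t y m → # 8 * (m * (t * y)) ≡ m * (# 8 * t * y)
        alg₃ = solve-∀ ℚ-ring
        alg₄ : ∀ y → - # 3 * (1ℚ * y) ≡ # 3 * - y
        alg₄ = solve-∀ ℚ-ring
        alg₅ : ∀ y → y ≡ - - y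
        alg₅ = solve-∀ ℚ-ring

      -- Fermat's theorem gives 1/a³ ≡ a^(p-4). At a = 0 both sides are 0, the exponent `o` being a
      -- successor.
      cube≈power : ∀ a → a < H → cube a ≈ # (a ℕ.^ o) [ p ]
      cube≈power zero    _   = ≈-reflexive (cong (λ x → x * x * x) (rₚ-∣ (p ∣0)))
      cube≈power a@(suc a′) a<H = begin
        cube a
          ≡⟨ trans (cong (λ x → x * x * x) (rₚ-∤ p∤a)) (sym (ℚ.*-identityʳ (recip a * recip a * recip a))) ⟩
        recip a * recip a * recip a * 1ℚ
          ≈⟨ ≈-*ˡ (int-* (int-* (int-recip p∤a) (int-recip p∤a)) (int-recip p∤a)) (≈-sym (fermat p∤a)) ⟩
        recip a * recip a * recip a * # (a ℕ.^ (k ℕ.+ k))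
          ≡⟨ trans (cong (recip a * recip a * recip a *_) (#^2k a)) (alg (recip a) (# a) (# (a ℕ.^ o))) ⟩
        (# a * recip a) * (# a * recip a) * (# a * recip a) * # (a ℕ.^ o)
          ≡⟨ trans (cong (λ x → x * x * x * # (a ℕ.^ o)) (recip-inverse a)) (ℚ.*-identityˡ (# (a ℕ.^ o))) ⟩
        # (a ℕ.^ o) ∎
        where
        open ≈-Reasoning p
        p∤a : ¬ p ∣ a
        p∤a = ∤-small (s≤s z≤n) (subst (a <_) (sym p≡) (s≤s (ℕ.≤-trans (ℕ.≤-pred a<H) (ℕ.m≤m+n k k))))
        alg : ∀ r a w → r * r * r * (a * (a * (a * w))) ≡ (a * r) * (a * r) * (a * r) * w
        alg = solve-∀ ℚ-ring

      Kₚ≈-2B : Kₚ ≈ - (# 2 * bernoulli (p ∸ 3)) [ p ]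
      Kₚ≈-2B = ≈-trans (≈-∑ H cube≈power) (≈-trans Y≈-2B (≈-reflexive (cong (λ j → - (# 2 * bernoulli j)) (sym (cong (_∸ 3) p≡m+3)))))

  -- For p = 3 the exponent p - 4 would be negative, so this case is checked directly: the half sum
  -- is 1, B₀ = 1, and 1 = -2 + 3 · 1.
  Kₚ≈ : ∀ p p-prime p≢2 k (p≡ : p ≡ suc (k ℕ.+ k)) → let open Localization p p-prime in
    Cubes.Kₚ p p-prime p≢2 k p≡ ≈ - (# 2 * bernoulli (p ∸ 3)) [ p ]
  Kₚ≈ p p-prime p≢2 zero          refl = contradiction (divides 1 refl) (prime∤1 p-prime)
  Kₚ≈ p p-prime p≢2 1             refl = ≈-trans (≈-reflexive Kₚ≡1) (congruent 1ℚ int-1 refl)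
    where
    open Localization 3 p-prime
    open Cubes 3 p-prime p≢2 1 refl
    open PrimeReciprocals 3 p-prime
    Kₚ≡1 : Kₚ ≡ 1ℚ
    Kₚ≡1 = trans (∑-suc 1 cube) (trans (cong₂ _+_ (trans (∑-1 cube) (cong (λ x → x * x * x) (rₚ-∣ (3 ∣0))))
      (cong (λ x → x * x * x) (rₚ-∤ (prime∤1 p-prime)))) refl)
  Kₚ≈ p p-prime p≢2 (suc (suc t)) p≡ = PowerSums.Kₚ≈-2B p p-prime p≢2 (suc (suc t)) p≡ t refl

  -- Odd divisors of n and assembly of the congruences.

  even-or-odd : ∀ n → (∃ λ k → n ≡ k ℕ.+ k) ⊎ (∃ λ k → n ≡ suc (k ℕ.+ k))
  even-or-odd zero    = inj₁ (0 , refl)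
  even-or-odd (suc n) with even-or-odd n
  ... | inj₁ (k , refl) = inj₂ (k , refl)
  ... | inj₂ (k , refl) = inj₁ (suc k , cong suc (sym (ℕ.+-suc k k)))

  Odd : ℕ → Set
  Odd n = ∃ λ k → n ≡ suc (k ℕ.+ k)

  odd-prime : ∀ {p} → Prime p → p ≢ 2 → Odd p
  odd-prime {p} p-prime p≢2 with even-or-odd p
  ... | inj₂ odd      = odd
  ... | inj₁ (k , p≡) = contradiction (sym (prime∣prime⇒≡ (from-yes (prime? 2)) p-prime (divides k (trans p≡ (alg k))))) p≢2
    where
    alg : ∀ k → k ℕ.+ k ≡ k ℕ.* 2
    alg = solve-∀ℕ

  odd-* : ∀ {m n} → Odd m → Odd n → Odd (m ℕ.* n)
  odd-* (k , refl) (l , refl) = k ℕ.+ l ℕ.+ 2 ℕ.* (k ℕ.* l) , alg k l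
    where
    alg : ∀ k l → suc (k ℕ.+ k) ℕ.* suc (l ℕ.+ l) ≡ suc (k ℕ.+ l ℕ.+ 2 ℕ.* (k ℕ.* l) ℕ.+ (k ℕ.+ l ℕ.+ 2 ℕ.* (k ℕ.* l)))
    alg = solve-∀ℕ

  odd-^ : ∀ {m} a → Odd m → Odd (m ℕ.^ a)
  odd-^ zero    odd = 0 , refl
  odd-^ (suc a) odd = odd-* odd (odd-^ a odd)

  half-quotient : ∀ {p m n} ((k , _) : Odd p) ((s , _) : Odd m) ((h , _) : Odd n) → n ≡ m ℕ.* p → suc h ≡ s ℕ.* p ℕ.+ suc k
  half-quotient (k , refl) (s , refl) (h , refl) eq = half-of-product {h} {s} {k} eq

  module MainCongruences (p q α β : ℕ) (p-prime : Prime p) (q-prime : Prime q) (p≢q : p ≢ q) (p≢2 : p ≢ 2) (q≢2 : q ≢ 2) where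
    open Localization p p-prime
    open PrimeProducts p q p-prime q-prime

    private
      P n : ℕ
      P = p ℕ.^ suc α
      n = P ℕ.* q ℕ.^ suc β

      p-odd : Odd p
      p-odd = odd-prime p-prime p≢2
      q-odd : Odd q
      q-odd = odd-prime q-prime q≢2
      n-odd : Odd n
      n-odd = odd-* (odd-^ (suc α) p-odd) (odd-^ (suc β) q-odd)
      n/p-odd : Odd (p ℕ.^ α ℕ.* q ℕ.^ suc β)
      n/p-odd = odd-* (odd-^ α p-odd) (odd-^ (suc β) q-odd)
      n/q-odd : Odd (P ℕ.* q ℕ.^ β)
      n/q-odd = odd-* (odd-^ (suc α) p-odd) (odd-^ β q-odd)
      n/pq-odd : Odd (p ℕ.^ α ℕ.* q ℕ.^ β)
      n/pq-odd = odd-* (odd-^ α p-odd) (odd-^ β q-odd)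

      k l h : ℕ
      k = proj₁ p-odd
      l = proj₁ q-odd
      h = proj₁ n-odd

      n≡ : suc (h ℕ.+ h) ≡ n
      n≡ = sym (proj₂ n-odd)

    open TwoPrimes p q p-prime q-prime
    open Reflection p q p-prime q-prime p≢2 q≢2 α β h n≡ using (p∤2)
    open TripleCongruences p q p-prime q-prime p≢2 q≢2 α β h n≡
    open ResidueSum p q p-prime q-prime p≢q p≢2 q≢2 α β h n≡
    open Cubes p p-prime p≢2 k (proj₂ p-odd)
    open UnitCubes p q p-prime q-prime p≢q p≢2 q≢2 k l (proj₂ p-odd) (proj₂ q-odd)

    private
      p∤16 : ¬ p ∣ 16
      p∤16 = ∤-* {2} {8} p∤2 (∤-* {2} {4} p∤2 (∤-* {2} {2} p∤2 p∤2))

      p∤q : ¬ p ∣ q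
      p∤q p∣q = p≢q (prime∣prime⇒≡ p-prime q-prime p∣q)

    Z≡Zₙ : Z n ≡ Zₙ
    Z≡Zₙ = trans (Z≡∑³ α β) (cong (λ m → ∑³ (suc m) (sumTo m r)) (sym n≡))

    odd-sum≡ : odd-sum n ≡ oddʳ
    odd-sum≡ = trans (cong odd-sum (sym n≡)) odd-sum≡oddʳ

    odd-sum≈Z : odd-sum n ≈ (ℤ.+ 7 / 16) * Z n [ P ]
    odd-sum≈Z = ≈-cancel p∤16 (subst₂ _≈_[ P ] (cong (# 16 *_) (sym odd-sum≡)) (trans (cong (# 7 *_) (sym Z≡Zₙ)) (alg (Z n))) 16odd≈7Z)
      where
      alg : ∀ z → # 7 * z ≡ # 16 * ((ℤ.+ 7 / 16) * z)
      alg = solve-∀ ℚ-ring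

    K≈ : K ≈ (1ℚ - recip (q ℕ.^ 3)) * - (# 2 * bernoulli (p ∸ 3)) [ p ]
    K≈ = ≈-trans
      (∑-r³≈ {h} {s = proj₁ n/p-odd} {t = proj₁ n/q-odd} {u = proj₁ n/pq-odd}
        (half-quotient p-odd n/p-odd n-odd (alg p (p ℕ.^ α) (q ℕ.^ suc β)))
        (half-quotient q-odd n/q-odd n-odd (alg₂ P q (q ℕ.^ β)))
        (half-quotient p-odd n/pq-odd n/q-odd (alg p (p ℕ.^ α) (q ℕ.^ β))))
      (≈-*ˡ (int-- int-1 (int-recip (∤-* p∤q (∤-* p∤q (∤-* p∤q (prime∤1 p-prime)))))) (Kₚ≈ p p-prime p≢2 k (proj₂ p-odd)))
      where
      alg : ∀ p a b → p ℕ.* a ℕ.* b ≡ a ℕ.* b ℕ.* p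
      alg = solve-∀ℕ
      alg₂ : ∀ a q b → a ℕ.* (q ℕ.* b) ≡ a ℕ.* b ℕ.* q
      alg₂ = solve-∀ℕ

    Z≈Bernoulli : (ℤ.+ 7 / 16) * Z n ≈
      (ℤ.+ 7 / 8) * (# 2 - # q) * (# 1 - recip (q ℕ.^ 3)) * # (p ℕ.^ α ℕ.* q ℕ.^ β) * bernoulli (p ∸ 3) [ P ]
    Z≈Bernoulli = begin
      (ℤ.+ 7 / 16) * Z n
        ≡⟨ cong ((ℤ.+ 7 / 16) *_) Z≡Zₙ ⟩
      (ℤ.+ 7 / 16) * Zₙ
        ≈⟨ ≈-*ˡ int-7/16 Zₙ≈K ⟩
      (ℤ.+ 7 / 16) * (# (p ℕ.^ α) * κ * K)
        ≡⟨ alg (# (p ℕ.^ α)) κ K ⟩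
      (ℤ.+ 7 / 16) * (κ * (# (p ℕ.^ α) * K))
        ≈⟨ ≈-*ˡ int-7/16 (≈-*ˡ int-κ (subst (# (p ℕ.^ α) * K ≈ # (p ℕ.^ α) * ((1ℚ - recip (q ℕ.^ 3)) * - (# 2 * bernoulli (p ∸ 3))) [_])
             (ℕ.*-comm (p ℕ.^ α) p) (≈-scale (p ℕ.^ α) K≈))) ⟩
      (ℤ.+ 7 / 16) * (κ * (# (p ℕ.^ α) * ((1ℚ - recip (q ℕ.^ 3)) * - (# 2 * bernoulli (p ∸ 3)))))
        -- The constant comes from (7/16)(q - 2)(-2) = (7/8)(2 - q).
        ≡⟨ trans (alg₂ (# (q ℕ.^ β)) (# q) (# (p ℕ.^ α)) (recip (q ℕ.^ 3)) (bernoulli (p ∸ 3)))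
             (cong (λ m → (ℤ.+ 7 / 8) * (# 2 - # q) * (# 1 - recip (q ℕ.^ 3)) * m * bernoulli (p ∸ 3)) (sym (#-* (p ℕ.^ α) (q ℕ.^ β)))) ⟩
      (ℤ.+ 7 / 8) * (# 2 - # q) * (# 1 - recip (q ℕ.^ 3)) * # (p ℕ.^ α ℕ.* q ℕ.^ β) * bernoulli (p ∸ 3) ∎
      where
      open ≈-Reasoning P
      int-7/16 : Integral (ℤ.+ 7 / 16)
      int-7/16 = integral 16 (ℤ.+ 7) p∤16 refl
      alg : ∀ a c k → (ℤ.+ 7 / 16) * (a * c * k) ≡ (ℤ.+ 7 / 16) * (c * (a * k))
      alg = solve-∀ ℚ-ring
      alg₂ : ∀ b q a r B → (ℤ.+ 7 / 16) * (b * (q - # 2) * (a * ((1ℚ - r) * - (# 2 * B))))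
        ≡ (ℤ.+ 7 / 8) * (# 2 - q) * (# 1 - r) * (a * b) * B
      alg₂ = solve-∀ ℚ-ring

    main : let mid = (ℤ.+ 7 / 16) * Z n
               rhs = (ℤ.+ 7 / 8) * (# 2 - # q) * (# 1 - recip (q ℕ.^ 3)) * # (p ℕ.^ α ℕ.* q ℕ.^ β) * bernoulli (p ∸ 3)
           in (odd-sum n ≡ mid [modℚ p ^ suc α ]) × (mid ≡ rhs [modℚ p ^ suc α ])
    main = ≈⇒≡-mod (suc α) odd-sum≈Z , ≈⇒≡-mod (suc α) Z≈Bernoulli

open import Data.Nat using (ℕ; _*_; _^_; _∸_; _≥_)
open import Relation.Binary.PropositionalEquality using (_≢_)
open import Data.Integer using (+_)
open import Data.Rational using (ℚ; _/_) renaming (_*_ to _*ℚ_; _-_ to _-ℚ_)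

theorem3 : (p q α β : ℕ) → Prime p → Prime q → p ≢ q → p ≢ 2 → q ≢ 2 → α ≥ 1 → β ≥ 1 →
    let n = p ^ α * q ^ β
        S = tripleSum n (λ i j k → inP (p * q) i ∧ inP (p * q) j ∧ inP (p * q) k ∧ isOdd i ∧ isOdd j ∧ isOdd k) recip3
        mid = (+ 7 / 16) *ℚ Z n
        rhs = (+ 7 / 8) *ℚ (ℕtoℚ 2 -ℚ ℕtoℚ q) *ℚ (ℕtoℚ 1 -ℚ recip (q ^ 3)) *ℚ ℕtoℚ (p ^ (α ∸ 1) * q ^ (β ∸ 1)) *ℚ bernoulli (p ∸ 3)
    in (S ≡ mid [modℚ p ^ α ]) × (mid ≡ rhs [modℚ p ^ α ])
-- With both exponents written as successors, α ∸ 1 and β ∸ 1 reduce to the exponents used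
-- throughout.
theorem3 p q (suc α) (suc β) p-prime q-prime p≢q p≢2 q≢2 _ _ =
  TripleReciprocalSums.MainCongruences.main p q α β p-prime q-prime p≢q p≢2 q≢2
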